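{- Let $\widehat\alpha_k=q^{3r^2-2r}-q^{3r^2-r}$ if $k=3r-1$, $\widehat\alpha_k=q^{3r^2+r}$ if $k=3r$, $\widehat\alpha_k=-q^{3r^2+2r}$ if $k=3r+1$. Then for every integer $p\ge1$, every positive integer $N$ and every primitive $N$th root of unity $q$, $$-\frac12+H_p^{(2)}(q)=q^p\left(\sum_{k=0}^{N-2}(-1)^kq^{ -\binom{k+1}{2}+p(k^2+2k)}\widehat\alpha_k+\frac12q^{ -p}\widehat\alpha_{N-1}\right).$$
   Context: $(a)_n=\prod_{k=1}^n(1-aq^{k-1})$, $\begin{bmatrix} n\\ k\end{bmatrix}=\frac{(q)_n}{(q)_{n-k}(q)_k}$. $H_p^{(2)}(q)=\sum_{n_p\ge\cdots\ge n_1\ge0}q^{n_p}(q^{n_p})_{n_p}\prod_{i=1}^{p-1}q^{n_i^2}\begin{bmatrix} n_{i+1}\\ n_i\end{bmatrix}$; at a root of unity only finitely many terms are nonzero. (In the paper $\widehat\alpha_k=\frac{1-q}{1-q^{k+1}}\alpha_k$ where $\alpha_k=\frac{1-q^{k+1}}{1-q}\widehat\alpha_k$ is part of a Bailey pair relative to $q^2$.) -}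

module Defs where

open import Level using (Level)
open import Data.Nat as ℕ using (ℕ; zero; suc; _∸_; _<_; _≤_)
open import Data.Nat.Combinatorics using (_C_)
open import Data.Integer as ℤ using (ℤ; +_; -[1+_])
open import Data.Sum using (_⊎_)
open import Relation.Nullary using (¬_)
open import Algebra.Bundles using (CommutativeRing)

module _ {c ℓ : Level} (R : CommutativeRing c ℓ) where
  open CommutativeRing R

  pow : Carrier → ℕ → Carrier
  pow x zero    = 1#
  pow x (suc n) = x * pow x n

  natR : ℕ → Carrier
  natR zero    = 0#
  natR (suc n) = 1# + natR n

  IsIntegralDomain : Set (c Level.⊔ ℓ)
  IsIntegralDomain = (¬ (1# ≈ 0#)) ×' (∀ x y → x * y ≈ 0# → x ≈ 0# ⊎ y ≈ 0#)
    where
    open import Data.Product using () renaming (_×_ to _×'_)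

  CharZero : Set ℓ
  CharZero = ∀ n → ¬ (natR (suc n) ≈ 0#)

  PrimitiveRoot : ℕ → Carrier → Set ℓ
  PrimitiveRoot N q = (pow q N ≈ 1#) ×' (∀ k → 0 < k → k < N → ¬ (pow q k ≈ 1#))
    where
    open import Data.Product using () renaming (_×_ to _×'_)

  sumBelow : ℕ → (ℕ → Carrier) → Carrier
  sumBelow zero    f = 0#
  sumBelow (suc n) f = sumBelow n f + f n

  module _ (q : Carrier) where

    poch : Carrier → ℕ → Carrier
    poch a zero    = 1#
    poch a (suc n) = poch a n * (1# - a * pow q n)

    -- Gaussian binomial [n k] as the polynomial in q (q-Pascal rule),
    -- evaluated at q:  [n;k] = [n-1;k-1] + q^k [n-1;k]
    gauss : ℕ → ℕ → Carrier
    gauss n       zero    = 1#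
    gauss zero    (suc k) = 0#
    gauss (suc n) (suc k) = gauss n k + pow q (suc k) * gauss n (suc k)

    -- inner j m = Σ_{m ≥ n_j ≥ ... ≥ n_1 ≥ 0} ∏ q^{n_i^2} [n_{i+1}; n_i]   (n_{j+1} = m)
    inner : ℕ → ℕ → Carrier
    inner zero    m = 1#
    inner (suc j) m = sumBelow (suc m) (λ n → pow q (n ℕ.* n) * gauss m n * inner j n)

    -- H_p^{(2)}(q) with the outermost index n_p truncated to n_p < M
    Htrunc : ℕ → ℕ → Carrier
    Htrunc p M = sumBelow M (λ m → pow q m * poch (pow q m) m * inner (p ∸ 1) m)

    -- \widehat α_k : go r k' computes \widehat α_{3r + k'}
    alphaHatFrom : ℕ → ℕ → Carrier
    alphaHatFrom r zero             = pow q (3 ℕ.* r ℕ.* r ℕ.+ r)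
    alphaHatFrom r (suc zero)       = - pow q (3 ℕ.* r ℕ.* r ℕ.+ 2 ℕ.* r)
    alphaHatFrom r (suc (suc zero)) =                                               -- k = 3(r+1)-1
      pow q (3 ℕ.* suc r ℕ.* suc r ∸ 2 ℕ.* suc r) - pow q (3 ℕ.* suc r ℕ.* suc r ∸ suc r)
    alphaHatFrom r (suc (suc (suc k))) = alphaHatFrom (suc r) k

    alphaHat : ℕ → Carrier
    alphaHat k = alphaHatFrom 0 k

    -- integer powers, given an inverse qi of q
    zpow : Carrier → ℤ → Carrier
    zpow qi (+ n)      = pow q n
    zpow qi -[1+ n ]   = pow qi (suc n)

    -- right-hand side of Theorem 2.15 (h plays the role of 1/2, qi of q^{-1})
    rhs : Carrier → Carrier → ℕ → ℕ → Carrier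
    rhs qi h N p =
      pow q p * ( sumBelow (N ∸ 1)
                    (λ k → pow (- 1#) k
                           * zpow qi (ℤ.- (+ (suc k C 2)) ℤ.+ (+ (p ℕ.* (k ℕ.* k ℕ.+ 2 ℕ.* k))))
                           * alphaHat k)
                + h * pow qi p * alphaHat (N ∸ 1) )

{-# OPTIONS --safe #-}

-- Write w n = q^(p n²), β i = (-1)^i q^(i(i+1)/2) and α̂ for alphaHat.
-- Iterating Bailey's lemma with a = 1 from the unit Bailey pair, and splitting [2m; m-n] into [2m-1; m-n]
-- and [2m-1; m-n-1] so that the sum telescopes, gives for m ≥ 1
--   (q^m)_m inner_(p-1)(m) = Σ_{i<m} β i (w i - w (i+1)) [2m-1; m-1-i].
-- At a primitive N-th root of unity [N-1-b; c]_q = (-1)^c q^(-c(c+1)/2) [b+c; c]_{1/q}, which turns the sum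
-- over m into Schur's polynomial Σ_c (-1)^c q^(c(1-c)/2) [L-c; c]_{1/q} = ez L at L = N-2-2i.  That polynomial
-- is zero or a signed power of q, with period three in L, and H becomes
--   1 + Σ_{i<⌊N/2⌋} β i q^(i+1) (w i - w (i+1)) ez (N-2-2i).
-- On the right-hand side w n = w (N-n) pairs the terms n = k+1 and N-n.  With l = N-2n the identity
--   α̂ (n+l-1) = q^n α̂ (n-1) + q^(n²+n) ez l + q^((n+1)²) ez (l-2)
-- shows that each pair is a difference of two consecutive coefficients on the left, and summation by parts
-- concludes.
module Submission where

open import Defs
open import Level using (Level)
open import Data.Nat using (ℕ; _≤_)
open import Algebra.Bundles using (CommutativeRing)

open import Data.Nat as ℕ using (zero; suc; _<_; _∸_; z≤n; s≤s; z<s; s<s)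
import Data.Nat.Properties as ℕₚ
open import Data.Nat.Tactic.RingSolver using (solve-∀)
open import Data.Nat.DivMod using (_/_; _%_; m≡m%n+[m/n]*n; m%n<n)
open import Data.Nat.Combinatorics using (nC1≡n; nCk+nC[k+1]≡[n+1]C[k+1]) renaming (_C_ to _choose_)
open import Data.Integer as ℤ using (ℤ; +_; -[1+_])
import Data.Integer.Properties as ℤₚ
open import Data.Product using (_×_; _,_; proj₁; proj₂; ∃-syntax)
open import Data.Sum using (_⊎_; inj₁; inj₂)
open import Data.Empty using (⊥-elim)
open import Data.Maybe using (Maybe; map)
open import Relation.Nullary using (¬_; yes; no)
open import Relation.Nullary.Decidable using (dec⇒maybe)
open import Relation.Binary.PropositionalEquality as ≡ using (_≡_)
open import Algebra.Bundles using (RawRing)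
open import Algebra.Solver.Ring.AlmostCommutativeRing
  using (_-Raw-AlmostCommutative⟶_; fromCommutativeRing)

-- The obstacle is the factor 1 + q^m. The Bailey chain yields the formula for (q^m)_m
-- inner_(p-1)(m) only multiplied by this factor, which is zero when q^m = -1, for instance at m =
-- N/2 for even N. Instead of passing through an indeterminate q, the chain is proved over every
-- commutative ring, at every q and without division, and is then applied over the dual numbers
-- R[ε]; characteristic zero enters there. Division is avoided throughout because (q)_n vanishes at
-- the root of unity for n ≥ N: binomials are handled by Pascal rules, and Bailey pairs have cleared
-- denominators. The coefficient 1/2 reflects the symmetry n -> N - n of the right-hand side: n = N
-- would be paired with n = 0, which is not a term of the sum. Since α̂ (N-1) = 1 + 2 q ez (N-2),
-- half of it is 1/2 plus exactly the boundary term that summation by parts leaves over.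

-- Ring normalisation with integer coefficients.

module IntegerCoefficients {c ℓ : Level} (R : CommutativeRing c ℓ) where
  open CommutativeRing R hiding (zero)
  open import Algebra.Properties.Ring ring
  open import Algebra.Properties.AbelianGroup +-abelianGroup using (⁻¹-∙-comm; ε⁻¹≈ε)
  open import Algebra.Properties.Semiring.Mult.TCOptimised semiring
    using (1+×; ×-homo-+; ×1-homo-*) renaming (_×_ to _·_)
  open import Relation.Binary.Reasoning.Setoid setoid

  -- Equality in `R` need not be decidable, so the solver takes its coefficients in ℤ and maps them
  -- to `R` by this homomorphism; constants and cancellations are then settled by computation.
  ⟦_⟧ℤ : ℤ → Carrier
  ⟦ + n ⟧ℤ      = n · 1#
  ⟦ -[1+ n ] ⟧ℤ = - (suc n · 1#)

  neg-homo : ∀ i → ⟦ ℤ.- i ⟧ℤ ≈ - ⟦ i ⟧ℤ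
  neg-homo (+ zero)   = sym ε⁻¹≈ε
  neg-homo (+ suc n)  = refl
  neg-homo -[1+ n ]   = sym (-‿involutive _)

  shift-difference : ∀ x y → x - y ≈ (1# + x) - (1# + y)
  shift-difference x y = sym (begin
    (1# + x) + - (1# + y)     ≈⟨ +-congˡ (sym (⁻¹-∙-comm 1# y)) ⟩
    (1# + x) + (- 1# + - y)   ≈⟨ +-congʳ (+-comm 1# x) ⟩
    (x + 1#) + (- 1# + - y)   ≈⟨ +-assoc x 1# _ ⟩
    x + (1# + (- 1# + - y))   ≈⟨ +-congˡ (sym (+-assoc 1# _ _)) ⟩
    x + ((1# + - 1#) + - y)   ≈⟨ +-congˡ (+-congʳ (-‿inverseʳ 1#)) ⟩
    x + (0# + - y)            ≈⟨ +-congˡ (+-identityˡ _) ⟩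
    x + - y                   ∎)

  ⊖-homo : ∀ m n → ⟦ m ℤ.⊖ n ⟧ℤ ≈ m · 1# - n · 1#
  ⊖-homo m zero          = sym (trans (+-congˡ ε⁻¹≈ε) (+-identityʳ _))
  ⊖-homo zero (suc n)    = sym (+-identityˡ _)
  ⊖-homo (suc m) (suc n) = begin
    ⟦ suc m ℤ.⊖ suc n ⟧ℤ             ≡⟨ ≡.cong ⟦_⟧ℤ (ℤₚ.[1+m]⊖[1+n]≡m⊖n m n) ⟩
    ⟦ m ℤ.⊖ n ⟧ℤ                     ≈⟨ ⊖-homo m n ⟩
    m · 1# - n · 1#                  ≈⟨ shift-difference _ _ ⟩
    (1# + m · 1#) - (1# + n · 1#)    ≈⟨ +-cong (sym (1+× m 1#)) (-‿cong (sym (1+× n 1#))) ⟩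
    suc m · 1# - suc n · 1#          ∎

  +-homo : ∀ i j → ⟦ i ℤ.+ j ⟧ℤ ≈ ⟦ i ⟧ℤ + ⟦ j ⟧ℤ
  +-homo (+ m)    (+ n)    = ×-homo-+ 1# m n
  +-homo (+ m)    -[1+ n ] = ⊖-homo m (suc n)
  +-homo -[1+ m ] (+ n)    = trans (⊖-homo n (suc m)) (+-comm _ _)
  +-homo -[1+ m ] -[1+ n ] = begin
    - (suc (suc (m ℕ.+ n)) · 1#)         ≡⟨ ≡.cong (λ k → - (suc k · 1#)) (ℕₚ.+-suc m n) ⟨
    - ((suc m ℕ.+ suc n) · 1#)           ≈⟨ -‿cong (×-homo-+ 1# (suc m) (suc n)) ⟩
    - (suc m · 1# + suc n · 1#)          ≈⟨ ⁻¹-∙-comm _ _ ⟨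
    - (suc m · 1#) + - (suc n · 1#)      ∎

  private
    negative-product : ∀ m n → ⟦ ℤ.- (+ (m ℕ.* n)) ⟧ℤ ≈ - (m · 1# * n · 1#)
    negative-product m n = trans (neg-homo (+ (m ℕ.* n))) (-‿cong (×1-homo-* m n))

  *-homo : ∀ i j → ⟦ i ℤ.* j ⟧ℤ ≈ ⟦ i ⟧ℤ * ⟦ j ⟧ℤ
  *-homo (+ m)    (+ n)    =
    trans (reflexive (≡.cong ⟦_⟧ℤ (ℤₚ.+◃n≡+n (m ℕ.* n)))) (×1-homo-* m n)
  *-homo (+ m)    -[1+ n ] =
    trans (reflexive (≡.cong ⟦_⟧ℤ (ℤₚ.-◃n≡-n (m ℕ.* suc n))))
      (trans (negative-product m (suc n)) (-‿distribʳ-* _ _))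
  *-homo -[1+ m ] (+ n)    =
    trans (reflexive (≡.cong ⟦_⟧ℤ (ℤₚ.-◃n≡-n (suc m ℕ.* n))))
      (trans (negative-product (suc m) n) (-‿distribˡ-* _ _))
  *-homo -[1+ m ] -[1+ n ] = begin
    (suc m ℕ.* suc n) · 1#                ≈⟨ ×1-homo-* (suc m) (suc n) ⟩
    suc m · 1# * suc n · 1#               ≈⟨ -‿involutive _ ⟨
    - - (suc m · 1# * suc n · 1#)         ≈⟨ -‿cong (-‿distribʳ-* _ _) ⟩
    - (suc m · 1# * - (suc n · 1#))       ≈⟨ -‿distribˡ-* _ _ ⟩
    - (suc m · 1#) * - (suc n · 1#)       ∎

  private
    ℤ-rawRing : RawRing _ _
    ℤ-rawRing = record
      { Carrier = ℤ ; _≈_ = _≡_ ; _+_ = ℤ._+_ ; _*_ = ℤ._*_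
      ; -_ = ℤ.-_ ; 0# = + 0 ; 1# = + 1 }

    morphism : ℤ-rawRing -Raw-AlmostCommutative⟶ fromCommutativeRing R
    morphism = record
      { ⟦_⟧ = ⟦_⟧ℤ ; +-homo = +-homo ; *-homo = *-homo
      ; -‿homo = neg-homo ; 0-homo = refl ; 1-homo = refl }

    _≟ℤ_ : ∀ i j → Maybe (⟦ i ⟧ℤ ≈ ⟦ j ⟧ℤ)
    i ≟ℤ j = map (λ { ≡.refl → refl }) (dec⇒maybe (i ℤ.≟ j))

  open import Algebra.Solver.Ring ℤ-rawRing (fromCommutativeRing R) morphism _≟ℤ_ public
    using (solve; _:=_; _:+_; _:*_; _:-_; :-_; con)

tri : ℕ → ℕ
tri zero    = 0
tri (suc n) = suc n ℕ.+ tri n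

-- Powers and sums along antidiagonals.

module FiniteSums {c ℓ : Level} (R : CommutativeRing c ℓ) where
  open CommutativeRing R hiding (zero)
  open IntegerCoefficients R public
  open import Relation.Binary.Reasoning.Setoid setoid

  infixr 8 _^_
  _^_ : Carrier → ℕ → Carrier
  _^_ = pow R

  ^-≡ : ∀ x {m n} → m ≡ n → x ^ m ≈ x ^ n
  ^-≡ x eq = reflexive (≡.cong (x ^_) eq)

  ^-cong : ∀ {x y} n → x ≈ y → x ^ n ≈ y ^ n
  ^-cong zero    eq = refl
  ^-cong (suc n) eq = *-cong eq (^-cong n eq)

  ^-+ : ∀ x m n → x ^ (m ℕ.+ n) ≈ x ^ m * x ^ n
  ^-+ x zero    n = sym (*-identityˡ _)
  ^-+ x (suc m) n = trans (*-congˡ (^-+ x m n)) (sym (*-assoc x _ _))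

  1^ : ∀ n → 1# ^ n ≈ 1#
  1^ zero    = refl
  1^ (suc n) = trans (*-identityˡ _) (1^ n)

  ^-distrib-* : ∀ x y n → (x * y) ^ n ≈ x ^ n * y ^ n
  ^-distrib-* x y zero    = sym (*-identityˡ 1#)
  ^-distrib-* x y (suc n) = trans (*-congˡ (^-distrib-* x y n))
    (solve 4 (λ a b c d → a :* b :* (c :* d) := a :* c :* (b :* d)) refl x y (x ^ n) (y ^ n))

  ^-inverse : ∀ {x y} → x * y ≈ 1# → ∀ n → x ^ n * y ^ n ≈ 1#
  ^-inverse xy≈1 n = trans (sym (^-distrib-* _ _ n)) (trans (^-cong n xy≈1) (1^ n))

  ^-* : ∀ x m n → x ^ (m ℕ.* n) ≈ (x ^ n) ^ m
  ^-* x zero    n = refl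
  ^-* x (suc m) n = trans (^-+ x n (m ℕ.* n)) (*-congˡ (^-* x m n))

  -- Summing over `i + j = m` makes the difference m - i available as the variable `j`, so no
  -- truncated subtraction enters the summands.
  diag : ℕ → (ℕ → ℕ → Carrier) → Carrier
  diag zero    f = f 0 0
  diag (suc m) f = f 0 (suc m) + diag m (λ i j → f (suc i) j)

  diag-cong : ∀ m {f g} → (∀ i j → i ℕ.+ j ≡ m → f i j ≈ g i j) → diag m f ≈ diag m g
  diag-cong zero    eq = eq 0 0 ≡.refl
  diag-cong (suc m) eq =
    +-cong (eq 0 (suc m) ≡.refl) (diag-cong m (λ i j i+j≡m → eq (suc i) j (≡.cong suc i+j≡m)))

  diag-+ : ∀ m f g → diag m (λ i j → f i j + g i j) ≈ diag m f + diag m g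
  diag-+ zero    f g = refl
  diag-+ (suc m) f g = trans (+-congˡ (diag-+ m _ _))
    (solve 4 (λ a b c d → a :+ b :+ (c :+ d) := a :+ c :+ (b :+ d)) refl _ _ _ _)

  diag-*ˡ : ∀ m x f → diag m (λ i j → x * f i j) ≈ x * diag m f
  diag-*ˡ zero    x f = refl
  diag-*ˡ (suc m) x f = trans (+-congˡ (diag-*ˡ m x _)) (sym (distribˡ x _ _))

  diag-zero : ∀ m → diag m (λ _ _ → 0#) ≈ 0#
  diag-zero zero    = refl
  diag-zero (suc m) = trans (+-identityˡ _) (diag-zero m)

  diag-last : ∀ m f → diag (suc m) f ≈ diag m (λ i j → f i (suc j)) + f (suc m) 0
  diag-last zero    f = refl
  diag-last (suc m) f = trans (+-congˡ (diag-last m (λ i → f (suc i)))) (sym (+-assoc _ _ _))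

  -- Both sides run over the triples `n + i + b = m`. This is the interchange of summation in
  -- Bailey's lemma and in the evaluation of H.
  diag-assoc : ∀ m (f : ℕ → ℕ → ℕ → Carrier) →
    diag m (λ k b → diag k (λ n i → f n i b)) ≈ diag m (λ n a → diag a (λ i b → f n i b))
  diag-assoc zero    f = refl
  diag-assoc (suc m) f = begin
    f 0 0 (suc m) + diag m (λ k b → f 0 (suc k) b + diag k (λ n i → f (suc n) i b))
      ≈⟨ +-congˡ (diag-+ m _ _) ⟩
    f 0 0 (suc m) + (diag m (λ k b → f 0 (suc k) b)
      + diag m (λ k b → diag k (λ n i → f (suc n) i b)))
      ≈⟨ sym (+-assoc _ _ _) ⟩
    diag (suc m) (f 0) + diag m (λ k b → diag k (λ n i → f (suc n) i b))
      ≈⟨ +-congˡ (diag-assoc m (λ n → f (suc n))) ⟩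
    diag (suc m) (f 0) + diag m (λ n a → diag a (λ i b → f (suc n) i b)) ∎

  -- The reindexing behind both telescoping arguments, `α₀-sum` and `abel-summation`: `g` is `f`
  -- moved by one place, with zeros at the free end.
  diag-shift : ∀ m f g → (∀ i → g i 0 ≈ 0#) → (∀ i j → g i (suc j) ≈ f (suc i) j) →
    f 0 m + diag m g ≈ diag m f
  diag-shift zero    f g g₀ g₊ = trans (+-congˡ (g₀ 0)) (+-identityʳ _)
  diag-shift (suc m) f g g₀ g₊ = +-congˡ (trans (diag-last m g)
    (trans (+-cong (diag-cong m (λ i j _ → g₊ i j)) (g₀ (suc m))) (+-identityʳ _)))

  diag-pascal : ∀ m f u v →
    (∀ b → f 0 (suc b) ≈ u 0 b) →
    (∀ i → f (suc i) 0 ≈ v i 0) →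
    (∀ i b → f (suc i) (suc b) ≈ u (suc i) b + v i (suc b)) →
    diag (suc m) f ≈ diag m u + diag m v
  diag-pascal m f u v f₀ᵦ fᵢ₀ fᵢᵦ = begin
    diag (suc m) f                               ≈⟨ diag-cong (suc m) split ⟩
    diag (suc m) (λ i b → U i b + V i b)         ≈⟨ diag-+ (suc m) U V ⟩
    diag (suc m) U + diag (suc m) V              ≈⟨ +-cong (diag-last m U) (+-identityˡ _) ⟩
    (diag m u + 0#) + diag m v                   ≈⟨ +-congʳ (+-identityʳ _) ⟩
    diag m u + diag m v                          ∎
    where
    U V : ℕ → ℕ → Carrier
    U i zero    = 0#
    U i (suc b) = u i b
    V zero    b = 0#
    V (suc i) b = v i b
    split : ∀ i b → i ℕ.+ b ≡ suc m → f i b ≈ U i b + V i b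
    split zero    (suc b) _ = trans (f₀ᵦ b) (sym (+-identityʳ _))
    split (suc i) zero    _ = trans (fᵢ₀ i) (sym (+-identityˡ _))
    split (suc i) (suc b) _ = fᵢᵦ i b

  sum-cong : ∀ n {f g} → (∀ i → i < n → f i ≈ g i) → sumBelow R n f ≈ sumBelow R n g
  sum-cong zero    eq = refl
  sum-cong (suc n) eq =
    +-cong (sum-cong n (λ i i<n → eq i (ℕₚ.m<n⇒m<1+n i<n))) (eq n (ℕₚ.n<1+n n))

  sum-*ˡ : ∀ n x f → sumBelow R n (λ i → x * f i) ≈ x * sumBelow R n f
  sum-*ˡ zero    x f = sym (zeroʳ x)
  sum-*ˡ (suc n) x f = trans (+-congʳ (sum-*ˡ n x f)) (sym (distribˡ x _ _))

  sum-head : ∀ n f → sumBelow R (suc n) f ≈ f 0 + sumBelow R n (λ i → f (suc i))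
  sum-head zero    f = trans (+-identityˡ _) (sym (+-identityʳ _))
  sum-head (suc n) f = trans (+-congʳ (sum-head n f)) (+-assoc _ _ _)

  sum-split : ∀ m n f → sumBelow R (m ℕ.+ n) f ≈ sumBelow R m f + sumBelow R n (λ i → f (m ℕ.+ i))
  sum-split zero    n f = sym (+-identityˡ _)
  sum-split (suc m) n f = begin
    sumBelow R (suc (m ℕ.+ n)) f                               ≈⟨ sum-head (m ℕ.+ n) f ⟩
    f 0 + sumBelow R (m ℕ.+ n) (λ i → f (suc i))               ≈⟨ +-congˡ (sum-split m n _) ⟩
    f 0 + (sumBelow R m (λ i → f (suc i)) + rest)              ≈⟨ +-assoc _ _ _ ⟨
    (f 0 + sumBelow R m (λ i → f (suc i))) + rest              ≈⟨ +-congʳ (sum-head m f) ⟨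
    sumBelow R (suc m) f + rest                                ∎
    where rest = sumBelow R n (λ i → f (suc m ℕ.+ i))

  sum≈diag : ∀ m f → sumBelow R (suc m) f ≈ diag m (λ i _ → f i)
  sum≈diag zero    f = +-identityˡ _
  sum≈diag (suc m) f = trans (sum-head (suc m) f) (+-congˡ (sum≈diag m _))

-- Gaussian binomials without division.

module GaussianBinomials {c ℓ : Level} (R : CommutativeRing c ℓ) (q : CommutativeRing.Carrier R) where
  open CommutativeRing R hiding (zero)
  open FiniteSums R
  open import Relation.Binary.Reasoning.Setoid setoid

  -- G a b is the Gaussian binomial [a+b; a]; indexing by both lower entries avoids subtraction.
  G : ℕ → ℕ → Carrier
  G zero    b       = 1#
  G (suc a) zero    = 1#
  G (suc a) (suc b) = G a (suc b) + q ^ suc a * G (suc a) b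

  -- The factor β of the overview. Taken at `qi` instead of `q`, it is the factor that appears in
  -- `reflection`.
  signed : ℕ → Carrier
  signed n = (- 1#) ^ n * q ^ tri n

  G₀ : ∀ a → G a 0 ≈ 1#
  G₀ zero    = refl
  G₀ (suc a) = refl

  G-≡ : ∀ {a a′ b b′} → a ≡ a′ → b ≡ b′ → G a b ≈ G a′ b′
  G-≡ eq eq′ = reflexive (≡.cong₂ G eq eq′)

  gauss-zero : ∀ n k → n < k → gauss R q n k ≈ 0#
  gauss-zero zero    (suc k) _         = refl
  gauss-zero (suc n) (suc k) (s<s n<k) =
    trans (+-cong (gauss-zero n k n<k) (*-congˡ (gauss-zero n (suc k) (ℕₚ.m<n⇒m<1+n n<k))))
          (solve 1 (λ x → con (+ 0) :+ x :* con (+ 0) := con (+ 0)) refl (q ^ suc k))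

  gauss≈G : ∀ a b → gauss R q (a ℕ.+ b) a ≈ G a b
  gauss≈G zero    b       = refl
  gauss≈G (suc a) zero    =
    trans (+-cong (trans (gauss≈G a 0) (G₀ a))
                  (*-congˡ (gauss-zero (a ℕ.+ 0) (suc a) (s≤s (ℕₚ.≤-reflexive (ℕₚ.+-identityʳ a))))))
          (solve 1 (λ x → con (+ 1) :+ x :* con (+ 0) := con (+ 1)) refl (q ^ suc a))
  gauss≈G (suc a) (suc b) =
    +-cong (gauss≈G a (suc b))
           (*-congˡ (trans (reflexive (≡.cong (λ n → gauss R q n (suc a)) (ℕₚ.+-suc a b)))
                           (gauss≈G (suc a) b)))

  -- The mirror image of the defining recursion; the two rules together give the symmetry `G-sym`.
  -- Both terms of the recursion are expanded by induction, and the four resulting terms regroup by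
  -- the recursion itself.
  G-pascal : ∀ a b → G (suc a) (suc b) ≈ G (suc a) b + q ^ suc b * G a (suc b)
  G-pascal zero    zero    = refl
  G-pascal zero    (suc b) = begin
    1# + q ^ 1 * G 1 (suc b)                     ≈⟨ +-congˡ (*-congˡ (G-pascal zero b)) ⟩
    1# + q ^ 1 * (G 1 b + q ^ suc b * 1#)
      ≈⟨ solve 3 (λ x g y → con (+ 1) :+ (x :* con (+ 1)) :* (g :+ y :* con (+ 1))
                   := con (+ 1) :+ (x :* con (+ 1)) :* g :+ x :* y :* con (+ 1))
               refl q (G 1 b) (q ^ suc b) ⟩
    1# + q ^ 1 * G 1 b + q ^ suc (suc b) * 1#    ∎
  G-pascal (suc a) zero    = begin
    G (suc a) 1 + q ^ suc (suc a) * 1#                 ≈⟨ +-congʳ (G-pascal a zero) ⟩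
    G (suc a) 0 + q ^ 1 * G a 1 + q ^ suc (suc a) * 1#
      ≈⟨ solve 3 (λ x g y → con (+ 1) :+ (x :* con (+ 1)) :* g :+ x :* y :* con (+ 1)
                   := con (+ 1) :+ (x :* con (+ 1)) :* (g :+ y :* con (+ 1)))
               refl q (G a 1) (q ^ suc a) ⟩
    1# + q ^ 1 * G (suc a) 1                           ∎
  G-pascal (suc a) (suc b) = begin
    G (suc a) (suc (suc b)) + x′ * G (suc (suc a)) (suc b)
      ≈⟨ +-cong (G-pascal a (suc b)) (*-congˡ (G-pascal (suc a) b)) ⟩
    (G (suc a) (suc b) + y′ * G a (suc (suc b))) + x′ * (G (suc (suc a)) b + y * G (suc a) (suc b))
      ≈⟨ solve 6 (λ q′ x y g h k →
             (g :+ q′ :* y :* h) :+ q′ :* x :* (k :+ y :* g)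
             := (g :+ q′ :* x :* k) :+ q′ :* y :* (h :+ x :* g))
           refl q x y (G (suc a) (suc b)) (G a (suc (suc b))) (G (suc (suc a)) b) ⟩
    G (suc (suc a)) (suc b) + y′ * G (suc a) (suc (suc b)) ∎
    where
    x  = q ^ suc a
    x′ = q ^ suc (suc a)
    y  = q ^ suc b
    y′ = q ^ suc (suc b)

  G-sym : ∀ a b → G a b ≈ G b a
  G-sym zero    b       = sym (G₀ b)
  G-sym (suc a) zero    = refl
  G-sym (suc a) (suc b) =
    trans (+-cong (G-sym a (suc b)) (*-congˡ (G-sym (suc a) b))) (sym (G-pascal b a))

  -- Both sides are the multinomial coefficient [x+y+z; x, y, z]. Factorials could vanish, so the
  -- proof is a Pascal induction: the left side splits into three products in which x, y or z is
  -- lowered by one.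
  G-trinomial : ∀ x y z → G (x ℕ.+ y) z * G x y ≈ G x (y ℕ.+ z) * G y z
  G-trinomial zero    y       z       = trans (*-identityʳ _) (sym (*-identityˡ _))
  G-trinomial (suc x) zero    z       =
    *-congʳ (G-≡ (ℕₚ.+-identityʳ (suc x)) (≡.refl {x = z}))
  G-trinomial (suc x) (suc y) zero    = begin
    1# * G (suc x) (suc y)                ≈⟨ *-comm _ _ ⟩
    G (suc x) (suc y) * 1#                ≈⟨ *-congʳ (G-≡ {suc x} ≡.refl (ℕₚ.+-identityʳ (suc y))) ⟨
    G (suc x) (suc y ℕ.+ 0) * 1#          ∎
  G-trinomial (suc x) (suc y) (suc z) = begin
    (A + q ^ (suc x ℕ.+ suc y) * B) * (C + X * D)
      ≈⟨ *-congʳ (+-congˡ (*-congʳ (^-+ q (suc x) (suc y)))) ⟩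
    (A + X * Y * B) * (C + X * D)
      ≈⟨ solve 6 (λ A X Y B C D → (A :+ X :* Y :* B) :* (C :+ X :* D)
             := A :* C :+ X :* (A :* D) :+ X :* Y :* (B :* (C :+ X :* D)))
           refl A X Y B C D ⟩
    A * C + X * (A * D) + X * Y * (B * G (suc x) (suc y))
      ≈⟨ +-cong (+-cong (G-trinomial x (suc y) (suc z)) (*-congˡ AD)) (*-congˡ BD) ⟩
    E * (F + Y * H) + X * (J * F) + X * Y * (J * H)
      ≈⟨ solve 6 (λ E F X Y H J → E :* (F :+ Y :* H) :+ X :* (J :* F) :+ X :* Y :* (J :* H)
             := (E :+ X :* J) :* (F :+ Y :* H))
           refl E F X Y H J ⟩
    (E + X * J) * (F + Y * H) ∎
    where
    X = q ^ suc x
    Y = q ^ suc y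
    A = G (x ℕ.+ suc y) (suc z)
    B = G (suc x ℕ.+ suc y) z
    C = G x (suc y)
    D = G (suc x) y
    E = G x (suc y ℕ.+ suc z)
    F = G y (suc z)
    H = G (suc y) z
    J = G (suc x) (y ℕ.+ suc z)
    AD : A * D ≈ J * F
    AD = trans (*-congʳ (G-≡ (ℕₚ.+-suc x y) ≡.refl)) (G-trinomial (suc x) y (suc z))
    BD : B * G (suc x) (suc y) ≈ J * H
    BD = trans (G-trinomial (suc x) (suc y) z) (*-congʳ (G-≡ {suc x} ≡.refl (≡.sym (ℕₚ.+-suc y z))))

  -- Both sides are the multinomial coefficient [w+x+y+z; w, x, y, z].
  G-quadrinomial : ∀ w x y z →
    G (w ℕ.+ x) (y ℕ.+ z) * G w x * G y z ≈ G (w ℕ.+ y) (x ℕ.+ z) * G w y * G x z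
  G-quadrinomial w x y z = begin
    G (w ℕ.+ x) (y ℕ.+ z) * G w x * G y z         ≈⟨ peel x y ⟩
    G w (x ℕ.+ (y ℕ.+ z)) * (G (x ℕ.+ y) z * G x y)
      ≈⟨ *-cong (G-≡ {w} ≡.refl (rotate x y z)) (*-cong (G-≡ (ℕₚ.+-comm x y) ≡.refl) (G-sym x y)) ⟩
    G w (y ℕ.+ (x ℕ.+ z)) * (G (y ℕ.+ x) z * G y x) ≈⟨ peel y x ⟨
    G (w ℕ.+ y) (x ℕ.+ z) * G w y * G x z         ∎
    where
    rotate : ∀ x y z → x ℕ.+ (y ℕ.+ z) ≡ y ℕ.+ (x ℕ.+ z)
    rotate = solve-∀
    peel : ∀ x y → G (w ℕ.+ x) (y ℕ.+ z) * G w x * G y z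
                 ≈ G w (x ℕ.+ (y ℕ.+ z)) * (G (x ℕ.+ y) z * G x y)
    peel x y = trans (*-congʳ (G-trinomial w x (y ℕ.+ z)))
      (trans (*-assoc _ _ _) (*-congˡ (sym (G-trinomial x y z))))

  poch-cong : ∀ {a a′} n → a ≈ a′ → poch R q a n ≈ poch R q a′ n
  poch-cong zero    eq = refl
  poch-cong (suc n) eq = *-cong (poch-cong n eq) (+-congˡ (-‿cong (*-congʳ eq)))

  poch-split : ∀ a m n → poch R q a (m ℕ.+ n) ≈ poch R q a m * poch R q (a * q ^ m) n
  poch-split a m zero    = trans (reflexive (≡.cong (poch R q a) (ℕₚ.+-identityʳ m))) (sym (*-identityʳ _))
  poch-split a m (suc n) = begin
    poch R q a (m ℕ.+ suc n)                           ≡⟨ ≡.cong (poch R q a) (ℕₚ.+-suc m n) ⟩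
    poch R q a (m ℕ.+ n) * (1# - a * q ^ (m ℕ.+ n))
      ≈⟨ *-cong (poch-split a m n)
                (+-congˡ (-‿cong (trans (*-congˡ (^-+ q m n)) (sym (*-assoc a _ _))))) ⟩
    poch R q a m * poch R q (a * q ^ m) n * (1# - a * q ^ m * q ^ n)
      ≈⟨ *-assoc _ _ _ ⟩
    poch R q a m * poch R q (a * q ^ m) (suc n)        ∎

  -- The two Pascal rules for [a+b+2; a+1] differ only in these terms.
  G-exchange : ∀ a b → (1# - q ^ suc b) * G a (suc b) ≈ (1# - q ^ suc a) * G (suc a) b
  G-exchange a b = begin
    (1# - y) * g             ≈⟨ solve 4 (λ x y g h → (con (+ 1) :- y) :* g
                                   := (g :+ x :* h) :- (y :* g :+ x :* h)) refl x y g h ⟩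
    G (suc a) (suc b) - (y * g + x * h)
                             ≈⟨ +-congʳ (G-pascal a b) ⟩
    (h + y * g) - (y * g + x * h)
                             ≈⟨ solve 4 (λ x y g h → (h :+ y :* g) :- (y :* g :+ x :* h)
                                   := (con (+ 1) :- x) :* h) refl x y g h ⟩
    (1# - x) * h             ∎
    where
    x = q ^ suc a
    y = q ^ suc b
    g = G a (suc b)
    h = G (suc a) b

  -- After one use of the recursion, `G-exchange` turns both terms into multiples of the same
  -- binomial. In this multiplied form the rule survives where 1 - q^(a+1) is zero.
  G-absorb : ∀ a b → (1# - q ^ suc a) * G (suc a) b ≈ (1# - q ^ suc (a ℕ.+ b)) * G a b
  G-absorb a zero    =
    *-cong (+-congˡ (-‿cong (^-≡ q (≡.cong suc (≡.sym (ℕₚ.+-identityʳ a)))))) (sym (G₀ a))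
  G-absorb a (suc b) = begin
    (1# - x) * (g + x * h)       ≈⟨ solve 3 (λ x g h → (con (+ 1) :- x) :* (g :+ x :* h)
                                       := (con (+ 1) :- x) :* g :+ x :* ((con (+ 1) :- x) :* h)) refl x g h ⟩
    (1# - x) * g + x * ((1# - x) * h)
                                 ≈⟨ +-congˡ (*-congˡ (G-exchange a b)) ⟨
    (1# - x) * g + x * ((1# - y) * g)
                                 ≈⟨ solve 3 (λ x y g → (con (+ 1) :- x) :* g :+ x :* ((con (+ 1) :- y) :* g)
                                       := (con (+ 1) :- x :* y) :* g) refl x y g ⟩
    (1# - x * y) * g             ≈⟨ *-congʳ (+-congˡ (-‿cong (^-+ q (suc a) (suc b)))) ⟨
    (1# - q ^ suc (a ℕ.+ suc b)) * g ∎
    where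
    x = q ^ suc a
    y = q ^ suc b
    g = G a (suc b)
    h = G (suc a) b

  [q]_ : ℕ → Carrier
  [q]_ = poch R q q

  -- The factorial formula [x+y; x] = (q^(y+1))_x / (q)_x, multiplied out so that it also holds
  -- where (q)_x vanishes.
  poch≈G : ∀ x y → poch R q (q ^ suc y) x ≈ G x y * [q] x
  poch≈G zero    y = sym (*-identityˡ 1#)
  poch≈G (suc x) y = begin
    poch R q (q ^ suc y) x * (1# - q ^ suc y * q ^ x)
      ≈⟨ *-cong (poch≈G x y) (+-congˡ (-‿cong (trans (sym (^-+ q (suc y) x)) (^-≡ q (≡.cong suc (ℕₚ.+-comm y x)))))) ⟩
    G x y * [q] x * (1# - q ^ suc (x ℕ.+ y))
      ≈⟨ solve 3 (λ g p z → g :* p :* z := z :* g :* p) refl _ _ _ ⟩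
    (1# - q ^ suc (x ℕ.+ y)) * G x y * [q] x
      ≈⟨ *-congʳ (G-absorb x y) ⟨
    (1# - q ^ suc x) * G (suc x) y * [q] x
      ≈⟨ solve 3 (λ g p z → z :* g :* p := g :* (p :* z)) refl _ _ _ ⟩
    G (suc x) y * [q] suc x ∎

  [q]-+ : ∀ k b → [q] (k ℕ.+ b) ≈ G k b * [q] k * [q] b
  [q]-+ k b = begin
    [q] (k ℕ.+ b)                       ≡⟨ ≡.cong [q]_ (ℕₚ.+-comm k b) ⟩
    [q] (b ℕ.+ k)                       ≈⟨ poch-split q b k ⟩
    [q] b * poch R q (q ^ suc b) k      ≈⟨ *-congˡ (poch≈G k b) ⟩
    [q] b * (G k b * [q] k)             ≈⟨ *-comm _ _ ⟩
    G k b * [q] k * [q] b               ∎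

-- Bailey's lemma and the telescoped sum.

module BaileyChain {c ℓ : Level} (R : CommutativeRing c ℓ) (q : CommutativeRing.Carrier R) where
  open CommutativeRing R hiding (zero)
  open FiniteSums R
  open GaussianBinomials R q
  open import Relation.Binary.Reasoning.Setoid setoid

  -- The summand of a limiting q-Vandermonde formula, Σ_i q^(i(i+c)) [a; i] / (q)_(i+c) = 1 /
  -- (q)_(a+c), after multiplication by (q)_(a+c); here b = a - i.
  vandermonde-term : ℕ → ℕ → ℕ → Carrier
  vandermonde-term c i b = q ^ (i ℕ.* (i ℕ.+ c)) * (G i b * poch R q (q ^ suc (i ℕ.+ c)) b)

  -- Pascal's rule expresses the sum for (a+1, c) as 1 - Z times the sum for (a, c) plus Z times the
  -- sum for (a, c+1), with Z = q^(a+c+1). Both are 1 by induction.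
  q-vandermonde : ∀ a c → diag a (vandermonde-term c) ≈ 1#
  q-vandermonde zero    c = trans (*-identityˡ _) (*-identityˡ _)
  q-vandermonde (suc a) c = begin
    diag (suc a) (vandermonde-term c)  ≈⟨ diag-pascal a (vandermonde-term c) u v first last middle ⟩
    diag a u + diag a v                ≈⟨ +-cong (trans (diag-cong a u≈) (diag-*ˡ a (1# - Z) _))
                                                 (trans (diag-cong a v≈) (diag-*ˡ a Z _)) ⟩
    (1# - Z) * diag a (vandermonde-term c) + Z * diag a (vandermonde-term (suc c))
                                       ≈⟨ +-cong (*-congˡ (q-vandermonde a c)) (*-congˡ (q-vandermonde a (suc c))) ⟩
    (1# - Z) * 1# + Z * 1#             ≈⟨ solve 1 (λ z → (con (+ 1) :- z) :* con (+ 1) :+ z :* con (+ 1) := con (+ 1)) refl Z ⟩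
    1#                                 ∎
    where
    Z = q ^ suc (a ℕ.+ c)
    u v : ℕ → ℕ → Carrier
    u i b = q ^ (i ℕ.* (i ℕ.+ c)) * (G i b * poch R q (q ^ suc (i ℕ.+ c)) (suc b))
    v i b = q ^ (suc i ℕ.* (suc i ℕ.+ c)) * (q ^ b * G i b * poch R q (q ^ suc (suc i ℕ.+ c)) b)
    first : ∀ b → vandermonde-term c 0 (suc b) ≈ u 0 b
    first b = refl
    last : ∀ i → vandermonde-term c (suc i) 0 ≈ v i 0
    last i = *-congˡ (*-congʳ (sym (trans (*-identityˡ _) (G₀ i))))
    middle : ∀ i b → vandermonde-term c (suc i) (suc b) ≈ u (suc i) b + v i (suc b)
    middle i b = trans (*-congˡ (*-congʳ (G-pascal i b)))
      (solve 4 (λ x g h p → x :* ((g :+ h) :* p) := x :* (g :* p) :+ x :* (h :* p)) refl _ _ _ _)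
    u≈ : ∀ i b → i ℕ.+ b ≡ a → u i b ≈ (1# - Z) * vandermonde-term c i b
    u≈ i b i+b≡a = begin
      x * (g * (p * (1# - q ^ suc (i ℕ.+ c) * q ^ b)))
        ≈⟨ *-congˡ (*-congˡ (*-congˡ (+-congˡ (-‿cong (trans (sym (^-+ q (suc (i ℕ.+ c)) b)) (^-≡ q exponent)))))) ⟩
      x * (g * (p * (1# - Z)))
        ≈⟨ solve 4 (λ x g p z → x :* (g :* (p :* z)) := z :* (x :* (g :* p))) refl x g p (1# - Z) ⟩
      (1# - Z) * (x * (g * p)) ∎
      where
      x = q ^ (i ℕ.* (i ℕ.+ c))
      g = G i b
      p = poch R q (q ^ suc (i ℕ.+ c)) b
      rearrange : ∀ i b c → suc (i ℕ.+ c) ℕ.+ b ≡ suc (i ℕ.+ b ℕ.+ c)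
      rearrange = solve-∀
      exponent : suc (i ℕ.+ c) ℕ.+ b ≡ suc (a ℕ.+ c)
      exponent = ≡.trans (rearrange i b c) (≡.cong (λ a → suc (a ℕ.+ c)) i+b≡a)
    v≈ : ∀ i b → i ℕ.+ b ≡ a → v i b ≈ Z * vandermonde-term (suc c) i b
    v≈ i b i+b≡a = begin
      x * (q ^ b * g * poch R q (q ^ suc (suc i ℕ.+ c)) b)
        ≈⟨ *-congˡ (*-congˡ (poch-cong b (^-≡ q (≡.cong suc (≡.sym (ℕₚ.+-suc i c)))))) ⟩
      x * (q ^ b * g * p)
        ≈⟨ solve 4 (λ x y g p → x :* (y :* g :* p) := (x :* y) :* (g :* p)) refl x (q ^ b) g p ⟩
      x * q ^ b * (g * p)
        ≈⟨ *-congʳ (trans (sym (^-+ q (suc i ℕ.* (suc i ℕ.+ c)) b)) (trans (^-≡ q exponent) (^-+ q (suc (a ℕ.+ c)) _))) ⟩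
      Z * q ^ (i ℕ.* (i ℕ.+ suc c)) * (g * p)
        ≈⟨ *-assoc _ _ _ ⟩
      Z * vandermonde-term (suc c) i b ∎
      where
      x = q ^ (suc i ℕ.* (suc i ℕ.+ c))
      g = G i b
      p = poch R q (q ^ suc (i ℕ.+ suc c)) b
      rearrange : ∀ i b c → suc i ℕ.* (suc i ℕ.+ c) ℕ.+ b ≡ suc (i ℕ.+ b ℕ.+ c) ℕ.+ i ℕ.* (i ℕ.+ suc c)
      rearrange = solve-∀
      exponent : suc i ℕ.* (suc i ℕ.+ c) ℕ.+ b ≡ suc (a ℕ.+ c) ℕ.+ i ℕ.* (i ℕ.+ suc c)
      exponent = ≡.trans (rearrange i b c) (≡.cong (λ a → suc (a ℕ.+ c) ℕ.+ i ℕ.* (i ℕ.+ suc c)) i+b≡a)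

  -- This is (q)_(2m) / (q)_m. Multiplying a Bailey relation by (q)_(2k) turns 1 / ((q)_(k-n)
  -- (q)_(k+n)) into [2k; k-n] and leaves this factor in front of (q)_k β_k.
  D : ℕ → Carrier
  D m = poch R q (q ^ suc m) m

  -- In factorials both sides are (q)_(2k+2b) / ((q)_k (q)_b); `G-quadrinomial` carries this out
  -- without quotients.
  D-G : ∀ k b → D (k ℕ.+ b) * G k b ≈ D k * (G (k ℕ.+ k) (b ℕ.+ b) * D b)
  D-G k b = begin
    D (k ℕ.+ b) * g
      ≈⟨ *-congʳ (trans (poch≈G (k ℕ.+ b) (k ℕ.+ b)) (*-congˡ ([q]-+ k b))) ⟩
    G (k ℕ.+ b) (k ℕ.+ b) * (g * [q] k * [q] b) * g
      ≈⟨ solve 4 (λ y g p r → y :* (g :* p :* r) :* g := y :* g :* g :* (p :* r)) refl _ g ([q] k) ([q] b) ⟩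
    G (k ℕ.+ b) (k ℕ.+ b) * g * g * ([q] k * [q] b)
      ≈⟨ *-congʳ (G-quadrinomial k k b b) ⟨
    G (k ℕ.+ k) (b ℕ.+ b) * G k k * G b b * ([q] k * [q] b)
      ≈⟨ solve 5 (λ y g h p r → y :* g :* h :* (p :* r) := g :* p :* (y :* (h :* r))) refl _ (G k k) (G b b) ([q] k) ([q] b) ⟩
    G k k * [q] k * (G (k ℕ.+ k) (b ℕ.+ b) * (G b b * [q] b))
      ≈⟨ *-cong (poch≈G k k) (*-congˡ (poch≈G b b)) ⟨
    D k * (G (k ℕ.+ k) (b ℕ.+ b) * D b) ∎
    where g = G k b

  -- Bailey pairs relative to a = 1 with denominators cleared: β k stands for (q)_k β_k.
  IsBaileyPair : (ℕ → Carrier) → (ℕ → Carrier) → Set ℓ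
  IsBaileyPair α β = ∀ k → D k * β k ≈ diag k (λ n i → α n * G i (i ℕ.+ (n ℕ.+ n)))

  -- With k = n + i one has k² = n² + i(i + 2n). Once the sums are interchanged, q^(n²) α_n leaves
  -- the sum over i, and what remains is `q-vandermonde` at c = 2n.
  bailey-lemma : ∀ {α β} → IsBaileyPair α β →
    IsBaileyPair (λ n → q ^ (n ℕ.* n) * α n)
                 (λ m → sumBelow R (suc m) (λ k → q ^ (k ℕ.* k) * gauss R q m k * β k))
  bailey-lemma {α} {β} pair m = begin
    D m * sumBelow R (suc m) (λ k → q ^ (k ℕ.* k) * gauss R q m k * β k)
      ≈⟨ *-congˡ (sum≈diag m _) ⟩
    D m * diag m (λ k _ → q ^ (k ℕ.* k) * gauss R q m k * β k)
      ≈⟨ sym (diag-*ˡ m (D m) _) ⟩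
    diag m (λ k _ → D m * (q ^ (k ℕ.* k) * gauss R q m k * β k))
      ≈⟨ diag-cong m outer ⟩
    diag m (λ k b → diag k (λ n i → F n i b))
      ≈⟨ diag-assoc m F ⟩
    diag m (λ n a → diag a (λ i b → F n i b))
      ≈⟨ diag-cong m (λ n a _ → inner-sum n a) ⟩
    diag m (λ n a → q ^ (n ℕ.* n) * α n * G a (a ℕ.+ (n ℕ.+ n))) ∎
    where
    W : ℕ → ℕ → Carrier
    W k b = q ^ (k ℕ.* k) * (G (k ℕ.+ k) (b ℕ.+ b) * D b)
    F : ℕ → ℕ → ℕ → Carrier
    F n i b = W (n ℕ.+ i) b * (α n * G i (i ℕ.+ (n ℕ.+ n)))
    outer : ∀ k b → k ℕ.+ b ≡ m →
      D m * (q ^ (k ℕ.* k) * gauss R q m k * β k) ≈ diag k (λ n i → F n i b)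
    outer k b ≡.refl = begin
      D (k ℕ.+ b) * (x * gauss R q (k ℕ.+ b) k * β k)
        ≈⟨ *-congˡ (*-congʳ (*-congˡ (gauss≈G k b))) ⟩
      D (k ℕ.+ b) * (x * G k b * β k)
        ≈⟨ solve 4 (λ d x g y → d :* (x :* g :* y) := (d :* g) :* (x :* y)) refl _ x (G k b) (β k) ⟩
      D (k ℕ.+ b) * G k b * (x * β k)
        ≈⟨ *-congʳ (D-G k b) ⟩
      D k * (G (k ℕ.+ k) (b ℕ.+ b) * D b) * (x * β k)
        ≈⟨ solve 4 (λ d w x y → d :* w :* (x :* y) := x :* w :* (d :* y)) refl (D k) _ x (β k) ⟩
      W k b * (D k * β k)
        ≈⟨ *-congˡ (pair k) ⟩
      W k b * diag k (λ n i → α n * G i (i ℕ.+ (n ℕ.+ n)))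
        ≈⟨ sym (diag-*ˡ k (W k b) _) ⟩
      diag k (λ n i → W k b * (α n * G i (i ℕ.+ (n ℕ.+ n))))
        ≈⟨ diag-cong k (λ { n i ≡.refl → refl }) ⟩
      diag k (λ n i → F n i b) ∎
      where x = q ^ (k ℕ.* k)
    square : ∀ n i → (n ℕ.+ i) ℕ.* (n ℕ.+ i) ≡ n ℕ.* n ℕ.+ i ℕ.* (i ℕ.+ (n ℕ.+ n))
    square = solve-∀
    lower : ∀ n i → (n ℕ.+ i) ℕ.+ (n ℕ.+ i) ≡ i ℕ.+ (i ℕ.+ (n ℕ.+ n))
    lower = solve-∀
    upper : ∀ n i b → (i ℕ.+ (n ℕ.+ n)) ℕ.+ b ≡ (i ℕ.+ b) ℕ.+ (n ℕ.+ n)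
    upper = solve-∀
    inner-sum : ∀ n a → diag a (λ i b → F n i b) ≈ q ^ (n ℕ.* n) * α n * G a (a ℕ.+ (n ℕ.+ n))
    inner-sum n a = begin
      diag a (λ i b → F n i b)                       ≈⟨ diag-cong a factor ⟩
      diag a (λ i b → C * vandermonde-term (n ℕ.+ n) i b) ≈⟨ diag-*ˡ a C _ ⟩
      C * diag a (vandermonde-term (n ℕ.+ n))        ≈⟨ *-congˡ (q-vandermonde a (n ℕ.+ n)) ⟩
      C * 1#                                         ≈⟨ *-identityʳ C ⟩
      C                                              ∎
      where
      C = q ^ (n ℕ.* n) * α n * G a (a ℕ.+ (n ℕ.+ n))
      factor : ∀ i b → i ℕ.+ b ≡ a → F n i b ≈ C * vandermonde-term (n ℕ.+ n) i b
      factor i b ≡.refl = begin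
        q ^ ((n ℕ.+ i) ℕ.* (n ℕ.+ i)) * (G ((n ℕ.+ i) ℕ.+ (n ℕ.+ i)) (b ℕ.+ b) * D b) * (α n * G i e)
          ≈⟨ *-congʳ (*-cong (trans (^-≡ q (square n i)) (^-+ q (n ℕ.* n) _))
                             (*-cong (G-≡ (lower n i) ≡.refl) (poch≈G b b))) ⟩
        x * y * (G (i ℕ.+ e) (b ℕ.+ b) * (G b b * [q] b)) * (α n * G i e)
          ≈⟨ solve 7 (λ x y g h p a k → x :* y :* (g :* (h :* p)) :* (a :* k)
                 := x :* a :* (y :* (g :* k :* h :* p))) refl x y _ (G b b) ([q] b) (α n) (G i e) ⟩
        x * α n * (y * (G (i ℕ.+ e) (b ℕ.+ b) * G i e * G b b * [q] b))
          ≈⟨ *-congˡ (*-congˡ (*-congʳ (G-quadrinomial i e b b))) ⟩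
        x * α n * (y * (G (i ℕ.+ b) (e ℕ.+ b) * G i b * G e b * [q] b))
          ≈⟨ *-congˡ (*-congˡ (*-cong (*-cong (*-congʳ (G-≡ {i ℕ.+ b} ≡.refl (upper n i b))) (G-sym e b)) refl)) ⟩
        x * α n * (y * (G (i ℕ.+ b) ((i ℕ.+ b) ℕ.+ (n ℕ.+ n)) * G i b * G b e * [q] b))
          ≈⟨ solve 7 (λ x a y g h k p → x :* a :* (y :* (g :* h :* k :* p))
                 := x :* a :* g :* (y :* (h :* (k :* p)))) refl x (α n) y _ (G i b) (G b e) ([q] b) ⟩
        C * (y * (G i b * (G b e * [q] b)))
          ≈⟨ *-congˡ (*-congˡ (*-congˡ (poch≈G b e))) ⟨
        C * vandermonde-term (n ℕ.+ n) i b ∎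
        where
        e = i ℕ.+ (n ℕ.+ n)
        x = q ^ (n ℕ.* n)
        y = q ^ (i ℕ.* e)

  -- The unit Bailey pair relative to a = 1: (-1)^n q^(n(n-1)/2) (1 + q^n) for n ≥ 1, whose β-side
  -- is `δ`.
  α₀ : ℕ → Carrier
  α₀ zero    = 1#
  α₀ (suc n) = - (signed n * (1# + q ^ suc n))

  odd-term : ℕ → ℕ → Carrier
  odd-term i c = signed i * G c (suc (c ℕ.+ (i ℕ.+ i)))

  -- Put m = μ + 1, and in (1 + q^n) [2m; m-n] expand the two copies of the binomial by opposite
  -- Pascal rules. The result is (1 + q^m) ([2m-1; m-n] + q^n [2m-1; m-n-1]), so `α₀ n` times the
  -- binomial is 1 + q^m times the difference of the `odd-term`s at n and n - 1. Summation by parts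
  -- moves the difference onto `w`.
  α₀-sum : ∀ (w : ℕ → Carrier) μ →
    diag (suc μ) (λ n a → w n * α₀ n * G a (a ℕ.+ (n ℕ.+ n)))
      ≈ (1# + q ^ suc μ) * diag μ (λ i c → (w i - w (suc i)) * odd-term i c)
  α₀-sum w μ = begin
    w 0 * 1# * G (suc μ) (suc μ ℕ.+ 0) + diag μ (λ i a → w (suc i) * α₀ (suc i) * G a (a ℕ.+ (suc i ℕ.+ suc i)))
      ≈⟨ +-cong head-term (trans (diag-cong μ tail-term) (trans (diag-*ˡ μ M _) (*-congˡ (diag-+ μ _ _)))) ⟩
    M * (w 0 * odd-term 0 μ) + M * (diag μ shifted + diag μ (λ i a → - (w (suc i) * odd-term i a)))
      ≈⟨ solve 4 (λ M x y z → M :* x :+ M :* (y :+ z) := M :* ((x :+ y) :+ z)) refl M _ _ _ ⟩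
    M * ((w 0 * odd-term 0 μ + diag μ shifted) + diag μ (λ i a → - (w (suc i) * odd-term i a)))
      ≈⟨ *-congˡ (+-congʳ (diag-shift μ (λ i a → w i * odd-term i a) shifted (λ _ → refl) (λ _ _ → refl))) ⟩
    M * (diag μ (λ i a → w i * odd-term i a) + diag μ (λ i a → - (w (suc i) * odd-term i a)))
      ≈⟨ *-congˡ (diag-+ μ _ _) ⟨
    M * diag μ (λ i a → w i * odd-term i a + - (w (suc i) * odd-term i a))
      ≈⟨ *-congˡ (diag-cong μ (λ i a _ → solve 3 (λ x y z → x :* z :- y :* z := (x :- y) :* z) refl (w i) (w (suc i)) (odd-term i a))) ⟩
    M * diag μ (λ i c → (w i - w (suc i)) * odd-term i c) ∎
    where
    M = 1# + q ^ suc μ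
    shifted : ℕ → ℕ → Carrier
    shifted i zero    = 0#
    shifted i (suc a) = w (suc i) * odd-term (suc i) a
    head-term : w 0 * 1# * G (suc μ) (suc μ ℕ.+ 0) ≈ M * (w 0 * odd-term 0 μ)
    head-term = begin
      w 0 * 1# * G (suc μ) (suc μ ℕ.+ 0)
        ≈⟨ *-congˡ (+-congˡ (*-congˡ (G-sym (suc μ) (μ ℕ.+ 0)))) ⟩
      w 0 * 1# * (G μ (suc μ ℕ.+ 0) + q ^ suc μ * G (μ ℕ.+ 0) (suc μ))
        ≈⟨ *-congˡ (+-congˡ (*-congˡ (G-≡ (ℕₚ.+-identityʳ μ) (≡.sym (ℕₚ.+-identityʳ (suc μ)))))) ⟩
      w 0 * 1# * (G μ (suc μ ℕ.+ 0) + q ^ suc μ * G μ (suc μ ℕ.+ 0))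
        ≈⟨ solve 3 (λ w g x → w :* con (+ 1) :* (g :+ x :* g)
             := (con (+ 1) :+ x) :* (w :* (con (+ 1) :* con (+ 1) :* g))) refl (w 0) _ (q ^ suc μ) ⟩
      M * (w 0 * odd-term 0 μ) ∎
    tail-term : ∀ i a → i ℕ.+ a ≡ μ →
      w (suc i) * α₀ (suc i) * G a (a ℕ.+ (suc i ℕ.+ suc i))
        ≈ M * (shifted i a + - (w (suc i) * odd-term i a))
    tail-term i zero i+0≡μ = begin
      w (suc i) * α₀ (suc i) * 1#
        ≈⟨ *-congʳ (*-congˡ (-‿cong (*-congˡ (+-congˡ (^-≡ q (≡.cong suc (≡.trans (≡.sym (ℕₚ.+-identityʳ i)) i+0≡μ))))))) ⟩
      w (suc i) * - (signed i * M) * 1#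
        ≈⟨ solve 3 (λ w s M → w :* (:- (s :* M)) :* con (+ 1)
              := M :* (con (+ 0) :+ :- (w :* (s :* con (+ 1))))) refl (w (suc i)) (signed i) M ⟩
      M * (0# + - (w (suc i) * (signed i * 1#))) ∎
    tail-term i (suc a) ≡.refl = begin
      w (suc i) * - ((s * t) * (1# + x)) * G (suc a) (suc (a ℕ.+ (suc i ℕ.+ suc i)))
        ≈⟨ solve 4 (λ w st x g → w :* (:- (st :* (con (+ 1) :+ x))) :* g := w :* (:- (st :* (g :+ x :* g))))
             refl (w (suc i)) (s * t) x _ ⟩
      w (suc i) * - ((s * t) * (G (suc a) (suc (a ℕ.+ (suc i ℕ.+ suc i))) + x * (g₂ + q ^ suc a * g₁)))
        ≈⟨ *-congˡ (-‿cong (*-congˡ (+-cong (G-pascal a _) (*-congˡ (+-congˡ refl))))) ⟩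
      w (suc i) * - ((s * t) * ((g₁ + q ^ suc (a ℕ.+ (suc i ℕ.+ suc i)) * g₂) + x * (g₂ + q ^ suc a * g₁)))
        ≈⟨ *-congˡ (-‿cong (*-congˡ (+-congʳ (+-congˡ (*-congʳ split))))) ⟩
      w (suc i) * - ((s * t) * ((g₁ + x * z * g₂) + x * (g₂ + q ^ suc a * g₁)))
        ≈⟨ *-congˡ (-‿cong (*-congˡ (+-congˡ (trans (distribˡ x g₂ _) (+-congˡ (trans (sym (*-assoc x _ _)) (*-congʳ z-split))))))) ⟩
      w (suc i) * - ((s * t) * ((g₁ + x * z * g₂) + (x * g₂ + z * g₁)))
        ≈⟨ solve 7 (λ w s t x z g h → w :* (:- (s :* t :* ((g :+ x :* z :* h) :+ (x :* h :+ z :* g))))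
              := (con (+ 1) :+ z) :* (w :* (:- con (+ 1) :* s :* (x :* t) :* h) :+ :- (w :* (s :* t :* g))))
             refl (w (suc i)) s t x z g₁ g₂ ⟩
      (1# + z) * (w (suc i) * ((- 1#) * s * (x * t) * g₂) + - (w (suc i) * (s * t * g₁)))
        ≈⟨ *-congˡ (+-cong (*-congˡ (*-congʳ (*-congˡ (sym (^-+ q (suc i) (tri i))))))
                           (-‿cong (*-congˡ (*-congˡ (G-≡ {suc a} ≡.refl (parity a i)))))) ⟩
      M * (shifted i (suc a) + - (w (suc i) * odd-term i (suc a))) ∎
      where
      s  = (- 1#) ^ i
      t  = q ^ tri i
      x  = q ^ suc i
      z  = q ^ suc (i ℕ.+ suc a)
      g₁ = G (suc a) (a ℕ.+ (suc i ℕ.+ suc i))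
      g₂ = G a (suc (a ℕ.+ (suc i ℕ.+ suc i)))
      parity : ∀ a i → a ℕ.+ (suc i ℕ.+ suc i) ≡ suc (suc a ℕ.+ (i ℕ.+ i))
      parity = solve-∀
      exponent : ∀ a i → suc (a ℕ.+ (suc i ℕ.+ suc i)) ≡ suc i ℕ.+ suc (i ℕ.+ suc a)
      exponent = solve-∀
      split : q ^ suc (a ℕ.+ (suc i ℕ.+ suc i)) ≈ x * z
      split = trans (^-≡ q (exponent a i)) (^-+ q (suc i) (suc (i ℕ.+ suc a)))
      z-split : x * q ^ suc a ≈ z
      z-split = sym (^-+ q (suc i) (suc a))

  weight : ℕ → ℕ → Carrier
  weight j n = (q ^ (n ℕ.* n)) ^ j

  δ : ℕ → Carrier
  δ zero    = 1#
  δ (suc _) = 0#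

  -- For the constant weight 1 all differences in `α₀-sum` vanish, which is the orthogonality behind
  -- the unit pair.
  δ-pair : IsBaileyPair (λ n → 1# * α₀ n) δ
  δ-pair zero    = solve 0 (con (+ 1) :* con (+ 1) := con (+ 1) :* con (+ 1) :* con (+ 1)) refl
  δ-pair (suc μ) = begin
    D (suc μ) * 0#                     ≈⟨ zeroʳ _ ⟩
    0#                                 ≈⟨ zeroʳ _ ⟨
    (1# + q ^ suc μ) * 0#              ≈⟨ *-congˡ (diag-zero μ) ⟨
    (1# + q ^ suc μ) * diag μ (λ _ _ → 0#)
      ≈⟨ *-congˡ (diag-cong μ (λ i c _ → sym (trans (*-congʳ (-‿inverseʳ 1#)) (zeroˡ _)))) ⟩
    (1# + q ^ suc μ) * diag μ (λ i c → (1# - 1#) * odd-term i c)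
      ≈⟨ α₀-sum (λ _ → 1#) μ ⟨
    diag (suc μ) (λ n a → 1# * α₀ n * G a (a ℕ.+ (n ℕ.+ n))) ∎

  pair-cong : ∀ {α α′ β β′} → (∀ n → α n ≈ α′ n) → (∀ k → β k ≈ β′ k) →
    IsBaileyPair α β → IsBaileyPair α′ β′
  pair-cong α≈ β≈ pair k = trans (*-congˡ (sym (β≈ k)))
    (trans (pair k) (diag-cong k (λ n _ _ → *-congʳ (α≈ n))))

  -- One step of the chain sends `δ` to the constant 1, which is `inner` at 0. Hence `inner` at j is
  -- reached after j + 1 steps, each contributing a factor q^(n²).
  inner-pair : ∀ j → IsBaileyPair (λ n → weight (suc j) n * α₀ n) (inner R q j)
  inner-pair zero    = pair-cong (λ n → sym (*-assoc _ _ _)) only-first (bailey-lemma δ-pair)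
    where
    only-first : ∀ m → sumBelow R (suc m) (λ k → q ^ (k ℕ.* k) * gauss R q m k * δ k) ≈ 1#
    only-first m = begin
      sumBelow R (suc m) (λ k → q ^ (k ℕ.* k) * gauss R q m k * δ k)   ≈⟨ sum-head m _ ⟩
      1# * 1# * 1# + sumBelow R m (λ k → q ^ (suc k ℕ.* suc k) * gauss R q m (suc k) * 0#)
        ≈⟨ +-cong (trans (*-identityʳ _) (*-identityʳ 1#))
                  (trans (sum-cong m (λ k _ → trans (zeroʳ _) (sym (zeroˡ 0#)))) (trans (sum-*ˡ m 0# _) (zeroˡ _))) ⟩
      1# + 0#                                                          ≈⟨ +-identityʳ 1# ⟩
      1#                                                               ∎
  inner-pair (suc j) = pair-cong (λ n → sym (*-assoc _ _ _)) (λ _ → refl) (bailey-lemma (inner-pair j))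

  -- The last factor 1 - q^(2m) of `D m` splits as (1 + q^m)(1 - q^m), and 1 - q^m completes (q^m)_m
  -- at its front, where m = μ + 1.
  D≈ : ∀ μ → D (suc μ) ≈ (1# + q ^ suc μ) * poch R q (q ^ suc μ) (suc μ)
  D≈ μ = begin
    P * (1# - q ^ suc (suc μ) * q ^ μ)
      ≈⟨ *-congˡ (+-congˡ (-‿cong (solve 2 (λ q x → q :* (q :* x) :* x := q :* x :* (q :* x)) refl q (q ^ μ)))) ⟩
    P * (1# - x * x)
      ≈⟨ solve 2 (λ p x → p :* (con (+ 1) :- x :* x)
            := (con (+ 1) :+ x) :* (con (+ 1) :* (con (+ 1) :- x :* con (+ 1)) :* p)) refl P x ⟩
    (1# + x) * (poch R q x 1 * P)
      ≈⟨ *-congˡ (*-congˡ (poch-cong μ (solve 2 (λ q x → q :* x := x :* (q :* con (+ 1))) refl q x))) ⟩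
    (1# + x) * (poch R q x 1 * poch R q (x * q ^ 1) μ)
      ≈⟨ *-congˡ (poch-split x 1 μ) ⟨
    (1# + x) * poch R q x (suc μ) ∎
    where
    x = q ^ suc μ
    P = poch R q (q ^ suc (suc μ)) μ

  -- The factor on the left comes from `D≈`, the one on the right from `α₀-sum`. It may be a zero
  -- divisor here, so it is kept.
  doubled-term : ∀ j μ →
    (1# + q ^ suc μ) * (poch R q (q ^ suc μ) (suc μ) * inner R q j (suc μ))
      ≈ (1# + q ^ suc μ) * diag μ (λ i c → (weight (suc j) i - weight (suc j) (suc i)) * odd-term i c)
  doubled-term j μ = begin
    (1# + q ^ suc μ) * (poch R q (q ^ suc μ) (suc μ) * inner R q j (suc μ)) ≈⟨ *-assoc _ _ _ ⟨
    (1# + q ^ suc μ) * poch R q (q ^ suc μ) (suc μ) * inner R q j (suc μ)   ≈⟨ *-congʳ (D≈ μ) ⟨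
    D (suc μ) * inner R q j (suc μ)                                        ≈⟨ inner-pair j (suc μ) ⟩
    diag (suc μ) (λ n a → weight (suc j) n * α₀ n * G a (a ℕ.+ (n ℕ.+ n))) ≈⟨ α₀-sum (weight (suc j)) μ ⟩
    _                                                                      ∎

-- Dual numbers as formal differentiation.

module DualNumbers {c ℓ : Level} (R : CommutativeRing c ℓ) where
  open CommutativeRing R hiding (zero)
  open FiniteSums R
  private
    module B = BaileyChain R
    module Gs = GaussianBinomials R

  -- R[ε] with ε² = 0; the pair (a , b) is a + bε.
  dual : CommutativeRing c ℓ
  dual = record
    { Carrier = Carrier × Carrier
    ; _≈_ = λ x y → (proj₁ x ≈ proj₁ y) × (proj₂ x ≈ proj₂ y)
    ; _+_ = λ x y → proj₁ x + proj₁ y , proj₂ x + proj₂ y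
    ; _*_ = λ x y → proj₁ x * proj₁ y , proj₁ x * proj₂ y + proj₂ x * proj₁ y
    ; -_  = λ x → - proj₁ x , - proj₂ x
    ; 0#  = 0# , 0#
    ; 1#  = 1# , 0#
    ; isCommutativeRing = record
      { isRing = record
        { +-isAbelianGroup = record
          { isGroup = record
            { isMonoid = record
              { isSemigroup = record
                { isMagma = record
                  { isEquivalence = record
                    { refl  = refl , refl
                    ; sym   = λ (e , e′) → sym e , sym e′
                    ; trans = λ (e , e′) (f , f′) → trans e f , trans e′ f′ }
                  ; ∙-cong = λ (e , e′) (f , f′) → +-cong e f , +-cong e′ f′ }
                ; assoc = λ _ _ _ → +-assoc _ _ _ , +-assoc _ _ _ }
              ; identity = (λ _ → +-identityˡ _ , +-identityˡ _) , (λ _ → +-identityʳ _ , +-identityʳ _) }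
            ; inverse = (λ _ → -‿inverseˡ _ , -‿inverseˡ _) , (λ _ → -‿inverseʳ _ , -‿inverseʳ _)
            ; ⁻¹-cong = λ (e , e′) → -‿cong e , -‿cong e′ }
          ; comm = λ _ _ → +-comm _ _ , +-comm _ _ }
        ; *-cong = λ (e , e′) (f , f′) → *-cong e f , +-cong (*-cong e f′) (*-cong e′ f)
        ; *-assoc = λ (a , a′) (b , b′) (d , d′) → *-assoc a b d ,
            solve 6 (λ a a′ b b′ d d′ → a :* b :* d′ :+ (a :* b′ :+ a′ :* b) :* d
                := a :* (b :* d′ :+ b′ :* d) :+ a′ :* (b :* d)) refl a a′ b b′ d d′
        ; *-identity =
            (λ (a , a′) → *-identityˡ a , solve 2 (λ a a′ → con (+ 1) :* a′ :+ con (+ 0) :* a := a′) refl a a′) ,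
            (λ (a , a′) → *-identityʳ a , solve 2 (λ a a′ → a :* con (+ 0) :+ a′ :* con (+ 1) := a′) refl a a′)
        ; distrib =
            (λ (a , a′) (b , b′) (d , d′) → distribˡ a b d ,
              solve 6 (λ a a′ b b′ d d′ → a :* (b′ :+ d′) :+ a′ :* (b :+ d)
                  := a :* b′ :+ a′ :* b :+ (a :* d′ :+ a′ :* d)) refl a a′ b b′ d d′) ,
            (λ (a , a′) (b , b′) (d , d′) → distribʳ a b d ,
              solve 6 (λ a a′ b b′ d d′ → (b :+ d) :* a′ :+ (b′ :+ d′) :* a
                  := b :* a′ :+ b′ :* a :+ (d :* a′ :+ d′ :* a)) refl a a′ b b′ d d′) }
      ; *-comm = λ (a , a′) (b , b′) → *-comm a b ,
          solve 4 (λ a a′ b b′ → a :* b′ :+ a′ :* b := b :* a′ :+ b′ :* a) refl a a′ b b′ } }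

  private
    module B′ = BaileyChain dual
    module G′ = GaussianBinomials dual
    module F′ = FiniteSums dual

  -- The first component is a ring homomorphism from R[ε] to R, so this and the following
  -- projections hold factor by factor.
  π-pow : ∀ x n → proj₁ (pow dual x n) ≈ proj₁ x ^ n
  π-pow x zero    = refl
  π-pow x (suc n) = *-congˡ (π-pow x n)

  π-sum : ∀ n {f g} → (∀ i → proj₁ (f i) ≈ g i) → proj₁ (sumBelow dual n f) ≈ sumBelow R n g
  π-sum zero    eq = refl
  π-sum (suc n) eq = +-cong (π-sum n eq) (eq n)

  π-diag : ∀ m {f g} → (∀ i j → proj₁ (f i j) ≈ g i j) → proj₁ (F′.diag m f) ≈ diag m g
  π-diag zero    eq = eq 0 0
  π-diag (suc m) eq = +-cong (eq 0 (suc m)) (π-diag m (λ i → eq (suc i)))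

  π-poch : ∀ x a n → proj₁ (poch dual x a n) ≈ poch R (proj₁ x) (proj₁ a) n
  π-poch x a zero    = refl
  π-poch x a (suc n) = *-cong (π-poch x a n) (+-congˡ (-‿cong (*-congˡ (π-pow x n))))

  π-gauss : ∀ x n k → proj₁ (gauss dual x n k) ≈ gauss R (proj₁ x) n k
  π-gauss x n       zero    = refl
  π-gauss x zero    (suc k) = refl
  π-gauss x (suc n) (suc k) =
    +-cong (π-gauss x n k) (*-cong (π-pow x (suc k)) (π-gauss x n (suc k)))

  π-inner : ∀ x j m → proj₁ (inner dual x j m) ≈ inner R (proj₁ x) j m
  π-inner x zero    m = refl
  π-inner x (suc j) m =
    π-sum (suc m) (λ n → *-cong (*-cong (π-pow x (n ℕ.* n)) (π-gauss x m n)) (π-inner x j n))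

  π-G : ∀ x a b → proj₁ (G′.G x a b) ≈ Gs.G (proj₁ x) a b
  π-G x zero    b       = refl
  π-G x (suc a) zero    = refl
  π-G x (suc a) (suc b) = +-cong (π-G x a (suc b)) (*-cong (π-pow x (suc a)) (π-G x (suc a) b))

  π-odd-term : ∀ x i j → proj₁ (B′.odd-term x i j) ≈ B.odd-term (proj₁ x) i j
  π-odd-term x i j = *-cong (*-cong (π-pow _ i) (π-pow x (tri i))) (π-G x j _)

  π-weight : ∀ x j n → proj₁ (B′.weight x j n) ≈ B.weight (proj₁ x) j n
  π-weight x j n = trans (π-pow _ j) (^-cong j (π-pow x (n ℕ.* n)))

  -- Since q + qε = q (1 + ε), its n-th power is q^n (1 + nε). Perturbing by qε realises q d/dq,
  -- which keeps the exponent n.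
  derivative : ∀ q n → proj₂ (pow dual (q , q) n) ≈ natR R n * q ^ n
  derivative q zero    = sym (zeroˡ 1#)
  derivative q (suc n) = trans (+-cong (*-congˡ (derivative q n)) (*-congˡ (π-pow (q , q) n)))
    (solve 3 (λ q n x → q :* (n :* x) :+ q :* x := (con (+ 1) :+ n) :* (q :* x)) refl q (natR R n) (q ^ n))

-- Cancellation in an integral domain.

module IntegralDomain {c ℓ : Level} (R : CommutativeRing c ℓ) (domain : IsIntegralDomain R) where
  open CommutativeRing R hiding (zero)
  open FiniteSums R

  1≉0 : ¬ 1# ≈ 0#
  1≉0 = proj₁ domain

  difference-zero : ∀ {x y} → x - y ≈ 0# → x ≈ y
  difference-zero {x} {y} eq =
    trans (solve 2 (λ x y → x := (x :- y) :+ y) refl x y) (trans (+-congʳ eq) (+-identityˡ y))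

  -- The domain axiom itself supplies the alternative, so whether 1 + q^m vanishes can be
  -- distinguished without decidable equality.
  cancel : ∀ x {y z} → x * y ≈ x * z → x ≈ 0# ⊎ y ≈ z
  cancel x {y} {z} eq with proj₂ domain x (y - z)
    (trans (solve 3 (λ x y z → x :* (y :- z) := x :* y :- x :* z) refl x y z)
           (trans (+-congʳ eq) (-‿inverseʳ _)))
  ... | inj₁ x≈0 = inj₁ x≈0
  ... | inj₂ eq′ = inj₂ (difference-zero eq′)

  cancel-nonzero : ∀ {x y z} → ¬ x ≈ 0# → x * y ≈ x * z → y ≈ z
  cancel-nonzero {x} x≉0 eq with cancel x eq
  ... | inj₁ x≈0 = ⊥-elim (x≉0 x≈0)
  ... | inj₂ y≈z = y≈z

  unit-nonzero : ∀ {x y} → x * y ≈ 1# → ¬ x ≈ 0#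
  unit-nonzero {x} {y} xy≈1 x≈0 = 1≉0 (trans (sym xy≈1) (trans (*-congʳ x≈0) (zeroˡ y)))

  module _ (charZero : CharZero R) {q qi : Carrier} (q·qi≈1 : q * qi ≈ 1#) where
    open DualNumbers R
    open BaileyChain R q using (weight; odd-term)
    private module DR = CommutativeRing dual

    -- Where 1 + q^m vanishes it cannot be cancelled; but at q + qε in R[ε] it becomes
    -- -mε, and the ε-component of the doubled identity has the nonzero factor m instead.
    halved-term : ∀ j μ →
      poch R q (q ^ suc μ) (suc μ) * inner R q j (suc μ)
        ≈ diag μ (λ i c → (weight (suc j) i - weight (suc j) (suc i)) * odd-term i c)
    halved-term j μ = conclude (cancel (1# + q ^ m) at-q)
      where
      m = suc μ
      q′ = (q , q)
      open BaileyChain dual q′ using (doubled-term) renaming (weight to weight′; odd-term to odd-term′)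
      X′ Y′ : Carrier × Carrier
      X′ = poch dual q′ (pow dual q′ m) m DR.* inner dual q′ j m
      Y′ = FiniteSums.diag dual μ (λ i c → (weight′ (suc j) i DR.- weight′ (suc j) (suc i)) DR.* odd-term′ i c)
      X Y ∂ : Carrier
      X = poch R q (q ^ m) m * inner R q j m
      Y = diag μ (λ i c → (weight (suc j) i - weight (suc j) (suc i)) * odd-term i c)
      ∂ = proj₂ (pow dual q′ m)
      X≈ : proj₁ X′ ≈ X
      X≈ = *-cong (trans (π-poch q′ _ m) (GaussianBinomials.poch-cong R q m (π-pow q′ m))) (π-inner q′ j m)
      Y≈ : proj₁ Y′ ≈ Y
      Y≈ = π-diag μ (λ i c →
        *-cong (+-cong (π-weight q′ (suc j) i) (-‿cong (π-weight q′ (suc j) (suc i)))) (π-odd-term q′ i c))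
      doubled : ((1# + proj₁ (pow dual q′ m)) * proj₁ X′ ≈ (1# + proj₁ (pow dual q′ m)) * proj₁ Y′)
              × ((1# + proj₁ (pow dual q′ m)) * proj₂ X′ + (0# + ∂) * proj₁ X′
                 ≈ (1# + proj₁ (pow dual q′ m)) * proj₂ Y′ + (0# + ∂) * proj₁ Y′)
      doubled = doubled-term j μ
      q^m≈ : 1# + proj₁ (pow dual q′ m) ≈ 1# + q ^ m
      q^m≈ = +-congˡ (π-pow q′ m)
      at-q : (1# + q ^ m) * X ≈ (1# + q ^ m) * Y
      at-q = trans (sym (*-cong q^m≈ X≈)) (trans (proj₁ doubled) (*-cong q^m≈ Y≈))
      conclude : 1# + q ^ m ≈ 0# ⊎ X ≈ Y → X ≈ Y
      conclude (inj₂ X≈Y)   = X≈Y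
      conclude (inj₁ 1+q^m≈0) =
        cancel-nonzero (unit-nonzero (^-inverse q·qi≈1 m)) (cancel-nonzero (charZero μ) first-order)
        where
        drop : ∀ u v → (1# + proj₁ (pow dual q′ m)) * u + (0# + ∂) * v ≈ natR R m * (q ^ m * v)
        drop u v = trans (+-cong (trans (*-congʳ (trans q^m≈ 1+q^m≈0)) (zeroˡ u))
                                 (*-congʳ (trans (+-identityˡ ∂) (derivative q m))))
                         (trans (+-identityˡ _) (*-assoc _ _ v))
        first-order : natR R m * (q ^ m * X) ≈ natR R m * (q ^ m * Y)
        first-order = trans (*-congˡ (*-congˡ (sym X≈))) (trans (sym (drop _ _))
          (trans (proj₂ doubled) (trans (drop _ _) (*-congˡ (*-congˡ Y≈)))))

-- Schur's polynomial and its recurrence.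

module EkhadZeilberger {c ℓ : Level} (R : CommutativeRing c ℓ) (q : CommutativeRing.Carrier R) where
  open CommutativeRing R hiding (zero)
  open FiniteSums R
  open GaussianBinomials R q
  open import Relation.Binary.Reasoning.Setoid setoid

  -- The sum of f c r over 2c + r = L.
  half : ℕ → (ℕ → ℕ → Carrier) → Carrier
  half zero          f = f 0 0
  half (suc zero)    f = f 0 1
  half (suc (suc L)) f = f 0 (suc (suc L)) + half L (λ c r → f (suc c) r)

  half-cong : ∀ L {f g} → (∀ c r → c ℕ.* 2 ℕ.+ r ≡ L → f c r ≈ g c r) → half L f ≈ half L g
  half-cong zero          eq = eq 0 0 ≡.refl
  half-cong (suc zero)    eq = eq 0 1 ≡.refl
  half-cong (suc (suc L)) eq =
    +-cong (eq 0 (suc (suc L)) ≡.refl) (half-cong L (λ c r e → eq (suc c) r (≡.cong (λ n → suc (suc n)) e)))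

  half-+ : ∀ L f g → half L (λ c r → f c r + g c r) ≈ half L f + half L g
  half-+ zero          f g = refl
  half-+ (suc zero)    f g = refl
  half-+ (suc (suc L)) f g = trans (+-congˡ (half-+ L _ _))
    (solve 4 (λ a b c d → a :+ b :+ (c :+ d) := a :+ c :+ (b :+ d)) refl _ _ _ _)

  half-*ˡ : ∀ L x f → half L (λ c r → x * f c r) ≈ x * half L f
  half-*ˡ zero          x f = refl
  half-*ˡ (suc zero)    x f = refl
  half-*ˡ (suc (suc L)) x f = trans (+-congˡ (half-*ˡ L x _)) (sym (distribˡ x _ _))

  half-shift : ∀ L f → (∀ c → f c 0 ≈ 0#) → half (suc L) f ≈ half L (λ c r → f c (suc r))
  half-shift zero          f f₀ = refl
  half-shift (suc zero)    f f₀ = trans (+-congˡ (f₀ 1)) (+-identityʳ _)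
  half-shift (suc (suc L)) f f₀ = +-congˡ (half-shift L _ (λ c → f₀ (suc c)))

  -- Lowering r decreases 2c + r by one and lowering c decreases it by two, so a Pascal rule for the
  -- summands becomes a second-order recurrence in L.
  half-pascal : ∀ L f u v →
    (∀ r → f 0 (suc r) ≈ u 0 r) →
    (∀ c → f (suc c) 0 ≈ v c 0) →
    (∀ c r → f (suc c) (suc r) ≈ u (suc c) r + v c (suc r)) →
    half (suc (suc L)) f ≈ half (suc L) u + half L v
  half-pascal L f u v f₀ᵣ f꜀₀ f꜀ᵣ = begin
    half (suc (suc L)) f                             ≈⟨ half-cong (suc (suc L)) split ⟩
    half (suc (suc L)) (λ c r → U c r + V c r)       ≈⟨ half-+ (suc (suc L)) U V ⟩
    half (suc (suc L)) U + half (suc (suc L)) V      ≈⟨ +-cong (half-shift (suc L) U (λ _ → refl)) (+-identityˡ _) ⟩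
    half (suc L) u + half L v                        ∎
    where
    U V : ℕ → ℕ → Carrier
    U c zero    = 0#
    U c (suc r) = u c r
    V zero    r = 0#
    V (suc c) r = v c r
    split : ∀ c r → c ℕ.* 2 ℕ.+ r ≡ suc (suc L) → f c r ≈ U c r + V c r
    split zero    (suc r) _ = trans (f₀ᵣ r) (sym (+-identityʳ _))
    split (suc c) zero    _ = trans (f꜀₀ c) (sym (+-identityˡ _))
    split (suc c) (suc r) _ = f꜀ᵣ c r

  -- (-1)^c q^(c(c-1)/2)
  signed⁻ : ℕ → Carrier
  signed⁻ zero    = 1#
  signed⁻ (suc c) = - signed c

  signed≈ : ∀ c → signed c ≈ q ^ c * signed⁻ c
  signed≈ zero    = refl
  signed≈ (suc c) = trans (*-congˡ (^-+ q (suc c) (tri c)))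
    (solve 3 (λ x s t → (:- con (+ 1)) :* s :* (x :* t) := x :* (:- (s :* t))) refl (q ^ suc c) ((- 1#) ^ c) (q ^ tri c))

  -- ez L = Σ_c (-1)^c q^(c(c-1)/2) [L-c; c], evaluated by coupling it with ez⁺.
  ez ez⁺ : ℕ → Carrier
  ez  L = half L (λ c r → signed⁻ c * G c r)
  ez⁺ L = half L (λ c r → signed  c * G c r)

  -- Uses the Pascal rule that defines `G`: its power q^(c+1) turns `signed⁻ (suc c)` into
  -- `signed (suc c)`.
  ez-step : ∀ L → ez (suc (suc L)) ≈ ez⁺ (suc L) - ez⁺ L
  ez-step L = begin
    ez (suc (suc L))
      ≈⟨ half-pascal L (λ c r → signed⁻ c * G c r) (λ c r → signed c * G c r) (λ c r → (- 1#) * (signed c * G c r)) first last middle ⟩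
    ez⁺ (suc L) + half L (λ c r → (- 1#) * (signed c * G c r))
      ≈⟨ +-congˡ (half-*ˡ L (- 1#) _) ⟩
    ez⁺ (suc L) + (- 1#) * ez⁺ L
      ≈⟨ solve 2 (λ x y → x :+ (:- con (+ 1)) :* y := x :- y) refl _ _ ⟩
    ez⁺ (suc L) - ez⁺ L ∎
    where
    first : ∀ r → signed⁻ 0 * G 0 (suc r) ≈ signed 0 * G 0 r
    first r = *-congʳ (sym (*-identityˡ 1#))
    last : ∀ c → signed⁻ (suc c) * G (suc c) 0 ≈ (- 1#) * (signed c * G c 0)
    last c = trans (solve 1 (λ s → :- s :* con (+ 1) := (:- con (+ 1)) :* (s :* con (+ 1))) refl (signed c))
                   (*-congˡ (*-congˡ (sym (G₀ c))))
    middle : ∀ c r → signed⁻ (suc c) * G (suc c) (suc r)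
                   ≈ signed (suc c) * G (suc c) r + (- 1#) * (signed c * G c (suc r))
    middle c r = begin
      - signed c * (G c (suc r) + q ^ suc c * G (suc c) r)
        ≈⟨ solve 4 (λ s g x h → :- s :* (g :+ x :* h) := x :* (:- s) :* h :+ (:- con (+ 1)) :* (s :* g))
             refl (signed c) (G c (suc r)) (q ^ suc c) (G (suc c) r) ⟩
      q ^ suc c * - signed c * G (suc c) r + (- 1#) * (signed c * G c (suc r))
        ≈⟨ +-congʳ (*-congʳ (sym (signed≈ (suc c)))) ⟩
      signed (suc c) * G (suc c) r + (- 1#) * (signed c * G c (suc r)) ∎

  -- Uses the opposite rule `G-pascal`, whose power involves r instead of c.
  ez⁺-step : ∀ L → ez⁺ (suc (suc L)) ≈ ez⁺ (suc L) - q ^ suc L * ez L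
  ez⁺-step L = begin
    ez⁺ (suc (suc L))
      ≈⟨ half-pascal L (λ c r → signed c * G c r) (λ c r → signed c * G c r) (λ c r → q ^ r * signed (suc c) * G c r) first last middle ⟩
    ez⁺ (suc L) + half L (λ c r → q ^ r * signed (suc c) * G c r)
      ≈⟨ +-congˡ (trans (half-cong L collect) (half-*ˡ L (- q ^ suc L) _)) ⟩
    ez⁺ (suc L) + (- q ^ suc L) * ez L
      ≈⟨ solve 3 (λ x y z → x :+ :- y :* z := x :- y :* z) refl _ _ _ ⟩
    ez⁺ (suc L) - q ^ suc L * ez L ∎
    where
    first : ∀ r → signed 0 * G 0 (suc r) ≈ signed 0 * G 0 r
    first r = refl
    last : ∀ c → signed (suc c) * G (suc c) 0 ≈ 1# * signed (suc c) * G c 0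
    last c = *-cong (sym (*-identityˡ _)) (sym (G₀ c))
    middle : ∀ c r → signed (suc c) * G (suc c) (suc r)
                   ≈ signed (suc c) * G (suc c) r + q ^ suc r * signed (suc c) * G c (suc r)
    middle c r = trans (*-congˡ (G-pascal c r))
      (solve 4 (λ s g x h → s :* (g :+ x :* h) := s :* g :+ x :* s :* h) refl _ _ (q ^ suc r) _)
    -- The surplus exponent c + 1 + c + r depends only on 2c + r = L, so the power of q leaves the
    -- sum.
    collect : ∀ c r → c ℕ.* 2 ℕ.+ r ≡ L → q ^ r * signed (suc c) * G c r ≈ (- q ^ suc L) * (signed⁻ c * G c r)
    collect c r ≡.refl = begin
      q ^ r * signed (suc c) * G c r
        ≈⟨ *-congʳ (*-congˡ (trans (signed≈ (suc c)) (*-congˡ (-‿cong (signed≈ c))))) ⟩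
      q ^ r * (q ^ suc c * - (q ^ c * signed⁻ c)) * G c r
        ≈⟨ solve 5 (λ x y z s g → x :* (y :* (:- (z :* s))) :* g := :- (y :* (z :* x)) :* (s :* g))
             refl (q ^ r) (q ^ suc c) (q ^ c) (signed⁻ c) (G c r) ⟩
      - (q ^ suc c * (q ^ c * q ^ r)) * (signed⁻ c * G c r)
        ≈⟨ *-congʳ (-‿cong (trans (*-congˡ (sym (^-+ q c r)))
              (trans (sym (^-+ q (suc c) (c ℕ.+ r))) (^-≡ q (exponent c r))))) ⟩
      - q ^ suc (c ℕ.* 2 ℕ.+ r) * (signed⁻ c * G c r) ∎
      where
      exponent : ∀ c r → suc c ℕ.+ (c ℕ.+ r) ≡ suc (c ℕ.* 2 ℕ.+ r)
      exponent = solve-∀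

  -- `ez-step` writes the left side as a difference of consecutive values of `ez⁺`, and `ez⁺-step`
  -- evaluates just such a difference.
  ez-recurrence : ∀ L → ez (3 ℕ.+ L) ≈ - (q ^ suc L * ez L)
  ez-recurrence L = trans (ez-step (suc L)) (trans (+-congʳ (ez⁺-step L))
    (solve 2 (λ x y → x :- y :- x := :- y) refl (ez⁺ (suc L)) (q ^ suc L * ez L)))

  ez₀ : ez 0 ≈ 1#
  ez₀ = *-identityˡ 1#

  ez₁ : ez 1 ≈ 1#
  ez₁ = *-identityˡ 1#

  ez₂ : ez 2 ≈ 0#
  ez₂ = solve 0 (con (+ 1) :* con (+ 1) :+ :- (con (+ 1) :* con (+ 1)) :* con (+ 1) := con (+ 0)) refl

  ez-3s+2 : ∀ s → ez (s ℕ.* 3 ℕ.+ 2) ≈ 0#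
  ez-3s+2 zero    = ez₂
  ez-3s+2 (suc s) = trans (ez-recurrence (s ℕ.* 3 ℕ.+ 2))
    (trans (-‿cong (*-congˡ (ez-3s+2 s))) (solve 1 (λ x → :- (x :* con (+ 0)) := con (+ 0)) refl _))

  -- The exponents that `ez-recurrence` accumulates: the pentagonal numbers s(3s-1)/2 for v = 0 and
  -- s(3s+1)/2 for v = 1.
  pentagonal : ℕ → ℕ → ℕ
  pentagonal v zero    = 0
  pentagonal v (suc s) = suc (s ℕ.* 3 ℕ.+ v) ℕ.+ pentagonal v s

  2*pentagonal : ∀ v s → 2 ℕ.* pentagonal v s ℕ.+ s ≡ s ℕ.* (3 ℕ.* s ℕ.+ 2 ℕ.* v)
  2*pentagonal v zero    = ≡.refl
  2*pentagonal v (suc s) = ≡.trans (regroup s v (pentagonal v s))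
    (≡.trans (≡.cong (2 ℕ.* suc (s ℕ.* 3 ℕ.+ v) ℕ.+ 1 ℕ.+_) (2*pentagonal v s)) (expand s v))
    where
    regroup : ∀ s v p → 2 ℕ.* (suc (s ℕ.* 3 ℕ.+ v) ℕ.+ p) ℕ.+ suc s ≡ 2 ℕ.* suc (s ℕ.* 3 ℕ.+ v) ℕ.+ 1 ℕ.+ (2 ℕ.* p ℕ.+ s)
    regroup = solve-∀
    expand : ∀ s v → 2 ℕ.* suc (s ℕ.* 3 ℕ.+ v) ℕ.+ 1 ℕ.+ s ℕ.* (3 ℕ.* s ℕ.+ 2 ℕ.* v) ≡ suc s ℕ.* (3 ℕ.* suc s ℕ.+ 2 ℕ.* v)
    expand = solve-∀

  ez-pentagonal : ∀ v → ez v ≈ 1# → ∀ s → ez (s ℕ.* 3 ℕ.+ v) ≈ (- 1#) ^ s * q ^ pentagonal v s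
  ez-pentagonal v ez-v zero    = trans ez-v (sym (*-identityˡ 1#))
  ez-pentagonal v ez-v (suc s) = begin
    ez (3 ℕ.+ (s ℕ.* 3 ℕ.+ v))                          ≈⟨ ez-recurrence (s ℕ.* 3 ℕ.+ v) ⟩
    - (x * ez (s ℕ.* 3 ℕ.+ v))                          ≈⟨ -‿cong (*-congˡ (ez-pentagonal v ez-v s)) ⟩
    - (x * ((- 1#) ^ s * q ^ pentagonal v s))
      ≈⟨ solve 3 (λ x y z → :- (x :* (y :* z)) := (:- con (+ 1)) :* y :* (x :* z)) refl x _ _ ⟩
    (- 1#) ^ suc s * (x * q ^ pentagonal v s)           ≈⟨ *-congˡ (^-+ q (suc (s ℕ.* 3 ℕ.+ v)) _) ⟨
    (- 1#) ^ suc s * q ^ pentagonal v (suc s)           ∎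
    where x = q ^ suc (s ℕ.* 3 ℕ.+ v)

  -- Writing r = 2y + ρ turns 2c + r = 2x + ρ into c + y = x; the bound on ρ makes both recursions
  -- stop at the same place.
  half≈diag : ∀ x ρ f → ρ ≤ 1 → half (x ℕ.* 2 ℕ.+ ρ) f ≈ diag x (λ c y → f c (y ℕ.* 2 ℕ.+ ρ))
  half≈diag zero    .0 f z≤n       = refl
  half≈diag zero    .1 f (s≤s z≤n) = refl
  half≈diag (suc x) ρ  f ρ≤1       = +-congˡ (half≈diag x ρ _ ρ≤1)

-- H at a primitive root of unity.

module RootOfUnity {c ℓ : Level} (R : CommutativeRing c ℓ) (domain : IsIntegralDomain R)
  (N : ℕ) (1≤N : 1 ≤ N) (q : CommutativeRing.Carrier R) (primitive-root : PrimitiveRoot R N q)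
  (qi : CommutativeRing.Carrier R)
  (q·qi≈1 : CommutativeRing._≈_ R (CommutativeRing._*_ R q qi) (CommutativeRing.1# R)) where
  open CommutativeRing R hiding (zero)
  open FiniteSums R
  open IntegralDomain R domain
  open GaussianBinomials R q
  private module Q = GaussianBinomials R qi
  open EkhadZeilberger R qi using (ez; signed⁻; signed≈; half≈diag)
  open BaileyChain R q using (weight; odd-term)
  open import Relation.Binary.Reasoning.Setoid setoid

  q^N : q ^ N ≈ 1#
  q^N = proj₁ primitive-root

  q^≉1 : ∀ k → 0 < k → k < N → ¬ q ^ k ≈ 1#
  q^≉1 = proj₂ primitive-root

  invert : ∀ n → q ^ n * qi ^ n ≈ 1#
  invert = ^-inverse q·qi≈1

  divide : ∀ n {x y} → q ^ n * x ≈ y → x ≈ qi ^ n * y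
  divide n {x} {y} eq = begin
    x                         ≈⟨ trans (*-congʳ (invert n)) (*-identityˡ x) ⟨
    q ^ n * qi ^ n * x        ≈⟨ solve 3 (λ a b x → a :* b :* x := b :* (a :* x)) refl (q ^ n) (qi ^ n) x ⟩
    qi ^ n * (q ^ n * x)      ≈⟨ *-congˡ eq ⟩
    qi ^ n * y                ∎

  q^-periodic : ∀ a k → q ^ (a ℕ.+ k ℕ.* N) ≈ q ^ a
  q^-periodic a k = begin
    q ^ (a ℕ.+ k ℕ.* N)      ≈⟨ ^-+ q a (k ℕ.* N) ⟩
    q ^ a * q ^ (k ℕ.* N)    ≈⟨ *-congˡ (trans (^-* q k N) (trans (^-cong k q^N) (1^ k))) ⟩
    q ^ a * 1#               ≈⟨ *-identityʳ _ ⟩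
    q ^ a                    ∎

  q^-mod : ∀ {a b} k l → a ℕ.+ k ℕ.* N ≡ b ℕ.+ l ℕ.* N → q ^ a ≈ q ^ b
  q^-mod {a} {b} k l eq = trans (sym (q^-periodic a k)) (trans (^-≡ q eq) (q^-periodic b l))

  -- `G-absorb` produces the factor 1 - q^N = 0, while 1 - q^(a+1) is nonzero by primitivity.
  G-middle : ∀ a b → suc a ℕ.+ suc b ≡ N → G (suc a) (suc b) ≈ 0#
  G-middle a b eq = cancel-nonzero 1-q^a≉0 (begin
    (1# - q ^ suc a) * G (suc a) (suc b)           ≈⟨ G-absorb a (suc b) ⟩
    (1# - q ^ (suc a ℕ.+ suc b)) * G a (suc b)     ≈⟨ *-congʳ (+-congˡ (-‿cong (trans (^-≡ q eq) q^N))) ⟩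
    (1# - 1#) * G a (suc b)                        ≈⟨ solve 2 (λ x y → (con (+ 1) :- con (+ 1)) :* x := y :* con (+ 0)) refl _ (1# - q ^ suc a) ⟩
    (1# - q ^ suc a) * 0#                          ∎)
    where
    1-q^a≉0 : ¬ 1# - q ^ suc a ≈ 0#
    1-q^a≉0 eq′ = q^≉1 (suc a) z<s (≡.subst (suc a <_) eq (ℕₚ.m<m+n (suc a) z<s))
                    (sym (difference-zero eq′))

  -- [N-1-b; c]_q = (-1)^c q^(-c(c+1)/2) [b+c; c]_{1/q}
  reflection : ∀ b c d → c ℕ.+ d ℕ.+ suc b ≡ N → G c d ≈ Q.signed c * Q.G c b
  reflection b       zero    d eq = solve 0 (con (+ 1) := con (+ 1) :* con (+ 1) :* con (+ 1)) refl
  reflection zero    (suc c) d eq = trans (divide (suc c) (begin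
    q ^ suc c * G (suc c) d
      ≈⟨ solve 2 (λ x y → y := (x :+ y) :- x) refl (G c (suc d)) _ ⟩
    G (suc c) (suc d) - G c (suc d)
      ≈⟨ +-cong (G-middle c d (≡.trans (corner c d) eq)) (-‿cong (reflection zero c (suc d) (≡.trans (slide c d) eq))) ⟩
    0# - Q.signed c * Q.G c 0
      ≈⟨ +-congˡ (-‿cong (*-congˡ (Q.G₀ c))) ⟩
    0# - Q.signed c * 1# ∎))
    (trans (solve 3 (λ x s t → x :* (con (+ 0) :- s :* t :* con (+ 1)) := (:- con (+ 1)) :* s :* (x :* t) :* con (+ 1))
              refl (qi ^ suc c) ((- 1#) ^ c) (qi ^ tri c))
           (*-congʳ (*-congˡ (sym (^-+ qi (suc c) (tri c))))))
    where
    corner : ∀ c d → suc c ℕ.+ suc d ≡ suc c ℕ.+ d ℕ.+ 1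
    corner = solve-∀
    slide : ∀ c d → c ℕ.+ suc d ℕ.+ 1 ≡ suc c ℕ.+ d ℕ.+ 1
    slide = solve-∀
  -- Pascal's rule is read downwards: an entry of row N-2-b comes from the row above it (smaller b)
  -- and from its left neighbour (smaller c). For b = 0 the row above is row N, whose inner entries
  -- vanish by `G-middle`.
  reflection (suc b) (suc c) d eq = trans (divide (suc c) (begin
    q ^ suc c * G (suc c) d
      ≈⟨ solve 2 (λ x y → y := (x :+ y) :- x) refl (G c (suc d)) _ ⟩
    G (suc c) (suc d) - G c (suc d)
      ≈⟨ +-cong (reflection b (suc c) (suc d) (≡.trans (corner b c d) eq))
                (-‿cong (reflection (suc b) c (suc d) (≡.trans (slide b c d) eq))) ⟩
    Q.signed (suc c) * Q.G (suc c) b - Q.signed c * Q.G c (suc b)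
      ≈⟨ +-congʳ (*-congʳ step) ⟩
    - (qi ^ suc c * Q.signed c) * Q.G (suc c) b - Q.signed c * Q.G c (suc b) ∎))
    (trans (solve 4 (λ x s g h → x :* (:- (x :* s) :* g :- s :* h) := :- (x :* s) :* (h :+ x :* g))
              refl (qi ^ suc c) (Q.signed c) (Q.G (suc c) b) (Q.G c (suc b)))
           (*-congʳ (sym step)))
    where
    corner : ∀ b c d → suc c ℕ.+ suc d ℕ.+ suc b ≡ suc c ℕ.+ d ℕ.+ suc (suc b)
    corner = solve-∀
    slide : ∀ b c d → c ℕ.+ suc d ℕ.+ suc (suc b) ≡ suc c ℕ.+ d ℕ.+ suc (suc b)
    slide = solve-∀
    step : Q.signed (suc c) ≈ - (qi ^ suc c * Q.signed c)
    step = trans (*-congˡ (^-+ qi (suc c) (tri c)))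
      (solve 3 (λ x s t → (:- con (+ 1)) :* s :* (x :* t) := :- (x :* (s :* t))) refl (qi ^ suc c) ((- 1#) ^ c) (qi ^ tri c))

  -- The case b = d = 0 of `reflection`, whose left side is 1. It determines the sign of
  -- q^(N(N-1)/2) without a distinction by the parity of N.
  q^tri : ∀ m → suc m ≡ N → q ^ tri m ≈ (- 1#) ^ m
  q^tri m eq = begin
    q ^ tri m                                   ≈⟨ *-identityʳ _ ⟨
    q ^ tri m * 1#                              ≈⟨ *-congˡ (trans (sym (G₀ m)) (reflection 0 m 0 (≡.trans (last m) eq))) ⟩
    q ^ tri m * ((- 1#) ^ m * qi ^ tri m * Q.G m 0)
      ≈⟨ *-congˡ (trans (*-congˡ (Q.G₀ m)) (*-identityʳ _)) ⟩
    q ^ tri m * ((- 1#) ^ m * qi ^ tri m)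
      ≈⟨ solve 3 (λ x s y → x :* (s :* y) := s :* (x :* y)) refl _ _ _ ⟩
    (- 1#) ^ m * (q ^ tri m * qi ^ tri m)       ≈⟨ *-congˡ (invert (tri m)) ⟩
    (- 1#) ^ m * 1#                             ≈⟨ *-identityʳ _ ⟩
    (- 1#) ^ m                                  ∎
    where
    last : ∀ m → m ℕ.+ 0 ℕ.+ 1 ≡ suc m
    last = solve-∀

  poch-root : ∀ a n t → t < n → a * q ^ t ≈ 1# → poch R q a n ≈ 0#
  poch-root a (suc n) t t<1+n root with ℕₚ.m<1+n⇒m<n∨m≡n t<1+n
  ... | inj₁ t<n    = trans (*-congʳ (poch-root a n t t<n root)) (zeroˡ _)
  ... | inj₂ ≡.refl = trans (*-congˡ (trans (+-congˡ (-‿cong root)) (-‿inverseʳ 1#))) (zeroʳ _)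

  multiple : ∀ {a} k → a ≡ k ℕ.* N → q ^ a ≈ 1#
  multiple k eq = trans (^-≡ q eq) (q^-periodic 0 k)

  -- The exponents m, ..., 2m-1 of the factors contain a multiple of N: N itself if m ≤ N, and
  -- otherwise the next multiple of N above m.
  poch-vanishes : ∀ m → N < m ℕ.+ m → poch R q (q ^ m) m ≈ 0#
  poch-vanishes m N<2m with m ℕₚ.≤? N
  ... | yes m≤N = poch-root (q ^ m) m (N ∸ m)
          (ℕₚ.+-cancelˡ-< m _ _ (≡.subst (_< m ℕ.+ m) (≡.sym (ℕₚ.m+[n∸m]≡n m≤N)) N<2m))
          (trans (sym (^-+ q m _)) (multiple 1 (≡.trans (ℕₚ.m+[n∸m]≡n m≤N) (≡.sym (ℕₚ.*-identityˡ N)))))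
  ... | no m≰N = poch-root (q ^ m) m (N ∸ r) (ℕₚ.≤-<-trans (ℕₚ.m∸n≤m N r) (ℕₚ.≰⇒> m≰N))
          (trans (sym (^-+ q m _)) (multiple (suc (m / N)) total))
    where
    instance _ = ℕ.>-nonZero 1≤N
    r = m % N
    total : m ℕ.+ (N ∸ r) ≡ suc (m / N) ℕ.* N
    total = ≡.trans (≡.cong (ℕ._+ (N ∸ r)) (m≡m%n+[m/n]*n m N))
      (≡.trans (move r (m / N ℕ.* N) (N ∸ r))
        (≡.cong (ℕ._+ m / N ℕ.* N) (ℕₚ.m+[n∸m]≡n (ℕₚ.<⇒≤ (m%n<n m N)))))
      where
      move : ∀ x y z → x ℕ.+ y ℕ.+ z ≡ x ℕ.+ z ℕ.+ y
      move = solve-∀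

  -- The coefficient β i q^(i+1) ez l of w i - w (i+1), with q^(i+1) absorbed into the triangular
  -- exponent.
  jump : ℕ → ℕ → Carrier
  jump i l = (- 1#) ^ i * q ^ tri (suc i) * ez l

  module _ (charZero : CharZero R) (j : ℕ) where
    private
      w : ℕ → Carrier
      w = weight (suc j)

    summand : ℕ → Carrier
    summand m = q ^ m * poch R q (q ^ m) m * inner R q j m

    summand₀ : summand 0 ≈ 1#
    summand₀ = trans (*-cong (*-identityʳ 1#) (inner₀ j)) (*-identityʳ 1#)
      where
      inner₀ : ∀ j → inner R q j 0 ≈ 1#
      inner₀ zero    = refl
      inner₀ (suc j) = trans (+-identityˡ _) (trans (*-cong (*-identityʳ 1#) (inner₀ j)) (*-identityʳ 1#))

    module _ (κ ρ : ℕ) (ρ≤1 : ρ ≤ 1) (N≡ : N ≡ suc κ ℕ.* 2 ℕ.+ ρ) where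

      -- For fixed i the binomials reflect to [c + 2y + ρ; c] at 1/q with c + y = κ - i. Of q^(μ+1)
      -- = q^(i+1) q^c, the factor q^c changes q^(-c(c+1)/2) into q^(-c(c-1)/2), which is exactly
      -- the coefficient in `ez`; the index 2(κ-i) + ρ is N-2-2i.
      nonzero-summands : sumBelow R (suc κ) (λ μ → summand (suc μ))
        ≈ diag κ (λ i x → (w i - w (suc i)) * jump i (x ℕ.* 2 ℕ.+ ρ))
      nonzero-summands = begin
        sumBelow R (suc κ) (λ μ → summand (suc μ))        ≈⟨ sum≈diag κ _ ⟩
        diag κ (λ μ y → summand (suc μ))                  ≈⟨ diag-cong κ expand ⟩
        diag κ (λ μ y → diag μ (λ i c → F i c y))         ≈⟨ diag-assoc κ F ⟩
        diag κ (λ i x → diag x (λ c y → F i c y))         ≈⟨ diag-cong κ (λ i x _ → collect i x) ⟩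
        diag κ (λ i x → (w i - w (suc i)) * jump i (x ℕ.* 2 ℕ.+ ρ)) ∎
        where
        C : ℕ → Carrier
        C i = (w i - w (suc i)) * ((- 1#) ^ i * q ^ tri (suc i))
        F : ℕ → ℕ → ℕ → Carrier
        F i c y = C i * (signed⁻ c * Q.G c (y ℕ.* 2 ℕ.+ ρ))
        collect : ∀ i x → diag x (λ c y → F i c y) ≈ (w i - w (suc i)) * jump i (x ℕ.* 2 ℕ.+ ρ)
        collect i x = trans (diag-*ˡ x (C i) _)
          (trans (*-congˡ (sym (half≈diag x ρ _ ρ≤1))) (*-assoc _ _ _))
        expand : ∀ μ y → μ ℕ.+ y ≡ κ → summand (suc μ) ≈ diag μ (λ i c → F i c y)
        expand μ y μ+y≡κ = begin
          summand (suc μ)                               ≈⟨ *-assoc _ _ _ ⟩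
          q ^ suc μ * (poch R q (q ^ suc μ) (suc μ) * inner R q j (suc μ))
            ≈⟨ *-congˡ (halved-term charZero q·qi≈1 j μ) ⟩
          q ^ suc μ * diag μ (λ i c → (w i - w (suc i)) * odd-term i c)
            ≈⟨ sym (diag-*ˡ μ (q ^ suc μ) _) ⟩
          diag μ (λ i c → q ^ suc μ * ((w i - w (suc i)) * odd-term i c))
            ≈⟨ diag-cong μ reflect ⟩
          diag μ (λ i c → F i c y) ∎
          where
          total : ∀ i c y ρ → c ℕ.+ suc (c ℕ.+ (i ℕ.+ i)) ℕ.+ suc (y ℕ.* 2 ℕ.+ ρ) ≡ suc (i ℕ.+ c ℕ.+ y) ℕ.* 2 ℕ.+ ρ
          total = solve-∀
          reflect : ∀ i c → i ℕ.+ c ≡ μ → q ^ suc μ * ((w i - w (suc i)) * odd-term i c) ≈ F i c y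
          reflect i c ≡.refl = begin
            q ^ (suc i ℕ.+ c) * (W * (s * t * G c (suc (c ℕ.+ (i ℕ.+ i)))))
              ≈⟨ *-cong (^-+ q (suc i) c) (*-congˡ (*-congˡ (reflection (y ℕ.* 2 ℕ.+ ρ) c _ N≡′))) ⟩
            q ^ suc i * q ^ c * (W * (s * t * (Q.signed c * g)))
              ≈⟨ *-congˡ (*-congˡ (*-congˡ (*-congʳ (signed≈ c)))) ⟩
            q ^ suc i * q ^ c * (W * (s * t * (qi ^ c * signed⁻ c * g)))
              ≈⟨ solve 8 (λ x y w s t z u g → x :* y :* (w :* (s :* t :* (z :* u :* g)))
                    := (y :* z) :* (w :* (s :* (x :* t)) :* (u :* g)))
                   refl (q ^ suc i) (q ^ c) W s t (qi ^ c) (signed⁻ c) g ⟩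
            q ^ c * qi ^ c * (W * (s * (q ^ suc i * t)) * (signed⁻ c * g))
              ≈⟨ trans (*-congʳ (invert c)) (*-identityˡ _) ⟩
            W * (s * (q ^ suc i * t)) * (signed⁻ c * g)
              ≈⟨ *-congʳ (*-congˡ (*-congˡ (sym (^-+ q (suc i) (tri i))))) ⟩
            F i c y ∎
            where
            W = w i - w (suc i)
            s = (- 1#) ^ i
            t = q ^ tri i
            g = Q.G c (y ℕ.* 2 ℕ.+ ρ)
            N≡′ : c ℕ.+ suc (c ℕ.+ (i ℕ.+ i)) ℕ.+ suc (y ℕ.* 2 ℕ.+ ρ) ≡ N
            N≡′ = ≡.trans (total i c y ρ)
              (≡.trans (≡.cong (λ κ → suc κ ℕ.* 2 ℕ.+ ρ) μ+y≡κ) (≡.sym N≡))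

    summand-vanishes : ∀ m → N < m ℕ.+ m → summand m ≈ 0#
    summand-vanishes m N<2m =
      trans (*-congʳ (trans (*-congˡ (poch-vanishes m N<2m)) (zeroʳ _))) (zeroˡ _)

    -- By `summand-vanishes` only indices up to N/2 contribute, so all sufficiently long truncations
    -- agree.
    Htrunc-stable : ∀ K M → N < suc K ℕ.+ suc K → suc K ≤ M →
      sumBelow R M summand ≈ sumBelow R (suc K) summand
    Htrunc-stable K M N<2K K<M = begin
      sumBelow R M summand               ≡⟨ ≡.cong (λ M → sumBelow R M summand) (ℕₚ.m+[n∸m]≡n K<M) ⟨
      sumBelow R (suc K ℕ.+ (M ∸ suc K)) summand ≈⟨ sum-split (suc K) (M ∸ suc K) summand ⟩
      sumBelow R (suc K) summand + sumBelow R (M ∸ suc K) (λ i → summand (suc K ℕ.+ i))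
        ≈⟨ +-congˡ (trans (sum-cong (M ∸ suc K) tail) (trans (sum-*ˡ (M ∸ suc K) 0# (λ _ → 0#)) (zeroˡ _))) ⟩
      sumBelow R (suc K) summand + 0#    ≈⟨ +-identityʳ _ ⟩
      sumBelow R (suc K) summand         ∎
      where
      tail : ∀ i → i < M ∸ suc K → summand (suc K ℕ.+ i) ≈ 0# * 0#
      tail i _ = trans (summand-vanishes (suc K ℕ.+ i)
        (ℕₚ.<-≤-trans N<2K (ℕₚ.+-mono-≤ (ℕₚ.m≤m+n (suc K) i) (ℕₚ.m≤m+n (suc K) i)))) (sym (zeroˡ 0#))

-- Residues modulo 3 and congruences of exponents modulo N.

mod₃ : ∀ n → ∃[ s ] (n ≡ s ℕ.* 3 ℕ.+ 0 ⊎ n ≡ s ℕ.* 3 ℕ.+ 1 ⊎ n ≡ s ℕ.* 3 ℕ.+ 2)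
mod₃ zero                = 0 , inj₁ ≡.refl
mod₃ (suc zero)          = 0 , inj₂ (inj₁ ≡.refl)
mod₃ (suc (suc zero))    = 0 , inj₂ (inj₂ ≡.refl)
mod₃ (suc (suc (suc n))) with mod₃ n
... | s , inj₁ ≡.refl        = suc s , inj₁ ≡.refl
... | s , inj₂ (inj₁ ≡.refl) = suc s , inj₂ (inj₁ ≡.refl)
... | s , inj₂ (inj₂ ≡.refl) = suc s , inj₂ (inj₂ ≡.refl)

-- Residues 1, 2, 3 instead of 0, 1, 2: for a positive multiple l = 3s + 3 the index l - 2 = 3s + 1
-- is then available without subtraction.
Mod₃⁺ : ℕ → Set
Mod₃⁺ n = ∃[ s ] (n ≡ s ℕ.* 3 ℕ.+ 1 ⊎ n ≡ s ℕ.* 3 ℕ.+ 2 ⊎ n ≡ s ℕ.* 3 ℕ.+ 3)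

mod₃⁺ : ∀ n → Mod₃⁺ (suc n)
mod₃⁺ n with mod₃ n
... | s , inj₁ ≡.refl        = s , inj₁ (≡.sym (ℕₚ.+-suc (s ℕ.* 3) 0))
... | s , inj₂ (inj₁ ≡.refl) = s , inj₂ (inj₁ (≡.sym (ℕₚ.+-suc (s ℕ.* 3) 1)))
... | s , inj₂ (inj₂ ≡.refl) = s , inj₂ (inj₂ (≡.sym (ℕₚ.+-suc (s ℕ.* 3) 2)))

2*tri : ∀ n → 2 ℕ.* tri n ≡ n ℕ.* suc n
2*tri zero    = ≡.refl
2*tri (suc n) = ≡.trans (ℕₚ.*-distribˡ-+ 2 (suc n) (tri n))
  (≡.trans (≡.cong (2 ℕ.* suc n ℕ.+_) (2*tri n)) (regroup n))
  where
  regroup : ∀ n → 2 ℕ.* suc n ℕ.+ n ℕ.* suc n ≡ suc n ℕ.* suc (suc n)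
  regroup = solve-∀

-- The exponents of alphaHat (3r + k) are a₀ r, a₁ r and a₂ r, a₃ r for k = 0, 1, 2; for N = 2n + l
-- those of ez l are ζ₀ n s and ζ₁ n s when l = 3s and l = 3s + 1. The identities below are congruences
-- modulo N, with the multiples of N distributed so that no subtraction occurs.
module ExponentIdentities where
  open import Data.Nat using (_+_; _*_)

  a₀ a₁ a₂ a₃ : ℕ → ℕ
  a₀ r = 3 * r * r + r
  a₁ r = 3 * r * r + 2 * r
  a₂ r = 3 * r * r + 4 * r + 1
  a₃ r = 3 * r * r + 5 * r + 2

  ζ₀ ζ₁ : ℕ → ℕ → ℕ
  ζ₀ n s = 4 * n * s + 2 * s + 2 * n * n + n
  ζ₁ n s = 4 * n * s + 2 * n * n + n

  mod-0-1-1 : ∀ r s → let n = suc (r * 3 + 0); R = r + s; N = 2 * n + (s * 3 + 1) in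
    (n + (3 * r * r + r)) + s * N ≡ ((3 * R * R + 2 * R) + (2 * r + s + 1)) + 0 * N
  mod-0-1-1 = solve-∀
  mod-0-1-2 : ∀ r s → let n = suc (r * 3 + 0); R = r + s; N = 2 * n + (s * 3 + 1) in
    (n * n + n + (4 * n * s + 2 * n * n + n)) + s * N ≡ ((3 * R * R + 2 * R) + (2 * r + s + 1) + (2 * r + s + 1)) + (4 * r + 1) * N
  mod-0-1-2 = solve-∀
  third-0-1 : ∀ r s → (2 * r + s + 1) * 3 ≡ 2 * suc (r * 3 + 0) + (s * 3 + 1)
  third-0-1 = solve-∀
  mod-0-2-1 : ∀ r s → let n = suc (r * 3 + 0); R = r + s; N = 2 * n + (s * 3 + 2) in
    (3 * R * R + 4 * R + 1) + 0 * N ≡ (n + (3 * r * r + r)) + s * N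
  mod-0-2-1 = solve-∀
  mod-0-2-2 : ∀ r s → let n = suc (r * 3 + 0); R = r + s; N = 2 * n + (s * 3 + 2) in
    (3 * R * R + 5 * R + 2) + (4 * r + 3) * N ≡ (suc n * suc n + (4 * suc n * s + 2 * s + 2 * suc n * suc n + suc n)) + s * N
  mod-0-2-2 = solve-∀
  mod-0-3-1 : ∀ r s → let n = suc (r * 3 + 0); R = suc (r + s); N = 2 * n + (s * 3 + 3) in
    (3 * R * R + R) + (4 * r + 2) * N ≡ (suc n * suc n + (4 * suc n * s + 2 * suc n * suc n + suc n)) + s * N
  mod-0-3-1 = solve-∀
  mod-0-3-2 : ∀ r s → let n = suc (r * 3 + 0); R = suc (r + s); N = 2 * n + (s * 3 + 3) in
    (n + (3 * r * r + r)) + (4 * r + 2) * N ≡ (n * n + n + (4 * n * suc s + 2 * suc s + 2 * n * n + n)) + 0 * N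
  mod-0-3-2 = solve-∀
  mod-1-1-1 : ∀ r s → let n = suc (r * 3 + 1); R = r + s; N = 2 * n + (s * 3 + 1) in
    (3 * R * R + 4 * R + 1) + (4 * r + 3) * N ≡ (n * n + n + (4 * n * s + 2 * n * n + n)) + s * N
  mod-1-1-1 = solve-∀
  mod-1-1-2 : ∀ r s → let n = suc (r * 3 + 1); R = r + s; N = 2 * n + (s * 3 + 1) in
    (3 * R * R + 5 * R + 2) + 0 * N ≡ (n + (3 * r * r + 2 * r)) + s * N
  mod-1-1-2 = solve-∀
  mod-1-2-1 : ∀ r s → let n = suc (r * 3 + 1); R = suc (r + s); N = 2 * n + (s * 3 + 2) in
    (suc n * suc n + (4 * suc n * s + 2 * s + 2 * suc n * suc n + suc n)) + s * N ≡ ((3 * R * R + R) + (2 * r + s + 2)) + (4 * r + 4) * N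
  mod-1-2-1 = solve-∀
  mod-1-2-2 : ∀ r s → let n = suc (r * 3 + 1); R = suc (r + s); N = 2 * n + (s * 3 + 2) in
    (n + (3 * r * r + 2 * r)) + (s + 1) * N ≡ ((3 * R * R + R) + (2 * r + s + 2) + (2 * r + s + 2)) + 0 * N
  mod-1-2-2 = solve-∀
  third-1-2 : ∀ r s → (2 * r + s + 2) * 3 ≡ 2 * suc (r * 3 + 1) + (s * 3 + 2)
  third-1-2 = solve-∀
  mod-1-3-1 : ∀ r s → let n = suc (r * 3 + 1); R = suc (r + s); N = 2 * n + (s * 3 + 3) in
    (3 * R * R + 2 * R) + (4 * r + 3) * N ≡ (n * n + n + (4 * n * suc s + 2 * suc s + 2 * n * n + n)) + s * N
  mod-1-3-1 = solve-∀
  mod-1-3-2 : ∀ r s → let n = suc (r * 3 + 1); R = suc (r + s); N = 2 * n + (s * 3 + 3) in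
    (n + (3 * r * r + 2 * r)) + (4 * r + 4) * N ≡ (suc n * suc n + (4 * suc n * s + 2 * suc n * suc n + suc n)) + 0 * N
  mod-1-3-2 = solve-∀
  mod-2-1-1 : ∀ r s → let n = suc (r * 3 + 2); R = suc (r + s); N = 2 * n + (s * 3 + 1) in
    (3 * R * R + R) + 0 * N ≡ (n + (3 * r * r + 4 * r + 1)) + s * N
  mod-2-1-1 = solve-∀
  mod-2-1-2 : ∀ r s → let n = suc (r * 3 + 2); R = suc (r + s); N = 2 * n + (s * 3 + 1) in
    (n + (3 * r * r + 5 * r + 2)) + (4 * r + 4) * N ≡ (n * n + n + (4 * n * s + 2 * n * n + n)) + 0 * N
  mod-2-1-2 = solve-∀
  mod-2-2-1 : ∀ r s → let n = suc (r * 3 + 2); R = suc (r + s); N = 2 * n + (s * 3 + 2) in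
    (3 * R * R + 2 * R) + 0 * N ≡ (n + (3 * r * r + 5 * r + 2)) + s * N
  mod-2-2-1 = solve-∀
  mod-2-2-2 : ∀ r s → let n = suc (r * 3 + 2); R = suc (r + s); N = 2 * n + (s * 3 + 2) in
    (n + (3 * r * r + 4 * r + 1)) + (4 * r + 6) * N ≡ (suc n * suc n + (4 * suc n * s + 2 * s + 2 * suc n * suc n + suc n)) + 0 * N
  mod-2-2-2 = solve-∀
  mod-2-3-1 : ∀ r s → let n = suc (r * 3 + 2); R = suc (r + s); N = 2 * n + (s * 3 + 3) in
    (n * n + n + (4 * n * suc s + 2 * suc s + 2 * n * n + n)) + s * N ≡ ((3 * R * R + 4 * R + 1) + (2 * r + s + 3)) + (4 * r + 4) * N
  mod-2-3-1 = solve-∀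
  mod-2-3-2 : ∀ r s → let n = suc (r * 3 + 2); R = suc (r + s); N = 2 * n + (s * 3 + 3) in
    (n + (3 * r * r + 5 * r + 2)) + (s + 1) * N ≡ ((3 * R * R + 4 * R + 1) + (2 * r + s + 3) + (2 * r + s + 3)) + 0 * N
  mod-2-3-2 = solve-∀
  mod-2-3-3 : ∀ r s → let n = suc (r * 3 + 2); R = suc (r + s); N = 2 * n + (s * 3 + 3) in
    (n + (3 * r * r + 4 * r + 1)) + (s + 1) * N ≡ ((3 * R * R + 5 * R + 2) + (2 * r + s + 3)) + 0 * N
  mod-2-3-3 = solve-∀
  mod-2-3-4 : ∀ r s → let n = suc (r * 3 + 2); R = suc (r + s); N = 2 * n + (s * 3 + 3) in
    (suc n * suc n + (4 * suc n * s + 2 * suc n * suc n + suc n)) + s * N ≡ ((3 * R * R + 5 * R + 2) + (2 * r + s + 3) + (2 * r + s + 3)) + (4 * r + 4) * N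
  mod-2-3-4 = solve-∀
  third-2-3 : ∀ r s → (2 * r + s + 3) * 3 ≡ 2 * suc (r * 3 + 2) + (s * 3 + 3)
  third-2-3 = solve-∀

-- Closed forms of ez and α̂ as powers of q.

module ClosedForms {c ℓ : Level} (R : CommutativeRing c ℓ) (domain : IsIntegralDomain R)
  (N : ℕ) (1≤N : 1 ≤ N) (q : CommutativeRing.Carrier R) (primitive-root : PrimitiveRoot R N q)
  (qi : CommutativeRing.Carrier R)
  (q·qi≈1 : CommutativeRing._≈_ R (CommutativeRing._*_ R q qi) (CommutativeRing.1# R)) where
  open CommutativeRing R hiding (zero)
  open FiniteSums R
  open IntegralDomain R domain
  open RootOfUnity R domain N 1≤N q primitive-root qi q·qi≈1
  open EkhadZeilberger R qi using (ez; ez₀; ez₁; ez-3s+2; ez-pentagonal; pentagonal; 2*pentagonal)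
  open ExponentIdentities using (a₀; a₁; a₂; a₃; ζ₀; ζ₁)
  open import Relation.Binary.Reasoning.Setoid setoid

  q^-≡-mod : ∀ {M} → M ≡ N → ∀ a b k l → a ℕ.+ k ℕ.* M ≡ b ℕ.+ l ℕ.* M → q ^ a ≈ q ^ b
  q^-≡-mod ≡.refl a b k l = q^-mod {a} {b} k l

  -1^even : ∀ k → (- 1#) ^ (k ℕ.* 2) ≈ 1#
  -1^even k = trans (^-* (- 1#) k 2) (trans (^-cong k
    (solve 0 ((:- con (+ 1)) :* ((:- con (+ 1)) :* con (+ 1)) := con (+ 1)) refl)) (1^ k))

  -1^-parity : ∀ k s → (- 1#) ^ (k ℕ.* 2 ℕ.+ s) ≈ (- 1#) ^ s
  -1^-parity k s = trans (^-+ (- 1#) (k ℕ.* 2) s) (trans (*-congʳ (-1^even k)) (*-identityˡ _))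

  -- q^(N(N-1)/2) = (-1)^(N-1) absorbs the signs in the pentagonal form of ez.
  ez-3s+1 : ∀ n s → 2 ℕ.* n ℕ.+ (s ℕ.* 3 ℕ.+ 1) ≡ N → ez (s ℕ.* 3 ℕ.+ 1) ≈ q ^ ζ₁ n s
  ez-3s+1 n s N≡ = trans (ez-pentagonal 1 ez₁ s) (sym (trans (divide (pentagonal 1 s) (begin
    q ^ pentagonal 1 s * q ^ ζ₁ n s     ≈⟨ ^-+ q (pentagonal 1 s) (ζ₁ n s) ⟨
    q ^ (pentagonal 1 s ℕ.+ ζ₁ n s)     ≈⟨ q^-≡-mod ≡.refl (pentagonal 1 s ℕ.+ ζ₁ n s) (tri m) s 0
                                             (≡.subst (λ N → pentagonal 1 s ℕ.+ ζ₁ n s ℕ.+ s ℕ.* N ≡ tri m ℕ.+ 0) 1+m≡N (≡.sym exponent)) ⟩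
    q ^ tri m                           ≈⟨ q^tri m 1+m≡N ⟩
    (- 1#) ^ m                          ≈⟨ ^-≡ (- 1#) (parity n s) ⟩
    (- 1#) ^ ((n ℕ.+ s) ℕ.* 2 ℕ.+ s)    ≈⟨ -1^-parity (n ℕ.+ s) s ⟩
    (- 1#) ^ s                          ∎)) (*-comm _ _)))
    where
    m = 2 ℕ.* n ℕ.+ s ℕ.* 3
    successor : ∀ n s → suc (2 ℕ.* n ℕ.+ s ℕ.* 3) ≡ 2 ℕ.* n ℕ.+ (s ℕ.* 3 ℕ.+ 1)
    successor = solve-∀
    1+m≡N : suc m ≡ N
    1+m≡N = ≡.trans (successor n s) N≡
    parity : ∀ n s → 2 ℕ.* n ℕ.+ s ℕ.* 3 ≡ (n ℕ.+ s) ℕ.* 2 ℕ.+ s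
    parity = solve-∀
    double : ∀ p n s → let m = 2 ℕ.* n ℕ.+ s ℕ.* 3 in
      2 ℕ.* (p ℕ.+ (4 ℕ.* n ℕ.* s ℕ.+ 2 ℕ.* n ℕ.* n ℕ.+ n) ℕ.+ s ℕ.* suc m) ℕ.+ s
        ≡ 2 ℕ.* p ℕ.+ s ℕ.+ 2 ℕ.* (4 ℕ.* n ℕ.* s ℕ.+ 2 ℕ.* n ℕ.* n ℕ.+ n ℕ.+ s ℕ.* suc m)
    double = solve-∀
    collect : ∀ n s → let m = 2 ℕ.* n ℕ.+ s ℕ.* 3 in
      s ℕ.* (3 ℕ.* s ℕ.+ 2 ℕ.* 1) ℕ.+ 2 ℕ.* (4 ℕ.* n ℕ.* s ℕ.+ 2 ℕ.* n ℕ.* n ℕ.+ n ℕ.+ s ℕ.* suc m) ≡ m ℕ.* suc m ℕ.+ s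
    collect = solve-∀
    exponent : tri m ℕ.+ 0 ≡ pentagonal 1 s ℕ.+ ζ₁ n s ℕ.+ s ℕ.* suc m
    exponent = ≡.trans (ℕₚ.+-identityʳ _) (ℕₚ.*-cancelˡ-≡ _ _ 2 (ℕₚ.+-cancelʳ-≡ s _ _ (≡.sym
      (≡.trans (double (pentagonal 1 s) n s)
        (≡.trans (≡.cong (ℕ._+ 2 ℕ.* (ζ₁ n s ℕ.+ s ℕ.* suc m)) (2*pentagonal 1 s))
          (≡.trans (collect n s) (≡.cong (ℕ._+ s) (≡.sym (2*tri m)))))))))

  -- Here N ≡ s (mod 2), so (-1)^(N-1) = -(-1)^s leaves a minus sign, in contrast to l = 3s + 1,
  -- where N - 1 ≡ s.
  ez-3s : ∀ n s → 2 ℕ.* n ℕ.+ (s ℕ.* 3 ℕ.+ 0) ≡ N → ez (s ℕ.* 3 ℕ.+ 0) ≈ - q ^ ζ₀ n s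
  ez-3s n s N≡ = trans (ez-pentagonal 0 ez₀ s) (sym (trans (-‿cong (divide (pentagonal 0 s) (begin
    q ^ pentagonal 0 s * q ^ ζ₀ n s     ≈⟨ ^-+ q (pentagonal 0 s) (ζ₀ n s) ⟨
    q ^ (pentagonal 0 s ℕ.+ ζ₀ n s)     ≈⟨ q^-mod {pentagonal 0 s ℕ.+ ζ₀ n s} {tri m} s 1 exponent ⟩
    q ^ tri m                           ≈⟨ q^tri m 1+m≡N ⟩
    (- 1#) ^ m                          ≈⟨ solve 1 (λ x → x := :- ((:- con (+ 1)) :* x)) refl _ ⟩
    - (- 1#) ^ suc m                    ≈⟨ -‿cong (trans (^-≡ (- 1#) (≡.trans (≡.trans 1+m≡N (≡.sym N≡)) (parity n s)))
                                                        (-1^-parity (n ℕ.+ s) s)) ⟩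
    - (- 1#) ^ s                        ∎)))
    (solve 2 (λ x y → :- (x :* (:- y)) := y :* x) refl _ _)))
    where
    m = N ∸ 1
    1+m≡N : suc m ≡ N
    1+m≡N = ℕₚ.m+[n∸m]≡n 1≤N
    parity : ∀ n s → 2 ℕ.* n ℕ.+ (s ℕ.* 3 ℕ.+ 0) ≡ (n ℕ.+ s) ℕ.* 2 ℕ.+ s
    parity = solve-∀
    double : ∀ p n s → let N = 2 ℕ.* n ℕ.+ (s ℕ.* 3 ℕ.+ 0) in
      2 ℕ.* (p ℕ.+ (4 ℕ.* n ℕ.* s ℕ.+ 2 ℕ.* s ℕ.+ 2 ℕ.* n ℕ.* n ℕ.+ n) ℕ.+ s ℕ.* N) ℕ.+ s
        ≡ 2 ℕ.* p ℕ.+ s ℕ.+ 2 ℕ.* (4 ℕ.* n ℕ.* s ℕ.+ 2 ℕ.* s ℕ.+ 2 ℕ.* n ℕ.* n ℕ.+ n ℕ.+ s ℕ.* N)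
    double = solve-∀
    collect : ∀ n s → let N = 2 ℕ.* n ℕ.+ (s ℕ.* 3 ℕ.+ 0) in
      s ℕ.* (3 ℕ.* s ℕ.+ 2 ℕ.* 0) ℕ.+ 2 ℕ.* (4 ℕ.* n ℕ.* s ℕ.+ 2 ℕ.* s ℕ.+ 2 ℕ.* n ℕ.* n ℕ.+ n ℕ.+ s ℕ.* N) ≡ N ℕ.* suc N ℕ.+ s
    collect = solve-∀
    triangle : ∀ M → 2 ℕ.* n ℕ.+ (s ℕ.* 3 ℕ.+ 0) ≡ M → pentagonal 0 s ℕ.+ ζ₀ n s ℕ.+ s ℕ.* M ≡ tri M
    triangle M ≡.refl = ℕₚ.*-cancelˡ-≡ _ _ 2 (ℕₚ.+-cancelʳ-≡ s _ _
      (≡.trans (double (pentagonal 0 s) n s)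
        (≡.trans (≡.cong (ℕ._+ 2 ℕ.* (ζ₀ n s ℕ.+ s ℕ.* M)) (2*pentagonal 0 s))
          (≡.trans (collect n s) (≡.cong (ℕ._+ s) (≡.sym (2*tri M)))))))
    exponent : pentagonal 0 s ℕ.+ ζ₀ n s ℕ.+ s ℕ.* N ≡ tri m ℕ.+ 1 ℕ.* N
    exponent = ≡.trans (triangle N N≡) (≡.trans (≡.cong tri (≡.sym 1+m≡N))
      (≡.trans (ℕₚ.+-comm (suc m) (tri m)) (≡.cong (tri m ℕ.+_) (≡.trans 1+m≡N (≡.sym (ℕₚ.*-identityˡ N))))))

  α̂ : ℕ → Carrier
  α̂ = alphaHat R q

  α̂-from : ∀ r r₀ k → alphaHatFrom R q r₀ (r ℕ.* 3 ℕ.+ k) ≡ alphaHatFrom R q (r ℕ.+ r₀) k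
  α̂-from zero    r₀ k = ≡.refl
  α̂-from (suc r) r₀ k = ≡.trans (α̂-from r (suc r₀) k) (≡.cong (λ r → alphaHatFrom R q r k) (ℕₚ.+-suc r r₀))

  α̂-3r+k : ∀ r k → α̂ (r ℕ.* 3 ℕ.+ k) ≈ alphaHatFrom R q r k
  α̂-3r+k r k = reflexive (≡.trans (α̂-from r 0 k) (≡.cong (λ r → alphaHatFrom R q r k) (ℕₚ.+-identityʳ r)))

  α̂-0 : ∀ r → α̂ (r ℕ.* 3 ℕ.+ 0) ≈ q ^ a₀ r
  α̂-0 r = α̂-3r+k r 0

  α̂-1 : ∀ r → α̂ (r ℕ.* 3 ℕ.+ 1) ≈ - q ^ a₁ r
  α̂-1 r = α̂-3r+k r 1

  α̂-2 : ∀ r → α̂ (r ℕ.* 3 ℕ.+ 2) ≈ q ^ a₂ r - q ^ a₃ r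
  -- The index 3r + 2 is 3(r+1) - 1, so the defining exponents are those of r + 1; expanding them
  -- removes the truncated subtraction.
  α̂-2 r = trans (α̂-3r+k r 2) (+-cong (^-≡ q (subtract (2 ℕ.* suc r) (expand₂ r))) (-‿cong (^-≡ q (subtract (suc r) (expand₃ r)))))
    where
    subtract : ∀ {x y} z → x ≡ y ℕ.+ z → x ∸ z ≡ y
    subtract {y = y} z eq = ≡.trans (≡.cong (_∸ z) eq) (ℕₚ.m+n∸n≡m y z)
    expand₂ : ∀ r → 3 ℕ.* suc r ℕ.* suc r ≡ 3 ℕ.* r ℕ.* r ℕ.+ 4 ℕ.* r ℕ.+ 1 ℕ.+ 2 ℕ.* suc r
    expand₂ = solve-∀
    expand₃ : ∀ r → 3 ℕ.* suc r ℕ.* suc r ≡ 3 ℕ.* r ℕ.* r ℕ.+ 5 ℕ.* r ℕ.+ 2 ℕ.+ suc r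
    expand₃ = solve-∀

  -- The power ω = q^S with S = N/3 satisfies ω³ = 1 and, by primitivity, ω ≠ 1; hence 1 + ω + ω² =
  -- 0.
  cube-roots : ∀ x y z S → S ℕ.* 3 ≡ N → q ^ y ≈ q ^ (x ℕ.+ S) → q ^ z ≈ q ^ (x ℕ.+ S ℕ.+ S) →
    q ^ x + q ^ y + q ^ z ≈ 0#
  cube-roots x y z S 3S≡N y≈ z≈ = begin
    q ^ x + q ^ y + q ^ z                   ≈⟨ +-cong (+-congˡ y≈) z≈ ⟩
    q ^ x + q ^ (x ℕ.+ S) + q ^ (x ℕ.+ S ℕ.+ S)
      ≈⟨ +-cong (+-congˡ (^-+ q x S)) (trans (^-+ q (x ℕ.+ S) S) (*-congʳ (^-+ q x S))) ⟩
    q ^ x + q ^ x * ω + q ^ x * ω * ω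
      ≈⟨ solve 2 (λ a w → a :+ a :* w :+ a :* w :* w := a :* (con (+ 1) :+ w :+ w :* w)) refl (q ^ x) ω ⟩
    q ^ x * (1# + ω + ω * ω)                ≈⟨ *-congˡ (cancel-nonzero 1-ω≉0 vanish) ⟩
    q ^ x * 0#                              ≈⟨ zeroʳ _ ⟩
    0#                                      ∎
    where
    ω = q ^ S
    S-positive : ∀ S → S ℕ.* 3 ≡ N → 0 < S
    S-positive zero    eq = ⊥-elim (ℕₚ.<-irrefl eq 1≤N)
    S-positive (suc S) eq = z<s
    0<S = S-positive S 3S≡N
    1-ω≉0 : ¬ 1# - ω ≈ 0#
    1-ω≉0 eq = q^≉1 S 0<S (≡.subst (S <_) 3S≡N (ℕₚ.m<m*n S 3 {{ℕ.>-nonZero 0<S}} (s≤s (s≤s z≤n))))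
                 (sym (difference-zero eq))
    vanish : (1# - ω) * (1# + ω + ω * ω) ≈ (1# - ω) * 0#
    vanish = begin
      (1# - ω) * (1# + ω + ω * ω)
        ≈⟨ solve 1 (λ w → (con (+ 1) :- w) :* (con (+ 1) :+ w :+ w :* w)
              := con (+ 1) :- w :* (w :* (w :* con (+ 1)))) refl ω ⟩
      1# - ω ^ 3              ≈⟨ +-congˡ (-‿cong (trans (sym (^-* q 3 S)) (trans (^-≡ q (≡.trans (ℕₚ.*-comm 3 S) 3S≡N)) q^N))) ⟩
      1# - 1#                 ≈⟨ -‿inverseʳ 1# ⟩
      0#                      ≈⟨ zeroʳ _ ⟨
      (1# - ω) * 0#           ∎

  *-mono : ∀ n {a} → q ^ n * q ^ a ≈ q ^ (n ℕ.+ a)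
  *-mono n {a} = sym (^-+ q n a)

  *-neg : ∀ n {a} → q ^ n * - q ^ a ≈ - q ^ (n ℕ.+ a)
  *-neg n {a} = trans (solve 2 (λ x y → x :* (:- y) := :- (x :* y)) refl _ _) (-‿cong (*-mono n))

  *-diff : ∀ n {a b} → q ^ n * (q ^ a - q ^ b) ≈ q ^ (n ℕ.+ a) - q ^ (n ℕ.+ b)
  *-diff n = trans (distribˡ _ _ _) (+-cong (*-mono n) (*-neg n))

  shift : ∀ {x x′ y y′ z} → x ≈ x′ → y ≈ y′ → x′ ≈ y′ + z → x ≈ y + z
  shift x≈ y≈ eq = trans x≈ (trans eq (+-congʳ (sym y≈)))

  solve-root₁ : ∀ {x y z} → x + y + z ≈ 0# → - x ≈ y + z
  solve-root₁ {x} {y} {z} eq = sym (begin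
    y + z                ≈⟨ solve 3 (λ x y z → y :+ z := (x :+ y :+ z) :- x) refl x y z ⟩
    (x + y + z) - x      ≈⟨ +-congʳ eq ⟩
    0# - x               ≈⟨ +-identityˡ _ ⟩
    - x                  ∎)

  solve-root₂ : ∀ {x y z} → x + y + z ≈ 0# → x ≈ - z + - y
  solve-root₂ {x} {y} {z} eq = begin
    x                        ≈⟨ solve 3 (λ x y z → x := (x :+ y :+ z) :+ (:- z :+ :- y)) refl x y z ⟩
    (x + y + z) + (- z + - y) ≈⟨ +-congʳ eq ⟩
    0# + (- z + - y)         ≈⟨ +-identityˡ _ ⟩
    - z + - y                ∎

  -- Serves the case i ≡ 2, l ≡ 0 (mod 3), where both values of α̂ are differences and the six
  -- monomials split into two vanishing triples.
  solve-root₃ : ∀ {x₁ x₂ y₁ y₂ z₁ z₂} → x₁ + z₁ + y₂ ≈ 0# → x₂ + y₁ + z₂ ≈ 0# →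
    x₁ - x₂ ≈ (y₁ - y₂) + (- z₁ + z₂)
  solve-root₃ {x₁} {x₂} {y₁} {y₂} {z₁} {z₂} eq₁ eq₂ = trans (+-cong (solve-root₂ eq₁) (solve-root₁ eq₂))
    (solve 4 (λ a b c d → (:- b :+ :- c) :+ (a :+ d) := (a :- b) :+ (:- c :+ d)) refl y₁ y₂ z₁ z₂)

  -- With n = i + 1 and N = 2n + l, shift-u-v relates α̂ (i + l) to α̂ i for i ≡ u and l ≡ v (mod 3).
  -- Monomials cancel in pairs, or in triples 1 + ω + ω² with ω = q^(N/3).
  shift-0-1 : ∀ r s → let n = suc (r ℕ.* 3 ℕ.+ 0) in 2 ℕ.* n ℕ.+ (s ℕ.* 3 ℕ.+ 1) ≡ N →
    α̂ ((r ℕ.+ s) ℕ.* 3 ℕ.+ 1) ≈ q ^ n * α̂ (r ℕ.* 3 ℕ.+ 0) + q ^ (n ℕ.* n ℕ.+ n ℕ.+ ζ₁ n s)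
  shift-0-1 r s N≡ = shift (α̂-1 t) (trans (*-congˡ (α̂-0 r)) (*-mono n)) (solve-root₁ root)
    where
    n = suc (r ℕ.* 3 ℕ.+ 0)
    t = r ℕ.+ s
    S = 2 ℕ.* r ℕ.+ s ℕ.+ 1
    3S≡N : S ℕ.* 3 ≡ N
    3S≡N = ≡.trans (ExponentIdentities.third-0-1 r s) N≡
    root-ω : q ^ (n ℕ.+ a₀ r) ≈ q ^ (a₁ t ℕ.+ S)
    root-ω = q^-≡-mod N≡ (n ℕ.+ a₀ r) (a₁ t ℕ.+ S) s 0 (ExponentIdentities.mod-0-1-1 r s)
    root-ω² : q ^ (n ℕ.* n ℕ.+ n ℕ.+ ζ₁ n s) ≈ q ^ (a₁ t ℕ.+ S ℕ.+ S)
    root-ω² = q^-≡-mod N≡ (n ℕ.* n ℕ.+ n ℕ.+ ζ₁ n s) (a₁ t ℕ.+ S ℕ.+ S) s (4 ℕ.* r ℕ.+ 1) (ExponentIdentities.mod-0-1-2 r s)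
    root : q ^ (a₁ t) + q ^ (n ℕ.+ a₀ r) + q ^ (n ℕ.* n ℕ.+ n ℕ.+ ζ₁ n s) ≈ 0#
    root = cube-roots (a₁ t) (n ℕ.+ a₀ r) (n ℕ.* n ℕ.+ n ℕ.+ ζ₁ n s) S 3S≡N root-ω root-ω²

  shift-0-2 : ∀ r s → let n = suc (r ℕ.* 3 ℕ.+ 0) in 2 ℕ.* n ℕ.+ (s ℕ.* 3 ℕ.+ 2) ≡ N →
    α̂ ((r ℕ.+ s) ℕ.* 3 ℕ.+ 2) ≈ q ^ n * α̂ (r ℕ.* 3 ℕ.+ 0) + - q ^ (suc n ℕ.* suc n ℕ.+ ζ₀ (suc n) s)
  shift-0-2 r s N≡ = shift (α̂-2 t) (trans (*-congˡ (α̂-0 r)) (*-mono n)) (+-cong L₁≈A (-‿cong L₂≈X))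
    where
    n = suc (r ℕ.* 3 ℕ.+ 0)
    t = r ℕ.+ s
    L₁≈A : q ^ (a₂ t) ≈ q ^ (n ℕ.+ a₀ r)
    L₁≈A = q^-≡-mod N≡ (a₂ t) (n ℕ.+ a₀ r) 0 s (ExponentIdentities.mod-0-2-1 r s)
    L₂≈X : q ^ (a₃ t) ≈ q ^ (suc n ℕ.* suc n ℕ.+ ζ₀ (suc n) s)
    L₂≈X = q^-≡-mod N≡ (a₃ t) (suc n ℕ.* suc n ℕ.+ ζ₀ (suc n) s) (4 ℕ.* r ℕ.+ 3) s (ExponentIdentities.mod-0-2-2 r s)

  shift-0-3 : ∀ r s → let n = suc (r ℕ.* 3 ℕ.+ 0) in 2 ℕ.* n ℕ.+ (s ℕ.* 3 ℕ.+ 3) ≡ N →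
    α̂ ((suc (r ℕ.+ s)) ℕ.* 3 ℕ.+ 0) ≈ q ^ n * α̂ (r ℕ.* 3 ℕ.+ 0) + (- q ^ (n ℕ.* n ℕ.+ n ℕ.+ ζ₀ n (suc s)) + q ^ (suc n ℕ.* suc n ℕ.+ ζ₁ (suc n) s))
  shift-0-3 r s N≡ = shift (α̂-0 t) (trans (*-congˡ (α̂-0 r)) (*-mono n)) (trans (solve 2 (λ a b → b := a :+ (:- a :+ b)) refl _ _) (+-congˡ (+-cong (-‿cong A≈X₁) L≈X₂)))
    where
    n = suc (r ℕ.* 3 ℕ.+ 0)
    t = suc (r ℕ.+ s)
    L≈X₂ : q ^ (a₀ t) ≈ q ^ (suc n ℕ.* suc n ℕ.+ ζ₁ (suc n) s)
    L≈X₂ = q^-≡-mod N≡ (a₀ t) (suc n ℕ.* suc n ℕ.+ ζ₁ (suc n) s) (4 ℕ.* r ℕ.+ 2) s (ExponentIdentities.mod-0-3-1 r s)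
    A≈X₁ : q ^ (n ℕ.+ a₀ r) ≈ q ^ (n ℕ.* n ℕ.+ n ℕ.+ ζ₀ n (suc s))
    A≈X₁ = q^-≡-mod N≡ (n ℕ.+ a₀ r) (n ℕ.* n ℕ.+ n ℕ.+ ζ₀ n (suc s)) (4 ℕ.* r ℕ.+ 2) 0 (ExponentIdentities.mod-0-3-2 r s)

  shift-1-1 : ∀ r s → let n = suc (r ℕ.* 3 ℕ.+ 1) in 2 ℕ.* n ℕ.+ (s ℕ.* 3 ℕ.+ 1) ≡ N →
    α̂ ((r ℕ.+ s) ℕ.* 3 ℕ.+ 2) ≈ q ^ n * α̂ (r ℕ.* 3 ℕ.+ 1) + q ^ (n ℕ.* n ℕ.+ n ℕ.+ ζ₁ n s)
  shift-1-1 r s N≡ = shift (α̂-2 t) (trans (*-congˡ (α̂-1 r)) (*-neg n)) (trans (+-comm _ _) (+-cong (-‿cong L₂≈A) L₁≈X))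
    where
    n = suc (r ℕ.* 3 ℕ.+ 1)
    t = r ℕ.+ s
    L₁≈X : q ^ (a₂ t) ≈ q ^ (n ℕ.* n ℕ.+ n ℕ.+ ζ₁ n s)
    L₁≈X = q^-≡-mod N≡ (a₂ t) (n ℕ.* n ℕ.+ n ℕ.+ ζ₁ n s) (4 ℕ.* r ℕ.+ 3) s (ExponentIdentities.mod-1-1-1 r s)
    L₂≈A : q ^ (a₃ t) ≈ q ^ (n ℕ.+ a₁ r)
    L₂≈A = q^-≡-mod N≡ (a₃ t) (n ℕ.+ a₁ r) 0 s (ExponentIdentities.mod-1-1-2 r s)

  shift-1-2 : ∀ r s → let n = suc (r ℕ.* 3 ℕ.+ 1) in 2 ℕ.* n ℕ.+ (s ℕ.* 3 ℕ.+ 2) ≡ N →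
    α̂ ((suc (r ℕ.+ s)) ℕ.* 3 ℕ.+ 0) ≈ q ^ n * α̂ (r ℕ.* 3 ℕ.+ 1) + - q ^ (suc n ℕ.* suc n ℕ.+ ζ₀ (suc n) s)
  shift-1-2 r s N≡ = shift (α̂-0 t) (trans (*-congˡ (α̂-1 r)) (*-neg n)) (solve-root₂ root)
    where
    n = suc (r ℕ.* 3 ℕ.+ 1)
    t = suc (r ℕ.+ s)
    S = 2 ℕ.* r ℕ.+ s ℕ.+ 2
    3S≡N : S ℕ.* 3 ≡ N
    3S≡N = ≡.trans (ExponentIdentities.third-1-2 r s) N≡
    root-ω : q ^ (suc n ℕ.* suc n ℕ.+ ζ₀ (suc n) s) ≈ q ^ (a₀ t ℕ.+ S)
    root-ω = q^-≡-mod N≡ (suc n ℕ.* suc n ℕ.+ ζ₀ (suc n) s) (a₀ t ℕ.+ S) s (4 ℕ.* r ℕ.+ 4) (ExponentIdentities.mod-1-2-1 r s)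
    root-ω² : q ^ (n ℕ.+ a₁ r) ≈ q ^ (a₀ t ℕ.+ S ℕ.+ S)
    root-ω² = q^-≡-mod N≡ (n ℕ.+ a₁ r) (a₀ t ℕ.+ S ℕ.+ S) (s ℕ.+ 1) 0 (ExponentIdentities.mod-1-2-2 r s)
    root : q ^ (a₀ t) + q ^ (suc n ℕ.* suc n ℕ.+ ζ₀ (suc n) s) + q ^ (n ℕ.+ a₁ r) ≈ 0#
    root = cube-roots (a₀ t) (suc n ℕ.* suc n ℕ.+ ζ₀ (suc n) s) (n ℕ.+ a₁ r) S 3S≡N root-ω root-ω²

  shift-1-3 : ∀ r s → let n = suc (r ℕ.* 3 ℕ.+ 1) in 2 ℕ.* n ℕ.+ (s ℕ.* 3 ℕ.+ 3) ≡ N →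
    α̂ ((suc (r ℕ.+ s)) ℕ.* 3 ℕ.+ 1) ≈ q ^ n * α̂ (r ℕ.* 3 ℕ.+ 1) + (- q ^ (n ℕ.* n ℕ.+ n ℕ.+ ζ₀ n (suc s)) + q ^ (suc n ℕ.* suc n ℕ.+ ζ₁ (suc n) s))
  shift-1-3 r s N≡ = shift (α̂-1 t) (trans (*-congˡ (α̂-1 r)) (*-neg n)) (trans (solve 2 (λ a b → :- b := :- a :+ (:- b :+ a)) refl _ _) (+-congˡ (+-cong (-‿cong L≈X₁) A≈X₂)))
    where
    n = suc (r ℕ.* 3 ℕ.+ 1)
    t = suc (r ℕ.+ s)
    L≈X₁ : q ^ (a₁ t) ≈ q ^ (n ℕ.* n ℕ.+ n ℕ.+ ζ₀ n (suc s))
    L≈X₁ = q^-≡-mod N≡ (a₁ t) (n ℕ.* n ℕ.+ n ℕ.+ ζ₀ n (suc s)) (4 ℕ.* r ℕ.+ 3) s (ExponentIdentities.mod-1-3-1 r s)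
    A≈X₂ : q ^ (n ℕ.+ a₁ r) ≈ q ^ (suc n ℕ.* suc n ℕ.+ ζ₁ (suc n) s)
    A≈X₂ = q^-≡-mod N≡ (n ℕ.+ a₁ r) (suc n ℕ.* suc n ℕ.+ ζ₁ (suc n) s) (4 ℕ.* r ℕ.+ 4) 0 (ExponentIdentities.mod-1-3-2 r s)

  shift-2-1 : ∀ r s → let n = suc (r ℕ.* 3 ℕ.+ 2) in 2 ℕ.* n ℕ.+ (s ℕ.* 3 ℕ.+ 1) ≡ N →
    α̂ ((suc (r ℕ.+ s)) ℕ.* 3 ℕ.+ 0) ≈ q ^ n * α̂ (r ℕ.* 3 ℕ.+ 2) + q ^ (n ℕ.* n ℕ.+ n ℕ.+ ζ₁ n s)
  shift-2-1 r s N≡ = shift (α̂-0 t) (trans (*-congˡ (α̂-2 r)) (*-diff n)) (trans (solve 2 (λ a b → a := a :- b :+ b) refl _ _) (+-cong (+-congʳ L≈A₁) A₂≈X))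
    where
    n = suc (r ℕ.* 3 ℕ.+ 2)
    t = suc (r ℕ.+ s)
    L≈A₁ : q ^ (a₀ t) ≈ q ^ (n ℕ.+ a₂ r)
    L≈A₁ = q^-≡-mod N≡ (a₀ t) (n ℕ.+ a₂ r) 0 s (ExponentIdentities.mod-2-1-1 r s)
    A₂≈X : q ^ (n ℕ.+ a₃ r) ≈ q ^ (n ℕ.* n ℕ.+ n ℕ.+ ζ₁ n s)
    A₂≈X = q^-≡-mod N≡ (n ℕ.+ a₃ r) (n ℕ.* n ℕ.+ n ℕ.+ ζ₁ n s) (4 ℕ.* r ℕ.+ 4) 0 (ExponentIdentities.mod-2-1-2 r s)

  shift-2-2 : ∀ r s → let n = suc (r ℕ.* 3 ℕ.+ 2) in 2 ℕ.* n ℕ.+ (s ℕ.* 3 ℕ.+ 2) ≡ N →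
    α̂ ((suc (r ℕ.+ s)) ℕ.* 3 ℕ.+ 1) ≈ q ^ n * α̂ (r ℕ.* 3 ℕ.+ 2) + - q ^ (suc n ℕ.* suc n ℕ.+ ζ₀ (suc n) s)
  shift-2-2 r s N≡ = shift (α̂-1 t) (trans (*-congˡ (α̂-2 r)) (*-diff n)) (trans (solve 2 (λ a b → :- b := a :- b :- a) refl _ _) (+-cong (+-congˡ (-‿cong L≈A₂)) (-‿cong A₁≈X)))
    where
    n = suc (r ℕ.* 3 ℕ.+ 2)
    t = suc (r ℕ.+ s)
    L≈A₂ : q ^ (a₁ t) ≈ q ^ (n ℕ.+ a₃ r)
    L≈A₂ = q^-≡-mod N≡ (a₁ t) (n ℕ.+ a₃ r) 0 s (ExponentIdentities.mod-2-2-1 r s)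
    A₁≈X : q ^ (n ℕ.+ a₂ r) ≈ q ^ (suc n ℕ.* suc n ℕ.+ ζ₀ (suc n) s)
    A₁≈X = q^-≡-mod N≡ (n ℕ.+ a₂ r) (suc n ℕ.* suc n ℕ.+ ζ₀ (suc n) s) (4 ℕ.* r ℕ.+ 6) 0 (ExponentIdentities.mod-2-2-2 r s)

  shift-2-3 : ∀ r s → let n = suc (r ℕ.* 3 ℕ.+ 2) in 2 ℕ.* n ℕ.+ (s ℕ.* 3 ℕ.+ 3) ≡ N →
    α̂ ((suc (r ℕ.+ s)) ℕ.* 3 ℕ.+ 2) ≈ q ^ n * α̂ (r ℕ.* 3 ℕ.+ 2) + (- q ^ (n ℕ.* n ℕ.+ n ℕ.+ ζ₀ n (suc s)) + q ^ (suc n ℕ.* suc n ℕ.+ ζ₁ (suc n) s))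
  shift-2-3 r s N≡ = shift (α̂-2 t) (trans (*-congˡ (α̂-2 r)) (*-diff n)) (solve-root₃ root₁ root₂)
    where
    n = suc (r ℕ.* 3 ℕ.+ 2)
    t = suc (r ℕ.+ s)
    S = 2 ℕ.* r ℕ.+ s ℕ.+ 3
    3S≡N : S ℕ.* 3 ≡ N
    3S≡N = ≡.trans (ExponentIdentities.third-2-3 r s) N≡
    root₁-ω : q ^ (n ℕ.* n ℕ.+ n ℕ.+ ζ₀ n (suc s)) ≈ q ^ (a₂ t ℕ.+ S)
    root₁-ω = q^-≡-mod N≡ (n ℕ.* n ℕ.+ n ℕ.+ ζ₀ n (suc s)) (a₂ t ℕ.+ S) s (4 ℕ.* r ℕ.+ 4) (ExponentIdentities.mod-2-3-1 r s)
    root₁-ω² : q ^ (n ℕ.+ a₃ r) ≈ q ^ (a₂ t ℕ.+ S ℕ.+ S)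
    root₁-ω² = q^-≡-mod N≡ (n ℕ.+ a₃ r) (a₂ t ℕ.+ S ℕ.+ S) (s ℕ.+ 1) 0 (ExponentIdentities.mod-2-3-2 r s)
    root₁ : q ^ (a₂ t) + q ^ (n ℕ.* n ℕ.+ n ℕ.+ ζ₀ n (suc s)) + q ^ (n ℕ.+ a₃ r) ≈ 0#
    root₁ = cube-roots (a₂ t) (n ℕ.* n ℕ.+ n ℕ.+ ζ₀ n (suc s)) (n ℕ.+ a₃ r) S 3S≡N root₁-ω root₁-ω²
    root₂-ω : q ^ (n ℕ.+ a₂ r) ≈ q ^ (a₃ t ℕ.+ S)
    root₂-ω = q^-≡-mod N≡ (n ℕ.+ a₂ r) (a₃ t ℕ.+ S) (s ℕ.+ 1) 0 (ExponentIdentities.mod-2-3-3 r s)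
    root₂-ω² : q ^ (suc n ℕ.* suc n ℕ.+ ζ₁ (suc n) s) ≈ q ^ (a₃ t ℕ.+ S ℕ.+ S)
    root₂-ω² = q^-≡-mod N≡ (suc n ℕ.* suc n ℕ.+ ζ₁ (suc n) s) (a₃ t ℕ.+ S ℕ.+ S) s (4 ℕ.* r ℕ.+ 4) (ExponentIdentities.mod-2-3-4 r s)
    root₂ : q ^ (a₃ t) + q ^ (n ℕ.+ a₂ r) + q ^ (suc n ℕ.* suc n ℕ.+ ζ₁ (suc n) s) ≈ 0#
    root₂ = cube-roots (a₃ t) (n ℕ.+ a₂ r) (suc n ℕ.* suc n ℕ.+ ζ₁ (suc n) s) S 3S≡N root₂-ω root₂-ω²

-- Folding the right-hand side under n -> N - n.

module Folding {c ℓ : Level} (R : CommutativeRing c ℓ) (domain : IsIntegralDomain R)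
  (N : ℕ) (1≤N : 1 ≤ N) (q : CommutativeRing.Carrier R) (primitive-root : PrimitiveRoot R N q)
  (qi : CommutativeRing.Carrier R)
  (q·qi≈1 : CommutativeRing._≈_ R (CommutativeRing._*_ R q qi) (CommutativeRing.1# R)) where
  open CommutativeRing R hiding (zero)
  open FiniteSums R
  open IntegralDomain R domain
  open RootOfUnity R domain N 1≤N q primitive-root qi q·qi≈1
  open ClosedForms R domain N 1≤N q primitive-root qi q·qi≈1
  open GaussianBinomials R q using (G-sym)
  private module Q = GaussianBinomials R qi
  open EkhadZeilberger R qi using (ez; ez₀; ez-3s+2)
  open BaileyChain R q using (weight)
  open ExponentIdentities using (a₀; a₁; a₂; a₃; ζ₀; ζ₁)
  open import Relation.Binary.Reasoning.Setoid setoid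

  -- This is ez (l-2). The value 0 at l = 1 continues `ez-recurrence` backwards from ez 2 = 0; the
  -- value 0 at l = 0 is a convention for the self-paired term n = N/2.
  ez⁻ : ℕ → Carrier
  ez⁻ zero          = 0#
  ez⁻ (suc zero)    = 0#
  ez⁻ (suc (suc l)) = ez l

  ez⁻-≡ : ∀ {l l′} → l ≡ suc (suc l′) → ez⁻ l ≈ ez l′
  ez⁻-≡ eq = reflexive (≡.cong ez⁻ eq)

  ez⁻-3s+1 : ∀ s → ez⁻ (s ℕ.* 3 ℕ.+ 1) ≈ 0#
  ez⁻-3s+1 zero    = refl
  ez⁻-3s+1 (suc s) = trans (reflexive (≡.cong ez (≡.sym (ℕₚ.+-suc (s ℕ.* 3) 1)))) (ez-3s+2 s)

  correction : ℕ → ℕ → Carrier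
  correction n l = q ^ (n ℕ.* n ℕ.+ n) * ez l + q ^ (suc n ℕ.* suc n) * ez⁻ l

  -- Since ez vanishes at indices 3s + 2, only the first term of `correction` survives for l ≡ 1 and
  -- only the second for l ≡ 2, while both remain for l ≡ 0. The second is evaluated at n + 1,
  -- because N = 2(n+1) + (l-2).
  correction-3s+1 : ∀ n s → 2 ℕ.* n ℕ.+ (s ℕ.* 3 ℕ.+ 1) ≡ N →
    correction n (s ℕ.* 3 ℕ.+ 1) ≈ q ^ (n ℕ.* n ℕ.+ n ℕ.+ ζ₁ n s)
  correction-3s+1 n s N≡ = trans (+-cong
    (trans (*-congˡ (ez-3s+1 n s N≡)) (*-mono (n ℕ.* n ℕ.+ n))) (trans (*-congˡ (ez⁻-3s+1 s)) (zeroʳ _)))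
    (+-identityʳ _)

  correction-3s+2 : ∀ n s → 2 ℕ.* n ℕ.+ (s ℕ.* 3 ℕ.+ 2) ≡ N →
    correction n (s ℕ.* 3 ℕ.+ 2) ≈ - q ^ (suc n ℕ.* suc n ℕ.+ ζ₀ (suc n) s)
  correction-3s+2 n s N≡ = trans (+-cong
    (trans (*-congˡ (ez-3s+2 s)) (zeroʳ _))
    (trans (*-congˡ (trans (ez⁻-≡ (next s)) (ez-3s (suc n) s (≡.trans (level n s) N≡)))) (*-neg (suc n ℕ.* suc n))))
    (+-identityˡ _)
    where
    next : ∀ s → s ℕ.* 3 ℕ.+ 2 ≡ suc (suc (s ℕ.* 3 ℕ.+ 0))
    next = solve-∀
    level : ∀ n s → 2 ℕ.* suc n ℕ.+ (s ℕ.* 3 ℕ.+ 0) ≡ 2 ℕ.* n ℕ.+ (s ℕ.* 3 ℕ.+ 2)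
    level = solve-∀

  correction-3s+3 : ∀ n s → 2 ℕ.* n ℕ.+ (s ℕ.* 3 ℕ.+ 3) ≡ N →
    correction n (s ℕ.* 3 ℕ.+ 3)
      ≈ - q ^ (n ℕ.* n ℕ.+ n ℕ.+ ζ₀ n (suc s)) + q ^ (suc n ℕ.* suc n ℕ.+ ζ₁ (suc n) s)
  correction-3s+3 n s N≡ = +-cong
    (trans (*-congˡ (trans (reflexive (≡.cong ez (wrap s)))
                           (ez-3s n (suc s) (≡.trans (≡.cong (2 ℕ.* n ℕ.+_) (≡.sym (wrap s))) N≡))))
           (*-neg (n ℕ.* n ℕ.+ n)))
    (trans (*-congˡ (trans (ez⁻-≡ (next s)) (ez-3s+1 (suc n) s (≡.trans (level n s) N≡)))) (*-mono (suc n ℕ.* suc n)))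
    where
    wrap : ∀ s → s ℕ.* 3 ℕ.+ 3 ≡ suc s ℕ.* 3 ℕ.+ 0
    wrap = solve-∀
    next : ∀ s → s ℕ.* 3 ℕ.+ 3 ≡ suc (suc (s ℕ.* 3 ℕ.+ 1))
    next = solve-∀
    level : ∀ n s → 2 ℕ.* suc n ℕ.+ (s ℕ.* 3 ℕ.+ 1) ≡ 2 ℕ.* n ℕ.+ (s ℕ.* 3 ℕ.+ 3)
    level = solve-∀

  α̂-fold : ∀ i l → Mod₃⁺ l → 2 ℕ.* suc i ℕ.+ l ≡ N →
    α̂ (i ℕ.+ l) ≈ q ^ suc i * α̂ i + correction (suc i) l
  α̂-fold i l (s , residue) N≡ = by-cases (mod₃ i) residue
    where
    index : ∀ r s u v → (r ℕ.* 3 ℕ.+ u) ℕ.+ (s ℕ.* 3 ℕ.+ v) ≡ (r ℕ.+ s) ℕ.* 3 ℕ.+ (u ℕ.+ v)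
    index = solve-∀
    carry : ∀ r s u v t → u ℕ.+ v ≡ 3 ℕ.+ t → (r ℕ.* 3 ℕ.+ u) ℕ.+ (s ℕ.* 3 ℕ.+ v) ≡ suc (r ℕ.+ s) ℕ.* 3 ℕ.+ t
    carry r s u v t eq = ≡.trans (index r s u v) (≡.trans (≡.cong ((r ℕ.+ s) ℕ.* 3 ℕ.+_) eq) (move (r ℕ.+ s) t))
      where
      move : ∀ x t → x ℕ.* 3 ℕ.+ (3 ℕ.+ t) ≡ suc x ℕ.* 3 ℕ.+ t
      move = solve-∀
    combine : ∀ {k k′ x y z} → k ≡ k′ → α̂ k′ ≈ x + y → z ≈ y → α̂ k ≈ x + z
    combine eq shifted z≈ = trans (reflexive (≡.cong α̂ eq)) (trans shifted (+-congˡ (sym z≈)))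
    by-cases : ∃[ r ] (i ≡ r ℕ.* 3 ℕ.+ 0 ⊎ i ≡ r ℕ.* 3 ℕ.+ 1 ⊎ i ≡ r ℕ.* 3 ℕ.+ 2) →
      l ≡ s ℕ.* 3 ℕ.+ 1 ⊎ l ≡ s ℕ.* 3 ℕ.+ 2 ⊎ l ≡ s ℕ.* 3 ℕ.+ 3 →
      α̂ (i ℕ.+ l) ≈ q ^ suc i * α̂ i + correction (suc i) l
    by-cases (r , inj₁ ≡.refl) (inj₁ ≡.refl) =
      combine (index r s 0 1) (shift-0-1 r s N≡) (correction-3s+1 (suc i) s N≡)
    by-cases (r , inj₁ ≡.refl) (inj₂ (inj₁ ≡.refl)) =
      combine (index r s 0 2) (shift-0-2 r s N≡) (correction-3s+2 (suc i) s N≡)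
    by-cases (r , inj₁ ≡.refl) (inj₂ (inj₂ ≡.refl)) =
      combine (carry r s 0 3 0 ≡.refl) (shift-0-3 r s N≡) (correction-3s+3 (suc i) s N≡)
    by-cases (r , inj₂ (inj₁ ≡.refl)) (inj₁ ≡.refl) =
      combine (index r s 1 1) (shift-1-1 r s N≡) (correction-3s+1 (suc i) s N≡)
    by-cases (r , inj₂ (inj₁ ≡.refl)) (inj₂ (inj₁ ≡.refl)) =
      combine (carry r s 1 2 0 ≡.refl) (shift-1-2 r s N≡) (correction-3s+2 (suc i) s N≡)
    by-cases (r , inj₂ (inj₁ ≡.refl)) (inj₂ (inj₂ ≡.refl)) =
      combine (carry r s 1 3 1 ≡.refl) (shift-1-3 r s N≡) (correction-3s+3 (suc i) s N≡)
    by-cases (r , inj₂ (inj₂ ≡.refl)) (inj₁ ≡.refl) =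
      combine (carry r s 2 1 0 ≡.refl) (shift-2-1 r s N≡) (correction-3s+1 (suc i) s N≡)
    by-cases (r , inj₂ (inj₂ ≡.refl)) (inj₂ (inj₁ ≡.refl)) =
      combine (carry r s 2 2 1 ≡.refl) (shift-2-2 r s N≡) (correction-3s+2 (suc i) s N≡)
    by-cases (r , inj₂ (inj₂ ≡.refl)) (inj₂ (inj₂ ≡.refl)) =
      combine (carry r s 2 3 2 ≡.refl) (shift-2-3 r s N≡) (correction-3s+3 (suc i) s N≡)

  -- The value at the self-paired index n = N. The quantity q ez (N-2) is 0, -1 or q^(N/3) for N ≡
  -- 1, 2, 0 (mod 3), and in the last case the relation between the cube roots of unity closes the
  -- identity.
  α̂-last : ∀ m → suc m ≡ N → α̂ m ≈ 1# + (q ^ 1 * ez⁻ N + q ^ 1 * ez⁻ N)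
  α̂-last m 1+m≡N = by-cases (mod₃ m)
    where
    by-cases : ∃[ r ] (m ≡ r ℕ.* 3 ℕ.+ 0 ⊎ m ≡ r ℕ.* 3 ℕ.+ 1 ⊎ m ≡ r ℕ.* 3 ℕ.+ 2) →
      α̂ m ≈ 1# + (q ^ 1 * ez⁻ N + q ^ 1 * ez⁻ N)
    by-cases (s , inj₁ ≡.refl) = begin
      α̂ (s ℕ.* 3 ℕ.+ 0)   ≈⟨ α̂-0 s ⟩
      q ^ a₀ s            ≈⟨ q^-≡-mod 1+m≡N (a₀ s) 0 0 s (multiple-of-N s) ⟩
      1#                  ≈⟨ solve 1 (λ x → con (+ 1) := con (+ 1) :+ (x :* con (+ 0) :+ x :* con (+ 0))) refl (q ^ 1) ⟩
      1# + (q ^ 1 * 0# + q ^ 1 * 0#)  ≈⟨ +-congˡ (+-cong (*-congˡ ez⁻N) (*-congˡ ez⁻N)) ⟨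
      1# + (q ^ 1 * ez⁻ N + q ^ 1 * ez⁻ N) ∎
      where
      multiple-of-N : ∀ s → 3 ℕ.* s ℕ.* s ℕ.+ s ℕ.+ 0 ℕ.* suc (s ℕ.* 3 ℕ.+ 0) ≡ 0 ℕ.+ s ℕ.* suc (s ℕ.* 3 ℕ.+ 0)
      multiple-of-N = solve-∀
      N≡ : N ≡ s ℕ.* 3 ℕ.+ 1
      N≡ = ≡.trans (≡.sym 1+m≡N) (≡.sym (ℕₚ.+-suc (s ℕ.* 3) 0))
      ez⁻N : ez⁻ N ≈ 0#
      ez⁻N = trans (reflexive (≡.cong ez⁻ N≡)) (ez⁻-3s+1 s)
    by-cases (s , inj₂ (inj₁ ≡.refl)) = begin
      α̂ (s ℕ.* 3 ℕ.+ 1)   ≈⟨ α̂-1 s ⟩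
      - q ^ a₁ s          ≈⟨ -‿cong (q^-≡-mod 1+m≡N (a₁ s) 0 0 s (multiple-of-N s)) ⟩
      - 1#                ≈⟨ solve 0 (:- con (+ 1) := con (+ 1) :+ ((:- con (+ 1)) :+ (:- con (+ 1)))) refl ⟩
      1# + (- 1# + - 1#)  ≈⟨ +-congˡ (+-cong qez⁻N qez⁻N) ⟨
      1# + (q ^ 1 * ez⁻ N + q ^ 1 * ez⁻ N) ∎
      where
      multiple-of-N : ∀ s → 3 ℕ.* s ℕ.* s ℕ.+ 2 ℕ.* s ℕ.+ 0 ℕ.* suc (s ℕ.* 3 ℕ.+ 1) ≡ 0 ℕ.+ s ℕ.* suc (s ℕ.* 3 ℕ.+ 1)
      multiple-of-N = solve-∀
      twice-N : ∀ s → 1 ℕ.+ (4 ℕ.* 1 ℕ.* s ℕ.+ 2 ℕ.* s ℕ.+ 2 ℕ.* 1 ℕ.* 1 ℕ.+ 1) ℕ.+ 0 ℕ.* suc (s ℕ.* 3 ℕ.+ 1) ≡ 0 ℕ.+ 2 ℕ.* suc (s ℕ.* 3 ℕ.+ 1)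
      twice-N = solve-∀
      next : ∀ s → suc (s ℕ.* 3 ℕ.+ 1) ≡ suc (suc (s ℕ.* 3 ℕ.+ 0))
      next = solve-∀
      qez⁻N : q ^ 1 * ez⁻ N ≈ - 1#
      qez⁻N = begin
        q ^ 1 * ez⁻ N                   ≈⟨ *-congˡ (ez⁻-≡ (≡.trans (≡.sym 1+m≡N) (next s))) ⟩
        q ^ 1 * ez (s ℕ.* 3 ℕ.+ 0)      ≈⟨ *-congˡ (ez-3s 1 s (≡.trans (≡.sym (next s)) 1+m≡N)) ⟩
        q ^ 1 * - q ^ ζ₀ 1 s            ≈⟨ *-neg 1 {ζ₀ 1 s} ⟩
        - q ^ (1 ℕ.+ ζ₀ 1 s)            ≈⟨ -‿cong (q^-≡-mod 1+m≡N (1 ℕ.+ ζ₀ 1 s) 0 0 2 (twice-N s)) ⟩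
        - 1#                            ∎
    by-cases (s , inj₂ (inj₂ ≡.refl)) = begin
      α̂ (s ℕ.* 3 ℕ.+ 2)     ≈⟨ α̂-2 s ⟩
      q ^ a₂ s - q ^ a₃ s   ≈⟨ solve-root₄ (cube-roots 0 (a₂ s) (a₃ s) (suc s) (≡.trans (third s) 1+m≡N)
                                 (q^-≡-mod 1+m≡N (a₂ s) (suc s) 0 s (ω-exponent s))
                                 (q^-≡-mod 1+m≡N (a₃ s) (suc s ℕ.+ suc s) 0 s (ω²-exponent s))) ⟩
      1# + (q ^ a₂ s + q ^ a₂ s) ≈⟨ +-congˡ (+-cong qez⁻N qez⁻N) ⟨
      1# + (q ^ 1 * ez⁻ N + q ^ 1 * ez⁻ N) ∎
      where
      third : ∀ s → suc s ℕ.* 3 ≡ suc (s ℕ.* 3 ℕ.+ 2)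
      third = solve-∀
      ω-exponent : ∀ s → 3 ℕ.* s ℕ.* s ℕ.+ 4 ℕ.* s ℕ.+ 1 ℕ.+ 0 ℕ.* suc (s ℕ.* 3 ℕ.+ 2) ≡ suc s ℕ.+ s ℕ.* suc (s ℕ.* 3 ℕ.+ 2)
      ω-exponent = solve-∀
      ω²-exponent : ∀ s → 3 ℕ.* s ℕ.* s ℕ.+ 5 ℕ.* s ℕ.+ 2 ℕ.+ 0 ℕ.* suc (s ℕ.* 3 ℕ.+ 2) ≡ suc s ℕ.+ suc s ℕ.+ s ℕ.* suc (s ℕ.* 3 ℕ.+ 2)
      ω²-exponent = solve-∀
      solve-root₄ : ∀ {y z} → 1# + y + z ≈ 0# → y - z ≈ 1# + (y + y)
      solve-root₄ {y} {z} eq = begin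
        y - z                               ≈⟨ +-identityʳ _ ⟨
        y - z + 0#                          ≈⟨ +-congˡ eq ⟨
        y - z + (1# + y + z)                ≈⟨ solve 2 (λ y z → y :- z :+ (con (+ 1) :+ y :+ z) := con (+ 1) :+ (y :+ y)) refl y z ⟩
        1# + (y + y)                        ∎
      next : ∀ s → suc (s ℕ.* 3 ℕ.+ 2) ≡ suc (suc (s ℕ.* 3 ℕ.+ 1))
      next = solve-∀
      q-exponent : ∀ s → 1 ℕ.+ (4 ℕ.* 1 ℕ.* s ℕ.+ 2 ℕ.* 1 ℕ.* 1 ℕ.+ 1) ℕ.+ s ℕ.* suc (s ℕ.* 3 ℕ.+ 2)
        ≡ 3 ℕ.* s ℕ.* s ℕ.+ 4 ℕ.* s ℕ.+ 1 ℕ.+ 1 ℕ.* suc (s ℕ.* 3 ℕ.+ 2)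
      q-exponent = solve-∀
      qez⁻N : q ^ 1 * ez⁻ N ≈ q ^ a₂ s
      qez⁻N = begin
        q ^ 1 * ez⁻ N                   ≈⟨ *-congˡ (ez⁻-≡ (≡.trans (≡.sym 1+m≡N) (next s))) ⟩
        q ^ 1 * ez (s ℕ.* 3 ℕ.+ 1)      ≈⟨ *-congˡ (ez-3s+1 1 s (≡.trans (≡.sym (next s)) 1+m≡N)) ⟩
        q ^ 1 * q ^ ζ₁ 1 s              ≈⟨ *-mono 1 {ζ₁ 1 s} ⟩
        q ^ (1 ℕ.+ ζ₁ 1 s)              ≈⟨ q^-≡-mod 1+m≡N (1 ℕ.+ ζ₁ 1 s) (a₂ s) s 1 (q-exponent s) ⟩
        q ^ a₂ s                        ∎

  q^half : ∀ i → 2 ℕ.* suc i ≡ N → q ^ suc i ≈ - 1#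
  q^half i 2n≡N with proj₂ domain (q ^ suc i - 1#) (q ^ suc i + 1#) (begin
    (q ^ suc i - 1#) * (q ^ suc i + 1#)
      ≈⟨ solve 1 (λ x → (x :- con (+ 1)) :* (x :+ con (+ 1)) := x :* (x :* con (+ 1)) :- con (+ 1)) refl (q ^ suc i) ⟩
    (q ^ suc i) ^ 2 - 1#  ≈⟨ +-congʳ (trans (sym (^-* q 2 (suc i))) (trans (^-≡ q 2n≡N) q^N)) ⟩
    1# - 1#               ≈⟨ -‿inverseʳ 1# ⟩
    0#                    ∎)
  ... | inj₁ eq = ⊥-elim (q^≉1 (suc i) z<s (≡.subst (suc i <_) 2n≡N (ℕₚ.m<m+n (suc i) z<s)) (difference-zero eq))
  ... | inj₂ eq = difference-zero (trans (+-congˡ (solve 0 (:- (:- con (+ 1)) := con (+ 1)) refl)) eq)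

  -- For even N the index n = N/2 is its own partner, so `α̂-fold` gives way to a direct evaluation
  -- with q^(N/2) = -1.
  α̂-middle : ∀ i → 2 ℕ.* suc i ≡ N → α̂ i ≈ - q ^ (suc i ℕ.* suc i)
  α̂-middle i 2n≡N = by-cases (mod₃ i)
    where
    negate : ∀ x → q ^ (x ℕ.+ suc i) ≈ - q ^ x
    negate x = trans (^-+ q x (suc i)) (trans (*-congˡ (q^half i 2n≡N))
      (solve 1 (λ x → x :* (:- con (+ 1)) := :- x) refl (q ^ x)))
    by-cases : ∃[ r ] (i ≡ r ℕ.* 3 ℕ.+ 0 ⊎ i ≡ r ℕ.* 3 ℕ.+ 1 ⊎ i ≡ r ℕ.* 3 ℕ.+ 2) → α̂ i ≈ - q ^ (suc i ℕ.* suc i)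
    by-cases (r , inj₁ ≡.refl) = trans (α̂-0 r) (trans
      (q^-≡-mod 2n≡N (a₀ r) (suc i ℕ.* suc i ℕ.+ suc i) (suc r) 0 (exponent r)) (negate (suc i ℕ.* suc i)))
      where
      exponent : ∀ r → let n = suc (r ℕ.* 3 ℕ.+ 0) in
        3 ℕ.* r ℕ.* r ℕ.+ r ℕ.+ suc r ℕ.* (2 ℕ.* n) ≡ n ℕ.* n ℕ.+ n ℕ.+ 0 ℕ.* (2 ℕ.* n)
      exponent = solve-∀
    by-cases (r , inj₂ (inj₁ ≡.refl)) = trans (α̂-1 r) (-‿cong
      (q^-≡-mod 2n≡N (a₁ r) (suc i ℕ.* suc i) (suc r) 0 (exponent r)))
      where
      exponent : ∀ r → let n = suc (r ℕ.* 3 ℕ.+ 1) in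
        3 ℕ.* r ℕ.* r ℕ.+ 2 ℕ.* r ℕ.+ suc r ℕ.* (2 ℕ.* n) ≡ n ℕ.* n ℕ.+ 0 ℕ.* (2 ℕ.* n)
      exponent = solve-∀
    -- The minus sign of `q ^ a₃ r` is absorbed as q^(N/2); the three exponents then differ by N/3
    -- modulo N.
    by-cases (r , inj₂ (inj₂ ≡.refl)) = trans (α̂-2 r) (trans (+-congˡ (sym (negate (a₃ r))))
      (trans (solve 2 (λ x z → x :+ z := z :+ x) refl _ _) (sym (solve-sum
        (cube-roots (a₂ r) (suc i ℕ.* suc i) (a₃ r ℕ.+ suc i) (2 ℕ.* suc r) (≡.trans (third r) 2n≡N)
          (q^-≡-mod 2n≡N (suc i ℕ.* suc i) (a₂ r ℕ.+ 2 ℕ.* suc r) 0 (suc r) (ω-exponent r))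
          (q^-≡-mod 2n≡N (a₃ r ℕ.+ suc i) (a₂ r ℕ.+ 2 ℕ.* suc r ℕ.+ 2 ℕ.* suc r) 0 0 (ω²-exponent r)))))))
      where
      solve-sum : ∀ {x y z} → x + y + z ≈ 0# → - y ≈ z + x
      solve-sum {x} {y} {z} eq = solve-root₁ (trans (solve 3 (λ x y z → y :+ z :+ x := x :+ y :+ z) refl x y z) eq)
      third : ∀ r → 2 ℕ.* suc r ℕ.* 3 ≡ 2 ℕ.* suc (r ℕ.* 3 ℕ.+ 2)
      third = solve-∀
      ω-exponent : ∀ r → let n = suc (r ℕ.* 3 ℕ.+ 2) in
        n ℕ.* n ℕ.+ 0 ℕ.* (2 ℕ.* n) ≡ (3 ℕ.* r ℕ.* r ℕ.+ 4 ℕ.* r ℕ.+ 1 ℕ.+ 2 ℕ.* suc r) ℕ.+ suc r ℕ.* (2 ℕ.* n)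
      ω-exponent = solve-∀
      ω²-exponent : ∀ r → let n = suc (r ℕ.* 3 ℕ.+ 2) in
        (3 ℕ.* r ℕ.* r ℕ.+ 5 ℕ.* r ℕ.+ 2 ℕ.+ n) ℕ.+ 0 ℕ.* (2 ℕ.* n)
          ≡ (3 ℕ.* r ℕ.* r ℕ.+ 4 ℕ.* r ℕ.+ 1 ℕ.+ 2 ℕ.* suc r ℕ.+ 2 ℕ.* suc r) ℕ.+ 0 ℕ.* (2 ℕ.* n)
      ω²-exponent = solve-∀

  -- The term k of the right-hand side is q^(p(k+1)²) γ k.
  γ : ℕ → Carrier
  γ k = Q.signed k * α̂ k

  jump⁻ : ℕ → ℕ → Carrier
  jump⁻ i l = (- 1#) ^ i * q ^ tri (suc i) * ez⁻ l

  -- By `reflection` at b = 0 both sides are Gaussian binomials of row N - 1, which are symmetric.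
  signed-reflect : ∀ a b → a ℕ.+ b ℕ.+ 1 ≡ N → Q.signed a ≈ Q.signed b
  signed-reflect a b eq = begin
    Q.signed a               ≈⟨ trans (*-congˡ (Q.G₀ a)) (*-identityʳ _) ⟨
    Q.signed a * Q.G a 0     ≈⟨ reflection 0 a b eq ⟨
    _                        ≈⟨ G-sym a b ⟩
    _                        ≈⟨ reflection 0 b a (≡.trans (≡.cong (ℕ._+ 1) (ℕₚ.+-comm b a)) eq) ⟩
    Q.signed b * Q.G b 0     ≈⟨ trans (*-congˡ (Q.G₀ b)) (*-identityʳ _) ⟩
    Q.signed b               ∎

  signed-cancel : ∀ n a b → a ≡ tri n ℕ.+ b → Q.signed n * q ^ a ≈ (- 1#) ^ n * q ^ b
  signed-cancel n a b ≡.refl = begin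
    (- 1#) ^ n * qi ^ tri n * q ^ (tri n ℕ.+ b)        ≈⟨ *-congˡ (^-+ q (tri n) b) ⟩
    (- 1#) ^ n * qi ^ tri n * (q ^ tri n * q ^ b)
      ≈⟨ solve 4 (λ s x y z → s :* x :* (y :* z) := s :* ((y :* x) :* z)) refl _ _ _ _ ⟩
    (- 1#) ^ n * (q ^ tri n * qi ^ tri n * q ^ b)
      ≈⟨ *-congˡ (trans (*-congʳ (invert (tri n))) (*-identityˡ _)) ⟩
    (- 1#) ^ n * q ^ b                                 ∎

  square≡tri+tri : ∀ n → suc n ℕ.* suc n ≡ tri n ℕ.+ tri (suc n)
  square≡tri+tri n = ≡.trans (expand n) (≡.trans (≡.cong (suc n ℕ.+_) (≡.sym (2*tri n))) (regroup n (tri n)))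
    where
    expand : ∀ n → suc n ℕ.* suc n ≡ suc n ℕ.+ n ℕ.* suc n
    expand = solve-∀
    regroup : ∀ n t → suc n ℕ.+ 2 ℕ.* t ≡ t ℕ.+ (suc n ℕ.+ t)
    regroup = solve-∀

  pronic≡tri+tri : ∀ n → n ℕ.* n ℕ.+ n ≡ tri n ℕ.+ tri n
  pronic≡tri+tri n = ≡.trans (expand n) (≡.trans (≡.sym (2*tri n)) (≡.cong (tri n ℕ.+_) (ℕₚ.+-identityʳ (tri n))))
    where
    expand : ∀ n → n ℕ.* n ℕ.+ n ≡ n ℕ.* suc n
    expand = solve-∀

  -- With n = i + 1, `signed-reflect` replaces the factor at i + l by the one at n. The leading term
  -- q^n α̂ i of `α̂-fold` then cancels `γ i`, because the factors at n and i differ by -q^(-n);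
  -- only `correction` remains.
  γ-pair : ∀ i l → Mod₃⁺ l → 2 ℕ.* suc i ℕ.+ l ≡ N → γ i + γ (i ℕ.+ l) ≈ jump⁻ (suc i) l - jump i l
  γ-pair i l residue N≡ = begin
    Q.signed i * α̂ i + Q.signed (i ℕ.+ l) * α̂ (i ℕ.+ l)
      ≈⟨ +-congˡ (*-cong (signed-reflect (i ℕ.+ l) n (≡.trans (total i l) N≡)) (α̂-fold i l residue N≡)) ⟩
    Q.signed i * α̂ i + Q.signed n * (q ^ n * α̂ i + correction n l)
      ≈⟨ solve 5 (λ s a t x c → s :* a :+ t :* (x :* a :+ c) := (s :+ t :* x) :* a :+ t :* c) refl _ (α̂ i) _ _ _ ⟩
    (Q.signed i + Q.signed n * q ^ n) * α̂ i + Q.signed n * correction n l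
      ≈⟨ +-cong (trans (*-congʳ opposite) (zeroˡ _))
                (solve 5 (λ t x y z w → t :* (x :* y :+ z :* w) := (t :* x) :* y :+ (t :* z) :* w) refl _ _ (ez l) _ (ez⁻ l)) ⟩
    0# + (Q.signed n * q ^ (n ℕ.* n ℕ.+ n) * ez l + Q.signed n * q ^ (suc n ℕ.* suc n) * ez⁻ l)
      ≈⟨ trans (+-identityˡ _) (+-cong (*-congʳ (signed-cancel n _ _ (pronic≡tri+tri n)))
                                       (*-congʳ (signed-cancel n _ _ (square≡tri+tri n)))) ⟩
    (- 1#) ^ n * q ^ tri n * ez l + jump⁻ n l
      ≈⟨ solve 4 (λ s t e j → (:- con (+ 1)) :* s :* t :* e :+ j := j :- s :* t :* e) refl ((- 1#) ^ i) _ _ _ ⟩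
    jump⁻ n l - jump i l ∎
    where
    n = suc i
    total : ∀ i l → i ℕ.+ l ℕ.+ suc i ℕ.+ 1 ≡ 2 ℕ.* suc i ℕ.+ l
    total = solve-∀
    opposite : Q.signed i + Q.signed n * q ^ n ≈ 0#
    opposite = begin
      s * qi ^ tri i + (- 1#) * s * qi ^ (n ℕ.+ tri i) * q ^ n
        ≈⟨ +-congˡ (*-congʳ (*-congˡ (^-+ qi n (tri i)))) ⟩
      s * qi ^ tri i + (- 1#) * s * (qi ^ n * qi ^ tri i) * q ^ n
        ≈⟨ solve 4 (λ s t x y → s :* t :+ (:- con (+ 1)) :* s :* (y :* t) :* x := s :* t :- s :* t :* (x :* y)) refl s _ (q ^ n) (qi ^ n) ⟩
      s * qi ^ tri i - s * qi ^ tri i * (q ^ n * qi ^ n)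
        ≈⟨ +-congˡ (-‿cong (trans (*-congˡ (invert n)) (*-identityʳ _))) ⟩
      s * qi ^ tri i - s * qi ^ tri i
        ≈⟨ -‿inverseʳ _ ⟩
      0# ∎
      where s = (- 1#) ^ i

  γ-middle : ∀ i → 2 ℕ.* suc i ≡ N → γ i ≈ - jump i 0
  γ-middle i 2n≡N = begin
    Q.signed i * α̂ i                              ≈⟨ *-congˡ (α̂-middle i 2n≡N) ⟩
    Q.signed i * - q ^ (suc i ℕ.* suc i)           ≈⟨ solve 2 (λ x y → x :* (:- y) := :- (x :* y)) refl _ _ ⟩
    - (Q.signed i * q ^ (suc i ℕ.* suc i))         ≈⟨ -‿cong (signed-cancel i _ _ (square≡tri+tri i)) ⟩
    - ((- 1#) ^ i * q ^ tri (suc i))               ≈⟨ -‿cong (trans (*-congˡ ez₀) (*-identityʳ _)) ⟨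
    - jump i 0                                     ∎

  weight-reflect : ∀ j a b → a ℕ.+ b ≡ N → weight j a ≈ weight j b
  weight-reflect j a b a+b≡N = ^-cong j (q^-≡-mod a+b≡N (a ℕ.* a) (b ℕ.* b) b a (swap a b))
    where
    swap : ∀ a b → a ℕ.* a ℕ.+ b ℕ.* (a ℕ.+ b) ≡ b ℕ.* b ℕ.+ a ℕ.* (a ℕ.+ b)
    swap = solve-∀

  -- Pairs the first term with the last and recurses inwards. Even and odd count the N - 1 terms, so
  -- they are opposite to the parity of N; in `fold-odd` the middle term stays alone.
  fold-even : ∀ κ (g : ℕ → Carrier) →
    sumBelow R (suc κ ℕ.* 2) g ≈ diag κ (λ i x → g i + g (i ℕ.+ suc (x ℕ.* 2)))
  fold-even zero    g = +-congʳ (+-identityˡ _)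
  fold-even (suc κ) g = begin
    sumBelow R (suc (suc κ ℕ.* 2)) g + z                                  ≈⟨ +-congʳ (sum-head (suc κ ℕ.* 2) g) ⟩
    g 0 + sumBelow R (suc κ ℕ.* 2) (λ k → g (suc k)) + z                  ≈⟨ +-congʳ (+-congˡ (fold-even κ _)) ⟩
    g 0 + diag κ (λ i x → g (suc i) + g (suc i ℕ.+ suc (x ℕ.* 2))) + z
      ≈⟨ solve 3 (λ a b c → a :+ b :+ c := (a :+ c) :+ b) refl _ _ _ ⟩
    (g 0 + z) + diag κ (λ i x → g (suc i) + g (suc i ℕ.+ suc (x ℕ.* 2)))  ∎
    where z = g (suc (suc κ ℕ.* 2))

  pair-up : (ℕ → Carrier) → ℕ → ℕ → Carrier
  pair-up g i zero    = g i
  pair-up g i (suc x) = g i + g (i ℕ.+ suc x ℕ.* 2)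

  fold-odd : ∀ κ (g : ℕ → Carrier) → sumBelow R (suc (κ ℕ.* 2)) g ≈ diag κ (pair-up g)
  fold-odd zero    g = +-identityˡ _
  fold-odd (suc κ) g = begin
    sumBelow R (suc (suc (κ ℕ.* 2))) g + z                       ≈⟨ +-congʳ (sum-head (suc (κ ℕ.* 2)) g) ⟩
    g 0 + sumBelow R (suc (κ ℕ.* 2)) (λ k → g (suc k)) + z       ≈⟨ +-congʳ (+-congˡ (fold-odd κ _)) ⟩
    g 0 + diag κ (pair-up (λ k → g (suc k))) + z
      ≈⟨ solve 3 (λ a b c → a :+ b :+ c := (a :+ c) :+ b) refl _ _ _ ⟩
    (g 0 + z) + diag κ (pair-up (λ k → g (suc k)))
      ≈⟨ +-congˡ (diag-cong κ (λ { i zero _ → refl ; i (suc x) _ → refl })) ⟩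
    (g 0 + z) + diag κ (λ i x → pair-up g (suc i) x) ∎
    where z = g (suc κ ℕ.* 2)

  module _ (j : ℕ) where
    g : ℕ → Carrier
    g k = weight j (suc k) * γ k

    folded : ℕ → ℕ → ℕ → Carrier
    folded ρ i x = weight j (suc i) * (jump⁻ (suc i) (x ℕ.* 2 ℕ.+ ρ) - jump i (x ℕ.* 2 ℕ.+ ρ))

    g-pair : ∀ i l l′ → l ≡ suc l′ → 2 ℕ.* suc i ℕ.+ l ≡ N →
      g i + g (i ℕ.+ l) ≈ weight j (suc i) * (jump⁻ (suc i) l - jump i l)
    g-pair i l l′ ≡.refl N≡ = begin
      weight j (suc i) * γ i + weight j (suc (i ℕ.+ l)) * γ (i ℕ.+ l)
        ≈⟨ +-congˡ (*-congʳ (weight-reflect j (suc (i ℕ.+ l)) (suc i) (≡.trans (total i l) N≡))) ⟩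
      weight j (suc i) * γ i + weight j (suc i) * γ (i ℕ.+ l)
        ≈⟨ sym (distribˡ _ _ _) ⟩
      weight j (suc i) * (γ i + γ (i ℕ.+ l))
        ≈⟨ *-congˡ (γ-pair i l (mod₃⁺ l′) N≡) ⟩
      weight j (suc i) * (jump⁻ (suc i) l - jump i l) ∎
      where
      total : ∀ i l → suc (i ℕ.+ l) ℕ.+ suc i ≡ 2 ℕ.* suc i ℕ.+ l
      total = solve-∀

    sum-folded : ∀ κ ρ → ρ ≤ 1 → N ≡ suc κ ℕ.* 2 ℕ.+ ρ → sumBelow R (N ∸ 1) g ≈ diag κ (folded ρ)
    sum-folded κ .0 z≤n N≡ = begin
      sumBelow R (N ∸ 1) g              ≡⟨ ≡.cong (λ m → sumBelow R m g) (≡.trans (≡.cong (_∸ 1) N≡) (≡.cong suc (ℕₚ.+-identityʳ (κ ℕ.* 2)))) ⟩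
      sumBelow R (suc (κ ℕ.* 2)) g      ≈⟨ fold-odd κ g ⟩
      diag κ (pair-up g)                ≈⟨ diag-cong κ pairs ⟩
      diag κ (folded 0)                 ∎
      where
      total : ∀ i x → 2 ℕ.* suc i ℕ.+ (x ℕ.* 2 ℕ.+ 0) ≡ suc (i ℕ.+ x) ℕ.* 2 ℕ.+ 0
      total = solve-∀
      pairs : ∀ i x → i ℕ.+ x ≡ κ → pair-up g i x ≈ folded 0 i x
      -- Here l = 0, so n = i + 1 is N/2 and no partner exists; `jump⁻` contributes its conventional
      -- zero.
      pairs i zero    i+x≡κ = begin
        weight j (suc i) * γ i                            ≈⟨ *-congˡ (γ-middle i (≡.trans (≡.sym (ℕₚ.+-identityʳ _))
                                                               (≡.trans (total i 0) (≡.trans (≡.cong (λ κ → suc κ ℕ.* 2 ℕ.+ 0) i+x≡κ) (≡.sym N≡))))) ⟩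
        weight j (suc i) * - jump i 0                     ≈⟨ *-congˡ (trans (+-congʳ (zeroʳ _)) (+-identityˡ _)) ⟨
        weight j (suc i) * (jump⁻ (suc i) 0 - jump i 0)   ∎
      pairs i (suc x) i+x≡κ = trans (+-congˡ (reflexive (≡.cong (λ l → g (i ℕ.+ l)) (≡.sym (ℕₚ.+-identityʳ (suc x ℕ.* 2))))))
        (g-pair i (suc x ℕ.* 2 ℕ.+ 0) _ ≡.refl
          (≡.trans (total i (suc x)) (≡.trans (≡.cong (λ κ → suc κ ℕ.* 2 ℕ.+ 0) i+x≡κ) (≡.sym N≡))))
    sum-folded κ .1 (s≤s z≤n) N≡ = begin
      sumBelow R (N ∸ 1) g              ≡⟨ ≡.cong (λ m → sumBelow R m g) (≡.trans (≡.cong (_∸ 1) N≡) (≡.cong suc (ℕₚ.+-comm (κ ℕ.* 2) 1))) ⟩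
      sumBelow R (suc κ ℕ.* 2) g        ≈⟨ fold-even κ g ⟩
      diag κ (λ i x → g i + g (i ℕ.+ suc (x ℕ.* 2)))  ≈⟨ diag-cong κ pairs ⟩
      diag κ (folded 1)                 ∎
      where
      total : ∀ i x → 2 ℕ.* suc i ℕ.+ (x ℕ.* 2 ℕ.+ 1) ≡ suc (i ℕ.+ x) ℕ.* 2 ℕ.+ 1
      total = solve-∀
      pairs : ∀ i x → i ℕ.+ x ≡ κ → g i + g (i ℕ.+ suc (x ℕ.* 2)) ≈ folded 1 i x
      pairs i x i+x≡κ = trans (+-congˡ (reflexive (≡.cong (λ l → g (i ℕ.+ l)) (ℕₚ.+-comm 1 (x ℕ.* 2)))))
        (g-pair i (x ℕ.* 2 ℕ.+ 1) (x ℕ.* 2) (ℕₚ.+-comm (x ℕ.* 2) 1)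
          (≡.trans (total i x) (≡.trans (≡.cong (λ κ → suc κ ℕ.* 2 ℕ.+ 1) i+x≡κ) (≡.sym N≡))))

    -- Raising i by one lowers the index of ez by two, which is what `jump⁻` records, so both parts
    -- can be summed over the same antidiagonal. At its end `ez⁻` has argument ρ ≤ 1 and is zero.
    abel-summation : ∀ κ ρ → ρ ≤ 1 →
      diag κ (λ i x → (weight j i - weight j (suc i)) * jump i (x ℕ.* 2 ℕ.+ ρ))
        ≈ weight j 0 * jump 0 (κ ℕ.* 2 ℕ.+ ρ) + diag κ (folded ρ)
    abel-summation κ ρ ρ≤1 = begin
      diag κ (λ i x → (w i - w (suc i)) * J i x)
        ≈⟨ diag-cong κ (λ i x _ → solve 3 (λ a b y → (a :- b) :* y := a :* y :+ :- (b :* y)) refl (w i) (w (suc i)) (J i x)) ⟩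
      diag κ (λ i x → w i * J i x + - (w (suc i) * J i x))
        ≈⟨ diag-+ κ _ _ ⟩
      diag κ (λ i x → w i * J i x) + diag κ (λ i x → - (w (suc i) * J i x))
        ≈⟨ +-congʳ (diag-shift κ (λ i x → w i * J i x) (λ i x → w (suc i) * J⁻ (suc i) x)
             (λ i → trans (*-congˡ (boundary i ρ≤1)) (zeroʳ _)) (λ i x → refl)) ⟨
      w 0 * J 0 κ + diag κ (λ i x → w (suc i) * J⁻ (suc i) x) + diag κ (λ i x → - (w (suc i) * J i x))
        ≈⟨ trans (+-assoc _ _ _) (+-congˡ (sym (diag-+ κ _ _))) ⟩
      w 0 * J 0 κ + diag κ (λ i x → w (suc i) * J⁻ (suc i) x + - (w (suc i) * J i x))
        ≈⟨ +-congˡ (diag-cong κ (λ i x _ → solve 3 (λ a x y → a :* x :+ :- (a :* y) := a :* (x :- y)) refl (w (suc i)) _ _)) ⟩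
      w 0 * J 0 κ + diag κ (folded ρ) ∎
      where
      w = weight j
      J J⁻ : ℕ → ℕ → Carrier
      J  i x = jump i (x ℕ.* 2 ℕ.+ ρ)
      J⁻ i x = jump⁻ i (x ℕ.* 2 ℕ.+ ρ)
      boundary : ∀ i {ρ} → ρ ≤ 1 → jump⁻ (suc i) ρ ≈ 0#
      boundary i z≤n       = zeroʳ _
      boundary i (s≤s z≤n) = zeroʳ _

-- Comparison of the two sides.

choose-2 : ∀ k → suc k choose 2 ≡ tri k
choose-2 zero    = ≡.refl
choose-2 (suc k) = ≡.trans (≡.sym (nCk+nC[k+1]≡[n+1]C[k+1] (suc k) 1))
  (≡.cong₂ ℕ._+_ (nC1≡n (suc k)) (choose-2 k))

halve : ∀ n → ∃[ κ ] ∃[ ρ ] (ρ ≤ 1 × n ≡ κ ℕ.* 2 ℕ.+ ρ)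
halve zero          = 0 , 0 , z≤n , ≡.refl
halve (suc zero)    = 0 , 1 , s≤s z≤n , ≡.refl
halve (suc (suc n)) with halve n
... | κ , ρ , ρ≤1 , ≡.refl = suc κ , ρ , ρ≤1 , ≡.refl

module Evaluation {c ℓ : Level} (R : CommutativeRing c ℓ) (domain : IsIntegralDomain R) (charZero : CharZero R)
  (N : ℕ) (1≤N : 1 ≤ N) (q : CommutativeRing.Carrier R) (primitive-root : PrimitiveRoot R N q)
  (qi : CommutativeRing.Carrier R)
  (q·qi≈1 : CommutativeRing._≈_ R (CommutativeRing._*_ R q qi) (CommutativeRing.1# R))
  (h : CommutativeRing.Carrier R)
  (h+h≈1 : CommutativeRing._≈_ R (CommutativeRing._+_ R h h) (CommutativeRing.1# R)) where
  open CommutativeRing R hiding (zero)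
  open FiniteSums R
  open RootOfUnity R domain N 1≤N q primitive-root qi q·qi≈1
  open ClosedForms R domain N 1≤N q primitive-root qi q·qi≈1 using (α̂)
  open Folding R domain N 1≤N q primitive-root qi q·qi≈1
  open BaileyChain R q using (weight)
  open import Relation.Binary.Reasoning.Setoid setoid

  zpow-⊖ : ∀ m n → zpow R q qi (m ℤ.⊖ n) ≈ q ^ m * qi ^ n
  zpow-⊖ m       zero    = sym (*-identityʳ _)
  zpow-⊖ zero    (suc n) = sym (*-identityˡ _)
  zpow-⊖ (suc m) (suc n) = begin
    zpow R q qi (suc m ℤ.⊖ suc n)   ≡⟨ ≡.cong (zpow R q qi) (ℤₚ.[1+m]⊖[1+n]≡m⊖n m n) ⟩
    zpow R q qi (m ℤ.⊖ n)           ≈⟨ zpow-⊖ m n ⟩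
    q ^ m * qi ^ n                  ≈⟨ trans (*-congʳ q·qi≈1) (*-identityˡ _) ⟨
    q * qi * (q ^ m * qi ^ n)
      ≈⟨ solve 4 (λ x y a b → x :* y :* (a :* b) := x :* a :* (y :* b)) refl q qi (q ^ m) (qi ^ n) ⟩
    q ^ suc m * qi ^ suc n          ∎

  zpow-difference : ∀ m n → zpow R q qi (ℤ.- (+ n) ℤ.+ + m) ≈ q ^ m * qi ^ n
  zpow-difference m zero    = sym (*-identityʳ _)
  zpow-difference m (suc n) = zpow-⊖ m (suc n)

  -- The prefactor q^p completes the square, p + p(k² + 2k) = p(k+1)², and cancels q^(-p) in the
  -- last term.
  rhs≈ : ∀ j → rhs R q qi h N (suc j) ≈ sumBelow R (N ∸ 1) (g (suc j)) + h * α̂ (N ∸ 1)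
  rhs≈ j = begin
    q ^ p * (sumBelow R (N ∸ 1) term + h * qi ^ p * α̂ (N ∸ 1))
      ≈⟨ solve 5 (λ x s h y a → x :* (s :+ h :* y :* a) := x :* s :+ (x :* y) :* (h :* a)) refl (q ^ p) _ h (qi ^ p) _ ⟩
    q ^ p * sumBelow R (N ∸ 1) term + q ^ p * qi ^ p * (h * α̂ (N ∸ 1))
      ≈⟨ +-cong (sym (sum-*ˡ (N ∸ 1) (q ^ p) term)) (trans (*-congʳ (invert p)) (*-identityˡ _)) ⟩
    sumBelow R (N ∸ 1) (λ k → q ^ p * term k) + h * α̂ (N ∸ 1)
      ≈⟨ +-congʳ (sum-cong (N ∸ 1) (λ k _ → term≈ k)) ⟩
    sumBelow R (N ∸ 1) (g p) + h * α̂ (N ∸ 1) ∎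
    where
    p = suc j
    term : ℕ → Carrier
    term k = (- 1#) ^ k * zpow R q qi (ℤ.- (+ (suc k choose 2)) ℤ.+ + (p ℕ.* (k ℕ.* k ℕ.+ 2 ℕ.* k))) * α̂ k
    complete-square : ∀ p k → p ℕ.+ p ℕ.* (k ℕ.* k ℕ.+ 2 ℕ.* k) ≡ p ℕ.* (suc k ℕ.* suc k)
    complete-square = solve-∀
    weight≈ : ∀ k → q ^ p * q ^ (p ℕ.* (k ℕ.* k ℕ.+ 2 ℕ.* k)) ≈ weight p (suc k)
    weight≈ k = trans (sym (^-+ q p _)) (trans (^-≡ q (complete-square p k)) (^-* q p (suc k ℕ.* suc k)))
    term≈ : ∀ k → q ^ p * term k ≈ g p k
    term≈ k = begin
      q ^ p * term k
        ≈⟨ *-congˡ (*-congʳ (*-congˡ (trans (zpow-difference _ (suc k choose 2)) (*-congˡ (^-≡ qi (choose-2 k)))))) ⟩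
      q ^ p * ((- 1#) ^ k * (q ^ (p ℕ.* (k ℕ.* k ℕ.+ 2 ℕ.* k)) * qi ^ tri k) * α̂ k)
        ≈⟨ solve 5 (λ x s y t a → x :* (s :* (y :* t) :* a) := (x :* y) :* (s :* t :* a)) refl (q ^ p) _ _ _ (α̂ k) ⟩
      q ^ p * q ^ (p ℕ.* (k ℕ.* k ℕ.+ 2 ℕ.* k)) * γ k
        ≈⟨ *-congʳ (weight≈ k) ⟩
      g p k ∎

  -- No summand beyond m = 0 survives and the right-hand sum is empty; both sides are 1/2.
  theorem-for-1 : N ≡ 1 → ∀ j M → N ≤ M → - h + Htrunc R q (suc j) M ≈ rhs R q qi h N (suc j)
  theorem-for-1 N≡1 j M N≤M = begin
    - h + Htrunc R q (suc j) M
      ≈⟨ +-congˡ (Htrunc-stable charZero j 0 M (≡.subst (_< 2) (≡.sym N≡1) (s≤s (s≤s z≤n))) (≡.subst (_≤ M) N≡1 N≤M)) ⟩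
    - h + (0# + summand charZero j 0)
      ≈⟨ +-congˡ (trans (+-identityˡ _) (trans (summand₀ charZero j) (sym h+h≈1))) ⟩
    - h + (h + h)
      ≈⟨ solve 1 (λ h → :- h :+ (h :+ h) := con (+ 0) :+ h :* con (+ 1)) refl h ⟩
    sumBelow R 0 (g (suc j)) + h * α̂ 0
      ≡⟨ ≡.cong (λ N → sumBelow R (N ∸ 1) (g (suc j)) + h * α̂ (N ∸ 1)) N≡1 ⟨
    sumBelow R (N ∸ 1) (g (suc j)) + h * α̂ (N ∸ 1)
      ≈⟨ rhs≈ j ⟨
    rhs R q qi h N (suc j) ∎

  -- Summation by parts leaves the boundary term J = q ez (N-2). As -1/2 + 1 = 1/2, the terms 1/2 +
  -- J are accounted for by `α̂-last`, which gives half of 1 + 2J.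
  theorem-beyond-1 : ∀ κ ρ → ρ ≤ 1 → N ≡ suc κ ℕ.* 2 ℕ.+ ρ → ∀ j M → N ≤ M →
    - h + Htrunc R q (suc j) M ≈ rhs R q qi h N (suc j)
  theorem-beyond-1 κ ρ ρ≤1 N≡ j M N≤M = begin
    - h + Htrunc R q (suc j) M
      ≈⟨ +-congˡ (Htrunc-stable charZero j (suc κ) M N<4+2κ 2+κ≤M) ⟩
    - h + sumBelow R (suc (suc κ)) (summand charZero j)
      ≈⟨ +-congˡ (trans (sum-head (suc κ) _) (+-cong (summand₀ charZero j)
           (trans (nonzero-summands charZero j κ ρ ρ≤1 N≡) (abel-summation p κ ρ ρ≤1)))) ⟩
    - h + (1# + (weight p 0 * J + S))
      ≈⟨ +-congˡ (+-cong (sym h+h≈1) (+-congʳ (trans (*-congʳ (1^ p)) (*-identityˡ J)))) ⟩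
    - h + (h + h + (J + S))
      ≈⟨ solve 3 (λ h j s → :- h :+ (h :+ h :+ (j :+ s)) := s :+ (h :+ con (+ 1) :* j)) refl h J S ⟩
    S + (h + 1# * J)
      -- Writing J as (h + h) J exposes the common factor `h`.
      ≈⟨ +-congˡ (+-congˡ (*-congʳ (sym h+h≈1))) ⟩
    S + (h + (h + h) * J)
      ≈⟨ solve 3 (λ h j s → s :+ (h :+ (h :+ h) :* j) := s :+ h :* (con (+ 1) :+ (j :+ j))) refl h J S ⟩
    S + h * (1# + (J + J))
      ≈⟨ +-cong (sym (sum-folded p κ ρ ρ≤1 N≡)) (*-congˡ (sym last)) ⟩
    sumBelow R (N ∸ 1) (g p) + h * α̂ (N ∸ 1)
      ≈⟨ rhs≈ j ⟨
    rhs R q qi h N (suc j) ∎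
    where
    p = suc j
    J = jump 0 (κ ℕ.* 2 ℕ.+ ρ)
    S = diag κ (folded p ρ)
    J≈ : q ^ 1 * ez⁻ N ≈ J
    J≈ = *-cong (sym (*-identityˡ _)) (ez⁻-≡ N≡)
    last : α̂ (N ∸ 1) ≈ 1# + (J + J)
    last = trans (α̂-last (N ∸ 1) (ℕₚ.m+[n∸m]≡n 1≤N)) (+-congˡ (+-cong J≈ J≈))
    upper : ∀ κ → suc κ ℕ.* 2 ℕ.+ 2 ≡ suc (suc κ) ℕ.+ suc (suc κ)
    upper = solve-∀
    N<4+2κ : N < suc (suc κ) ℕ.+ suc (suc κ)
    N<4+2κ = ≡.subst₂ _<_ (≡.sym N≡) (upper κ) (ℕₚ.+-monoʳ-< (suc κ ℕ.* 2) (s≤s ρ≤1))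
    2+κ≤M : suc (suc κ) ≤ M
    2+κ≤M = ℕₚ.≤-trans (s≤s (s≤s (ℕₚ.≤-trans (ℕₚ.m≤m*n κ 2) (ℕₚ.m≤m+n (κ ℕ.* 2) ρ)))) (≡.subst (_≤ M) N≡ N≤M)

theorem2p15 : {c ℓ : Level} (R : CommutativeRing c ℓ) →
    IsIntegralDomain R → CharZero R →
    (N : ℕ) → 1 ≤ N →
    (q : CommutativeRing.Carrier R) → PrimitiveRoot R N q →
    (qi : CommutativeRing.Carrier R) → CommutativeRing._≈_ R (CommutativeRing._*_ R q qi) (CommutativeRing.1# R) →
    (h : CommutativeRing.Carrier R) → CommutativeRing._≈_ R (CommutativeRing._+_ R h h) (CommutativeRing.1# R) →
    (p : ℕ) → 1 ≤ p →
    (M : ℕ) → N ≤ M →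
    CommutativeRing._≈_ R
    (CommutativeRing._+_ R (CommutativeRing.-_ R h) (Htrunc R q p M))
    (rhs R q qi h N p)
theorem2p15 R domain charZero N 1≤N q primitive-root qi q·qi≈1 h h+h≈1 (suc j) 1≤p M N≤M with halve N
... | suc κ , ρ , ρ≤1 , N≡ = theorem-beyond-1 κ ρ ρ≤1 N≡ j M N≤M
  where open Evaluation R domain charZero N 1≤N q primitive-root qi q·qi≈1 h h+h≈1
... | zero , ρ , ρ≤1 , N≡ = theorem-for-1 (ℕₚ.≤-antisym (≡.subst (_≤ 1) (≡.sym N≡) ρ≤1) 1≤N) j M N≤M
  where open Evaluation R domain charZero N 1≤N q primitive-root qi q·qi≈1 h h+h≈1
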